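{- Let $m\ge1$ and define on intervals of $\mathrm{Tam}_n^m$ (via their $m$-interval-posets) $\beta_m=\mathrm{contract}\circ\beta\circ\mathrm{expand}$. Then $\beta_m$ is an involution on the intervals of $\mathrm{Tam}_n^m$ such that for every interval $I$ and every commutative alphabet $X$: $\mathrm{mrises}(I)=\mathrm{mcontacts}(\beta_m(I))$, $\mathrm{mRiseMon}(I,X)=\mathrm{mContactMon}(\beta_m(I),X)$, and $\mathrm{dist}(I)=\mathrm{dist}(\beta_m(I))$.
   Context: $m$-ballot paths of size $n$: lattice paths from $(0,0)$ to $(nm,n)$ with unit vertical/horizontal steps weakly above $y=x/m$. $\mathrm{DD}(B)$ is the Dyck path of size $nm$ replacing each vertical step by $m$ up-steps and each horizontal step by one down-step. $\mathrm{Tam}_n^m$: $B\le B'$ iff $\mathrm{DD}(B)\le\mathrm{DD}(B')$ in the Tamari order on Dyck paths of size $nm$ (equivalently the order generated by $m$-ballot rotations; the images form an upper ideal). $\mathrm{dist}(I)$ for $I=[B_1,B_2]$ is the maximal chain length from $B_1$ to $B_2$ in $\mathrm{Tam}_n^m$. The interval $I=[B_1,B_2]$ corresponds to the interval-poset (defined below) of the Tamari interval $[\mathrm{DD}(B_1),\mathrm{DD}(B_2)]$; these are exactly the $m$-interval-posets: interval-posets of size $nm$ with $im\triangleleft im-1\triangleleft\dots\triangleleft im-(m-1)$ for all $1\le i\le n$. Tamari background: Dyck paths are words in up $1$/down $0$; $\mathrm{tree}(D_1 1 D_2 0)$ has left subtree $\mathrm{tree}(D_1)$, right subtree $\mathrm{tree}(D_2)$;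 Tamari order generated by right rotations $y(x(A,B),C)\to x(A,y(B,C))$; nodes $v_1,\dots,v_N$ in in-order. An interval-poset of size $N$ is a partial order $\triangleleft$ on $\{1,\dots,N\}$ with $a\triangleleft c\Rightarrow b\triangleleft c$ and $c\triangleleft a\Rightarrow b\triangleleft a$ for $a<b<c$; the Tamari interval $[T_1,T_2]$ corresponds to the interval-poset where, for $a<b$, $b\triangleleft a$ iff $v_b$ in right subtree of $v_a$ in $T_1$, $a\triangleleft b$ iff $v_a$ in left subtree of $v_b$ in $T_2$. Grafting trees, $\mathrm{Graft}$, $\beta$: $u$ = interval-poset of size 1. Shifted concatenation of $I_1$ (size $n_1$) and $I_2$: relations of $I_1$ and of $I_2$ shifted by $n_1$. Left grafting $I_1\prec I_2$ ($I_2$ nonempty): add $y\triangleleft n_1+1$ for all $y\le n_1$; $\emptyset\prec I_2=I_2$. Right grafting $I_1\succ_r I_2$ ($I_1$ nonempty, $0\le r\le c$, $y_1<\dots<y_c$ the shifted decreasing roots of $I_2$, i.e. vertices $b$ with no $a<b$, $b\triangleleft a$): add $y_i\triangleleft n_1$ for $i\le r$; $I_1\succ_0\emptyset=I_1$. A grafting tree is a binary tree $T$ with labels $\ell(v)\in\mathbb N$ satisfying $\ell(v)\le\mathrm{size}(T_R(v))-\sum_{w\in T_R(v)}\ell(w)$ for all nodes $v$ ($T_R(v)$ the right subtree). $\mathrm{Graft}^{ -1}(\emptyset)=\emptyset$, $\mathrm{Graft}^{ -1}(T,\ell)=\mathrm{Graft}^{ -1}(T_L,\ell)\prec(u\succ_{\ell(\mathrm{root})}\mathrm{Graft}^{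 -1}(T_R,\ell))$; this is a bijection with inverse $\mathrm{Graft}$. The left branch involution $\mathrm{LB}$ on binary trees: $\mathrm{LB}(\emptyset)=\emptyset$; for $T=v(T_L,T_R)$, $\mathrm{LB}(T)$ is $\mathrm{LB}(T_L)$ with the node $v$ (empty left subtree, right subtree $\mathrm{LB}(T_R)$) attached as left child of its leftmost node (or equal to $v(\emptyset,\mathrm{LB}(T_R))$ if $T_L=\emptyset$); labels travel with nodes; on intervals $\mathrm{LB}(I)=\mathrm{Graft}^{ -1}(\mathrm{LB}(\mathrm{Graft}(I)))$. $\mathrm{compl}(I)$: $i\triangleleft j$ iff $(N+1-i)\triangleleft_I(N+1-j)$. $\beta=\mathrm{LB}\circ\mathrm{compl}\circ\mathrm{LB}$. Expansion/contraction: for a grafting tree $(T,\ell)$ of size $nm$, $\mathrm{expand}(T,\ell)=(T,\ell')$ with $\ell'(v_i)=m\ell(v_i)$ if $m\mid i$ and $\ell'(v_i)=m(\ell(v_i)-1)$ otherwise; $\mathrm{contract}(T,\ell')=(T,\ell)$ with $\ell(v_i)=\ell'(v_i)/m$ if $m\mid i$ and $\ell'(v_i)/m+1$ otherwise. These act on interval-posets through $\mathrm{Graft}$. $m$-statistics of an $m$-ballot path $B$: $\mathrm{mcontacts}(B)$ = number of points on $y=x/m$ except the last; $\mathrm{mrises}(B)$ = number of initial vertical steps; for the $i$-th vertical step starting at $(a,b)$ and $1\le j\le m$, $c_{i,j}(B)$ = number of non-final contacts between the line $\ell_{i,j}$ of slope $1/m$ through $(a,b+j/m)$ and the maximal portion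 of $B$ starting at $(a,b+1)$ staying weakly above $\ell_{i,j}$; $r_i(B)$ = number of vertical steps immediately after the $i$-th horizontal step. $m$-contact vector $(\mathrm{mcontacts},c_{1,1},\dots,c_{1,m},\dots,c_{n,1},\dots,c_{n,m-1})$, $m$-rise vector $(\mathrm{mrises},r_1,\dots,r_{nm-1})$; $\mathrm{mContactMon}(B,X)$, $\mathrm{mRiseMon}(B,X)$ are the products of $x_v$ over their entries $v$. For $I=[B_1,B_2]$, contact statistics are those of $B_1$, rise statistics those of $B_2$. -}

module Defs where

open import Level using (Level)
open import Data.Bool.Base using (Bool; true; false; _∧_; _∨_; not; if_then_else_)
open import Data.Nat.Base using (ℕ; zero; suc; _+_; _*_; _∸_; _≤_; _/_; NonZero; _≡ᵇ_; _<ᵇ_; _≤ᵇ_)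
open import Data.Nat.Divisibility using (_∣?_)
open import Data.List.Base using (List; []; _∷_; length; map; upTo; take; concatMap; filterᵇ; foldr)
open import Data.Bool.ListAction using (any)
open import Data.Product.Base using (Σ; _×_)
open import Data.Unit.Base using (⊤)
open import Relation.Nullary.Decidable.Core using (does)
open import Relation.Nullary.Negation.Core using (¬_)
open import Relation.Binary.PropositionalEquality.Core using (_≡_)
open import Relation.Binary.Construct.Closure.ReflexiveTransitive using (Star)
open import Algebra.Bundles using (CommutativeMonoid)

range1 : ℕ → List ℕ
range1 n = map suc (upTo n)

dropLast : {A : Set} → List A → List A
dropLast []           = []
dropLast (x ∷ [])     = []
dropLast (x ∷ y ∷ xs) = x ∷ dropLast (y ∷ xs)

countTrue : List Bool → ℕ
countTrue []          = 0
countTrue (true ∷ s)  = suc (countTrue s)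
countTrue (false ∷ s) = countTrue s

countFalse : List Bool → ℕ
countFalse []          = 0
countFalse (true ∷ s)  = countFalse s
countFalse (false ∷ s) = suc (countFalse s)

countZeros : List ℕ → ℕ
countZeros []          = 0
countZeros (zero ∷ s)  = suc (countZeros s)
countZeros (suc _ ∷ s) = countZeros s

data BinTree : Set where
  leaf : BinTree
  node : BinTree → BinTree → BinTree

bsize : BinTree → ℕ
bsize leaf       = 0
bsize (node L R) = suc (bsize L + bsize R)

-- Dyck words: true = up step 1, false = down step 0.
-- tree(D1 1 D2 0) = node (tree D1) (tree D2), computed by a left-to-right
-- stack parser (acc = tree of the current level, stack = saved left parts).
parse : List Bool → BinTree → List BinTree → BinTree
parse []            acc st       = acc
parse (true  ∷ w)   acc st       = parse w leaf (acc ∷ st)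
parse (false ∷ w)   acc []       = parse w acc []      -- never used on Dyck words
parse (false ∷ w)   acc (s ∷ st) = parse w (node s acc) st

tree : List Bool → BinTree
tree w = parse w leaf []

data _⟶_ : BinTree → BinTree → Set where
  rot   : ∀ {A B C} → node (node A B) C ⟶ node A (node B C)
  left  : ∀ {L L' R} → L ⟶ L' → node L R ⟶ node L' R
  right : ∀ {L R R'} → R ⟶ R' → node L R ⟶ node L R'

_≤T_ : BinTree → BinTree → Set
T ≤T T' = Star _⟶_ T T'

_≤Dyck_ : List Bool → List Bool → Set
D ≤Dyck D' = tree D ≤T tree D'

-- m-ballot paths (true = vertical step, false = horizontal step)

-- from (0,0) to (nm,n), weakly above y = x/m (i.e. x ≤ m y at every point)
IsBallot : ℕ → ℕ → List Bool → Set
IsBallot m n B =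
  countTrue B ≡ n × countFalse B ≡ n * m ×
  (∀ k → countFalse (take k B) ≤ m * countTrue (take k B))

DD : ℕ → List Bool → List Bool
DD m = concatMap step
  where
  rep : ℕ → List Bool
  rep zero    = []
  rep (suc k) = true ∷ rep k
  step : Bool → List Bool
  step true  = rep m
  step false = false ∷ []

_≤[_]_ : List Bool → ℕ → List Bool → Set
B ≤[ m ] B' = DD m B ≤Dyck DD m B'

_<[_]_ : List Bool → ℕ → List Bool → Set
B <[ m ] B' = B ≤[ m ] B' × ¬ (B ≡ B')

record Interval (m n : ℕ) : Set where
  field
    low    : List Bool
    high   : List Bool
    lowOK  : IsBallot m n low
    highOK : IsBallot m n high
    le     : low ≤[ m ] high
open Interval public

SameInterval : ∀ {m n} → Interval m n → Interval m n → Set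
SameInterval I J = low I ≡ low J × high I ≡ high J

data Chain (m n : ℕ) : List Bool → List Bool → ℕ → Set where
  done : ∀ {B} → Chain m n B B 0
  step : ∀ {B C B' k} → IsBallot m n C → B <[ m ] C → Chain m n C B' k →
         Chain m n B B' (suc k)

IsDist : (m n : ℕ) → Interval m n → ℕ → Set
IsDist m n I d = Chain m n (low I) (high I) d ×
                 (∀ k → Chain m n (low I) (high I) k → k ≤ d)

-- Interval-posets, as Boolean relations on {1..size}

record IPoset : Set where
  constructor ip
  field
    isz : ℕ
    rel : ℕ → ℕ → Bool     -- rel a b = true  iff  a ◁ b
open IPoset public

inRange : ℕ → ℕ → Bool
inRange N a = (1 ≤ᵇ a) ∧ (a ≤ᵇ N)

_≈IP_ : IPoset → IPoset → Set
P ≈IP Q = isz P ≡ isz Q ×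
  (∀ a b → 1 ≤ a → a ≤ isz P → 1 ≤ b → b ≤ isz P → rel P a b ≡ rel Q a b)

-- Warshall: transitive closure through intermediate vertices 1..k
warshall : ℕ → (ℕ → ℕ → Bool) → ℕ → ℕ → Bool
warshall zero    R a b = R a b
warshall (suc k) R a b =
  warshall k R a b ∨ (warshall k R a (suc k) ∧ warshall k R (suc k) b)

closure : ℕ → (ℕ → ℕ → Bool) → IPoset
closure N R = ip N (λ a b → inRange N a ∧ inRange N b ∧ ((a ≡ᵇ b) ∨ warshall N R a b))

-- v_b in the right subtree of v_a (in-order labels 1..size)
inRight : BinTree → ℕ → ℕ → Bool
inRight leaf       a b = false
inRight (node L R) a b =
  if a ≡ᵇ r then (r <ᵇ b) ∧ (b ≤ᵇ r + bsize R)
  else if a <ᵇ r then inRight L a b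
  else inRight R (a ∸ r) (b ∸ r)
  where r = suc (bsize L)

inLeft : BinTree → ℕ → ℕ → Bool
inLeft leaf       a b = false
inLeft (node L R) a b =
  if b ≡ᵇ r then (1 ≤ᵇ a) ∧ (a <ᵇ r)
  else if b <ᵇ r then inLeft L a b
  else inLeft R (a ∸ r) (b ∸ r)
  where r = suc (bsize L)

ipOfTrees : BinTree → BinTree → IPoset
ipOfTrees T1 T2 = ip N (λ a b → inRange N a ∧ inRange N b ∧
                         ((a ≡ᵇ b) ∨ inRight T1 b a ∨ inLeft T2 a b))
  where N = bsize T1

ipOf : ∀ {m n} → Interval m n → IPoset
ipOf {m} I = ipOfTrees (tree (DD m (low I))) (tree (DD m (high I)))

uIP : IPoset
uIP = ip 1 (λ a b → (a ≡ᵇ 1) ∧ (b ≡ᵇ 1))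

emptyIP : IPoset
emptyIP = ip 0 (λ _ _ → false)

shiftRel : IPoset → IPoset → ℕ → ℕ → Bool
shiftRel (ip n1 R1) (ip n2 R2) a b =
  (inRange n1 a ∧ inRange n1 b ∧ R1 a b) ∨
  ((n1 <ᵇ a) ∧ (n1 <ᵇ b) ∧ R2 (a ∸ n1) (b ∸ n1))

decRoots : IPoset → List ℕ
decRoots (ip n R) = filterᵇ (λ b → not (any (λ a → R b a) (range1 (b ∸ 1)))) (range1 n)

member : ℕ → List ℕ → Bool
member x ys = any (λ y → x ≡ᵇ y) ys

_≺_ : IPoset → IPoset → IPoset
I1 ≺ I2 = closure (n1 + isz I2)
  (λ a b → shiftRel I1 I2 a b ∨ (inRange n1 a ∧ (b ≡ᵇ suc n1)))
  where n1 = isz I1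

_≻[_]_ : IPoset → ℕ → IPoset → IPoset
I1 ≻[ r ] I2 = closure (n1 + isz I2)
  (λ a b → shiftRel I1 I2 a b ∨
           (member a (map (n1 +_) (take r (decRoots I2))) ∧ (b ≡ᵇ n1)))
  where n1 = isz I1

compl : IPoset → IPoset
compl (ip N R) = ip N (λ i j → inRange N i ∧ inRange N j ∧ R (suc N ∸ i) (suc N ∸ j))

data LTree : Set where
  lleaf : LTree
  lnode : ℕ → LTree → LTree → LTree

lsize : LTree → ℕ
lsize lleaf         = 0
lsize (lnode _ L R) = suc (lsize L + lsize R)

labelSum : LTree → ℕ
labelSum lleaf         = 0
labelSum (lnode l L R) = l + labelSum L + labelSum R

-- ℓ(v) ≤ size(T_R(v)) - Σ_{w ∈ T_R(v)} ℓ(w)  for all nodes v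
-- (written without truncated subtraction)
ValidGT : LTree → Set
ValidGT lleaf         = ⊤
ValidGT (lnode l L R) = l + labelSum R ≤ lsize R × ValidGT L × ValidGT R

graftInv : LTree → IPoset
graftInv lleaf         = emptyIP
graftInv (lnode l L R) = graftInv L ≺ (uIP ≻[ l ] graftInv R)

IsGraft : LTree → IPoset → Set
IsGraft G P = ValidGT G × (graftInv G ≈IP P)

attachLeftmost : LTree → LTree → LTree
attachLeftmost lleaf         X = X
attachLeftmost (lnode l A B) X = lnode l (attachLeftmost A X) B

LB : LTree → LTree
LB lleaf         = lleaf
LB (lnode l L R) = attachLeftmost (LB L) (lnode l lleaf (LB R))

relabel : (ℕ → ℕ → ℕ) → ℕ → LTree → LTree
relabel f k lleaf         = lleaf
relabel f k (lnode l L R) = lnode (f i l) (relabel f k L) (relabel f i R)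
  where i = suc (k + lsize L)

expand : ℕ → LTree → LTree
expand m = relabel (λ i l → if does (m ∣? i) then m * l else m * (l ∸ 1)) 0

contract : (m : ℕ) .{{_ : NonZero m}} → LTree → LTree
contract m = relabel (λ i l → if does (m ∣? i) then l / m else suc (l / m)) 0

-- β_m = contract ∘ β ∘ expand, β = LB ∘ compl ∘ LB,
-- LB(P) = Graft⁻¹(LB(Graft P)).  Graft is given as the inverse of Graft⁻¹,
-- hence the witnesses g0..g3 below.
record BetaM (m n : ℕ) .{{_ : NonZero m}} (I J : Interval m n) : Set where
  field
    g0 g1 g2 g3 : LTree
    is0 : IsGraft g0 (ipOf I)
    is1 : IsGraft g1 (graftInv (expand m g0))
    is2 : IsGraft g2 (compl (graftInv (LB g1)))
    is3 : IsGraft g3 (graftInv (LB g2))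
    res : ipOf J ≈IP graftInv (contract m g3)

-- points on y = x/m (x = m y), except the last point
mcontacts : ℕ → List Bool → ℕ
mcontacts m B = length (filterᵇ (λ k → countFalse (take k B) ≡ᵇ m * countTrue (take k B))
                                (upTo (length B)))

leading : List Bool → ℕ
leading []          = 0
leading (true ∷ s)  = suc (leading s)
leading (false ∷ s) = 0

mrises : List Bool → ℕ
mrises = leading

vSuffixes : List Bool → List (List Bool)
vSuffixes []          = []
vSuffixes (true ∷ s)  = s ∷ vSuffixes s
vSuffixes (false ∷ s) = vSuffixes s

-- heights h = m y - x - (m b + j - a) above the line ℓ_{i,j} of the points of
-- the maximal portion staying weakly above ℓ_{i,j}
portion : ℕ → ℕ → List Bool → List ℕ
portion m h       []          = h ∷ []
portion m h       (true ∷ s)  = h ∷ portion m (h + m) s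
portion m zero    (false ∷ s) = zero ∷ []
portion m (suc h) (false ∷ s) = suc h ∷ portion m h s

-- c_{i,j}: s is the rest of the path after the i-th vertical step;
-- the portion starts at (a,b+1), at height m - j above ℓ_{i,j}
cij : ℕ → List Bool → ℕ → ℕ
cij m s j = countZeros (dropLast (portion m (m ∸ j) s))

contactVec : ℕ → List Bool → List ℕ
contactVec m B = mcontacts m B ∷
  dropLast (concatMap (λ s → map (cij m s) (range1 m)) (vSuffixes B))

rList : List Bool → List ℕ
rList []          = []
rList (true ∷ s)  = rList s
rList (false ∷ s) = leading s ∷ rList s

riseVec : List Bool → List ℕ
riseVec B = mrises B ∷ dropLast (rList B)

monomial : ∀ {c ℓ} (M : CommutativeMonoid c ℓ) → (ℕ → CommutativeMonoid.Carrier M) →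
           List ℕ → CommutativeMonoid.Carrier M
monomial M x = foldr (λ v acc → x v ∙ acc) ε
  where open CommutativeMonoid M

mContactMon : ∀ {c ℓ} (M : CommutativeMonoid c ℓ) → ℕ → (ℕ → CommutativeMonoid.Carrier M) →
              List Bool → CommutativeMonoid.Carrier M
mContactMon M m x B = monomial M x (contactVec m B)

mRiseMon : ∀ {c ℓ} (M : CommutativeMonoid c ℓ) → (ℕ → CommutativeMonoid.Carrier M) →
           List Bool → CommutativeMonoid.Carrier M
mRiseMon M x B = monomial M x (riseVec B)

{-# OPTIONS --safe #-}
-- A grafting tree (T,ℓ) is the Tamari interval whose upper bound is T and whose
-- lower bound is the tree with ℓ as sequence of right arities (numbers of
-- children in the decreasing forest).  The quantity
--   slack(T,ℓ) = Σ_v (size(T_R(v)) - ℓ(v) - Σ_{w ∈ T_R(v)} ℓ(w))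
-- grows by at least 1 under each rotation of the upper bound, and some rotation
-- back lowers it by exactly 1; so it is the length of the longest chain.  Hence
-- compl, which reverses chains, preserves it, and LB clearly does.  The
-- rises of LB(T) are the right arities of the mirror image of T, read in order,
-- so compl followed by LB turns labels into rises, and β exchanges the two.
-- Therefore β preserves the intervals whose rises and contacts are all divisible
-- by m, which are the expanded m-intervals.  On these, expansion multiplies the
-- contacts by m and maps the slack s to m s + const, with a constant depending
-- on the size only.
module Submission where

open import Defs
open import Data.Bool.Base using (Bool; true; false; T; _∧_; _∨_; not; if_then_else_)
open import Data.Nat.Base
open import Data.Nat.Properties
open import Data.Nat.Tactic.RingSolver using (solve-∀)
open import Data.List.Base hiding (any; sum)
open import Data.List.Properties hiding (sum-++)
open import Data.Nat.ListAction using (sum)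
open import Data.Nat.ListAction.Properties using (sum-++; sum-↭)
open import Data.List.Relation.Binary.Permutation.Propositional using (_↭_; ↭-refl; ↭-sym; ↭-trans; ↭-reflexive; ↭-prep; module PermutationReasoning)
open import Data.List.Relation.Binary.Permutation.Propositional.Properties using (++-comm; ++⁺; map⁺; drop-mid; ↭-length; All-resp-↭)
open import Data.Product.Base using (Σ; ∃; _×_; _,_; proj₁; proj₂)
open import Data.Sum.Base using (_⊎_; inj₁; inj₂)
open import Data.Empty using (⊥; ⊥-elim)
open import Data.Unit.Base using (⊤; tt)
open import Function.Base using (_∘_; id)
open import Relation.Nullary using (¬_; Dec; yes; no)
open import Relation.Nullary.Decidable.Core using (T?; does)
open import Relation.Binary.PropositionalEquality using (_≡_; _≢_; refl; sym; trans; cong; cong₂; subst; subst₂; module ≡-Reasoning)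
open import Relation.Binary.Construct.Closure.ReflexiveTransitive using (ε; _◅_)
open import Function.Bundles using (_⇔_; mk⇔; Equivalence)
open import Data.Bool.Properties using (T-∧; T-∨)
open import Data.List.Membership.Propositional using (_∈_)
open import Data.List.Membership.Propositional.Properties using (∈-++⁺ˡ; ∈-++⁺ʳ; ∈-++⁻; ∈-map⁺; ∈-map⁻; ∈-upTo⁺; ∈-upTo⁻)
open import Data.List.Relation.Unary.Any using (here; there)
open import Data.List.Relation.Unary.All as All using (All; []; _∷_)
open import Data.Bool.ListAction using (any)
open import Data.Nat.Divisibility using (_∣_; _∣?_; _∣0; ∣m∣n⇒∣m+n; ∣m+n∣m⇒∣n; ∣-refl; ∣⇒≤; m∣m*n)
open import Data.Nat.DivMod using (m*n/n≡m; m/n*n≡m)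
open import Algebra.Bundles using (CommutativeMonoid)

-- Binary trees

-- The slack bounds chains because it depends on the interval alone: upper and lower bound determine
-- the grafting tree, so every chain, applied rotation by rotation to the tree of a one-element
-- interval, ends in the same tree. Posets enter only through positions. The vertices below a by
-- decreasing relations are those just after position a, as many as the right subtree of a in the
-- lower bound has nodes; increasing relations use left subtrees of the upper bound. These sizes
-- determine both trees, so every witness in `BetaM` is forced, and `compl` swaps the two trees and
-- mirrors them. Let ρ_i be the residue of -i modulo m. Both cases of the expansion are the one
-- formula m ℓ - (m-1) + ρ_{i+1} - ρ_i, so label sums telescope. In the upper bound of an m-interval
-- the subtree of every node ends at a multiple of m, where ρ vanishes; hence a contribution d to
-- the slack becomes m d + ρ_i, and the constant is the sum of all ρ_i. Finally, rotations never
-- leave the trees of m-ballot paths, so longest chains of Tam_n^m are longest Tamari chains of size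
-- nm.

mirror : BinTree → BinTree
mirror leaf       = leaf
mirror (node L R) = node (mirror R) (mirror L)

mirror-involutive : ∀ T → mirror (mirror T) ≡ T
mirror-involutive leaf       = refl
mirror-involutive (node L R) = cong₂ node (mirror-involutive L) (mirror-involutive R)

bsize-mirror : ∀ T → bsize (mirror T) ≡ bsize T
bsize-mirror leaf       = refl
bsize-mirror (node L R) = cong suc (trans (cong₂ _+_ (bsize-mirror R) (bsize-mirror L)) (+-comm (bsize R) (bsize L)))

leftBranch : BinTree → ℕ
leftBranch leaf       = 0
leftBranch (node L R) = suc (leftBranch L)

-- Numbers of children of v₁, v₂, … in the forest of the decreasing relations.
decArities : BinTree → List ℕ
decArities leaf       = []
decArities (node L R) = decArities L ++ leftBranch R ∷ decArities R

length-decArities : ∀ T → length (decArities T) ≡ bsize T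
length-decArities leaf       = refl
length-decArities (node L R) = begin
  length (decArities L ++ leftBranch R ∷ decArities R) ≡⟨ length-++ (decArities L) ⟩
  length (decArities L) + suc (length (decArities R))  ≡⟨ cong₂ (λ a b → a + suc b) (length-decArities L) (length-decArities R) ⟩
  bsize L + suc (bsize R)                              ≡⟨ +-suc _ _ ⟩
  suc (bsize L + bsize R)                              ∎
  where open ≡-Reasoning

-- The last node in in-order has no right child. Its arity is the entry that the contact and rise
-- vectors omit.
decArities-∷ʳ : ∀ T → T ≡ leaf ⊎ ∃ λ xs → decArities T ≡ xs ++ 0 ∷ []
decArities-∷ʳ leaf = inj₁ refl
decArities-∷ʳ (node L R) with decArities-∷ʳ R
... | inj₁ refl     = inj₂ (decArities L , refl)
... | inj₂ (xs , e) = inj₂ (decArities L ++ leftBranch R ∷ xs ,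
  trans (cong (λ ys → decArities L ++ leftBranch R ∷ ys) e) (sym (++-assoc (decArities L) (leftBranch R ∷ xs) (0 ∷ []))))

data Path : BinTree → BinTree → ℕ → Set where
  []  : ∀ {T} → Path T T 0
  _∷_ : ∀ {T T' T'' k} → T ⟶ T' → Path T' T'' k → Path T T'' (suc k)

_++ᴾ_ : ∀ {A B C j k} → Path A B j → Path B C k → Path A C (j + k)
[]      ++ᴾ q = q
(r ∷ p) ++ᴾ q = r ∷ (p ++ᴾ q)

toPath : ∀ {A B} → A ≤T B → ∃ (Path A B)
toPath ε       = 0 , []
toPath (r ◅ s) = _ , r ∷ proj₂ (toPath s)

fromPath : ∀ {A B k} → Path A B k → A ≤T B
fromPath []      = ε
fromPath (r ∷ p) = r ◅ fromPath p

snocᴾ : ∀ {A B C k} → Path A B k → B ⟶ C → Path A C (suc k)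
snocᴾ []      r = r ∷ []
snocᴾ (s ∷ p) r = s ∷ snocᴾ p r

mirror-⟶ : ∀ {A B} → A ⟶ B → mirror B ⟶ mirror A
mirror-⟶ rot       = rot
mirror-⟶ (left r)  = right (mirror-⟶ r)
mirror-⟶ (right r) = left (mirror-⟶ r)

mirror-Path : ∀ {A B k} → Path A B k → Path (mirror B) (mirror A) k
mirror-Path []      = []
mirror-Path (r ∷ p) = snocᴾ (mirror-Path p) (mirror-⟶ r)

⟶-bsize : ∀ {A B} → A ⟶ B → bsize A ≡ bsize B
⟶-bsize (rot {A} {B} {C}) = cong suc (trans (cong suc (+-assoc (bsize A) (bsize B) (bsize C))) (sym (+-suc (bsize A) _)))
⟶-bsize (left {R = R} r)  = cong (λ n → suc (n + bsize R)) (⟶-bsize r)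
⟶-bsize (right {L} r)     = cong (λ n → suc (bsize L + n)) (⟶-bsize r)

-- Grafting trees as Tamari intervals

shape : LTree → BinTree
shape lleaf         = leaf
shape (lnode _ L R) = node (shape L) (shape R)

labels : LTree → List ℕ
labels lleaf         = []
labels (lnode l L R) = labels L ++ l ∷ labels R

-- The first l trees of the decreasing forest of R become children of a new
-- node, which is placed to the right of the forest of A.
graftLower : BinTree → ℕ → BinTree → BinTree
graftLower A l leaf       = node A leaf
graftLower A l (node X Y) with leftBranch (node X Y) ≤? l
... | yes _ = node A (node X Y)
... | no  _ = node (graftLower A l X) Y

lower : LTree → BinTree
lower lleaf         = leaf
lower (lnode l L R) = graftLower (lower L) l (lower R)

graftLower-≥ : ∀ A l R → leftBranch R ≤ l → graftLower A l R ≡ node A R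
graftLower-≥ A l leaf       _ = refl
graftLower-≥ A l (node X Y) h with leftBranch (node X Y) ≤? l
... | yes _ = refl
... | no ¬h = ⊥-elim (¬h h)

graftLower-< : ∀ A l X Y → l < leftBranch (node X Y) → graftLower A l (node X Y) ≡ node (graftLower A l X) Y
graftLower-< A l X Y h with leftBranch (node X Y) ≤? l
... | yes g = ⊥-elim (<⇒≱ h g)
... | no  _ = refl

-- The new node swallows l roots of R and becomes a root itself, while the roots of A survive to its
-- left; l stands on the left to avoid subtraction.
leftBranch-graftLower : ∀ A l R → l ≤ leftBranch R → l + leftBranch (graftLower A l R) ≡ suc (leftBranch A + leftBranch R)
leftBranch-graftLower A zero leaf z≤n = cong suc (sym (+-identityʳ _))
leftBranch-graftLower A l (node X Y) h with leftBranch (node X Y) ≤? l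
... | yes g rewrite ≤-antisym h g = trans (+-suc (suc (leftBranch X)) (leftBranch A)) (cong suc (+-comm (suc (leftBranch X)) (leftBranch A)))
... | no ¬g = trans (+-suc l _) (trans (cong suc (leftBranch-graftLower A l X (s≤s⁻¹ (≰⇒> ¬g)))) (cong suc (sym (+-suc (leftBranch A) _))))

decArities-graftLower : ∀ A l R → l ≤ leftBranch R → decArities (graftLower A l R) ≡ decArities A ++ l ∷ decArities R
decArities-graftLower A zero leaf z≤n = refl
decArities-graftLower A l (node X Y) h with leftBranch (node X Y) ≤? l
... | yes g = cong (λ n → decArities A ++ n ∷ decArities (node X Y)) (≤-antisym g h)
... | no ¬g = trans (cong (_++ leftBranch Y ∷ decArities Y) (decArities-graftLower A l X (s≤s⁻¹ (≰⇒> ¬g))))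
                    (++-assoc (decArities A) (l ∷ decArities X) (leftBranch Y ∷ decArities Y))

bsize-graftLower : ∀ A l R → bsize (graftLower A l R) ≡ suc (bsize A + bsize R)
bsize-graftLower A l leaf = refl
bsize-graftLower A l (node X Y) with leftBranch (node X Y) ≤? l
... | yes _ = refl
... | no  _ = trans (cong (λ n → suc (n + bsize Y)) (bsize-graftLower A l X)) (lemma (bsize A) (bsize X) (bsize Y))
  where
  lemma : ∀ a x y → suc (suc (a + x) + y) ≡ suc (a + suc (x + y))
  lemma = solve-∀

-- The two sides are the lower bounds after and before a rotation of the upper bound. The roots of B
-- come first in the forest of `graftLower B k C`, and by hypothesis the outer node takes its l
-- children among them.
graftLower-assoc : ∀ A l B k C → l ≤ leftBranch B → graftLower A l (graftLower B k C) ≡ graftLower (graftLower A l B) k C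
graftLower-assoc A l B k leaf h = graftLower-< A l B leaf (s≤s h)
graftLower-assoc A l B k (node X Y) h with leftBranch (node X Y) ≤? k
... | yes _ = graftLower-< A l B (node X Y) (s≤s h)
... | no ¬g = trans (graftLower-< A l (graftLower B k X) Y (s≤s bound)) (cong (λ Z → node Z Y) (graftLower-assoc A l B k X h))
  where
  k≤ : k ≤ leftBranch X
  k≤ = s≤s⁻¹ (≰⇒> ¬g)
  bound : l ≤ leftBranch (graftLower B k X)
  bound = +-cancelˡ-≤ k l _ (begin
    k + l                            ≤⟨ +-mono-≤ k≤ h ⟩
    leftBranch X + leftBranch B      ≡⟨ +-comm (leftBranch X) _ ⟩
    leftBranch B + leftBranch X      ≤⟨ n≤1+n _ ⟩
    suc (leftBranch B + leftBranch X) ≡⟨ leftBranch-graftLower B k X k≤ ⟨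
    k + leftBranch (graftLower B k X) ∎)
    where open ≤-Reasoning

bsize-shape : ∀ G → bsize (shape G) ≡ lsize G
bsize-shape lleaf         = refl
bsize-shape (lnode _ L R) = cong suc (cong₂ _+_ (bsize-shape L) (bsize-shape R))

bsize-lower : ∀ G → bsize (lower G) ≡ lsize G
bsize-lower lleaf         = refl
bsize-lower (lnode l L R) = trans (bsize-graftLower (lower L) l (lower R)) (cong suc (cong₂ _+_ (bsize-lower L) (bsize-lower R)))

sum-labels : ∀ G → sum (labels G) ≡ labelSum G
sum-labels lleaf         = refl
sum-labels (lnode l L R) = begin
  sum (labels L ++ l ∷ labels R)          ≡⟨ sum-++ (labels L) _ ⟩
  sum (labels L) + (l + sum (labels R))   ≡⟨ cong₂ (λ a b → a + (l + b)) (sum-labels L) (sum-labels R) ⟩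
  labelSum L + (l + labelSum R)           ≡⟨ lemma (labelSum L) l (labelSum R) ⟩
  l + labelSum L + labelSum R             ∎
  where
  open ≡-Reasoning
  lemma : ∀ a b c → a + (b + c) ≡ b + a + c
  lemma = solve-∀

-- In the decreasing forest each node is either a root or the child of exactly one node.
labels-leftBranch : ∀ G → ValidGT G → labelSum G + leftBranch (lower G) ≡ lsize G
-- Size minus label sum is the number of trees in the forest of `lower R`, so validity says exactly
-- that there are l trees to take as children. Hence the mutual induction.
label≤leftBranch : ∀ l L R → ValidGT (lnode l L R) → l ≤ leftBranch (lower R)

label≤leftBranch l L R (h , _ , vR) = +-cancelʳ-≤ (labelSum R) l _ (begin
  l + labelSum R                      ≤⟨ h ⟩
  lsize R                             ≡⟨ labels-leftBranch R vR ⟨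
  labelSum R + leftBranch (lower R)   ≡⟨ +-comm (labelSum R) _ ⟩
  leftBranch (lower R) + labelSum R   ∎)
  where open ≤-Reasoning

labels-leftBranch lleaf         _ = refl
labels-leftBranch (lnode l L R) v@(_ , vL , vR) = begin
  l + labelSum L + labelSum R + leftBranch (graftLower (lower L) l (lower R))
    ≡⟨ lemma₁ l (labelSum L) (labelSum R) _ ⟩
  labelSum L + labelSum R + (l + leftBranch (graftLower (lower L) l (lower R)))
    ≡⟨ cong (labelSum L + labelSum R +_) (leftBranch-graftLower (lower L) l (lower R) (label≤leftBranch l L R v)) ⟩
  labelSum L + labelSum R + suc (leftBranch (lower L) + leftBranch (lower R))
    ≡⟨ lemma₂ (labelSum L) (labelSum R) (leftBranch (lower L)) (leftBranch (lower R)) ⟩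
  suc ((labelSum L + leftBranch (lower L)) + (labelSum R + leftBranch (lower R)))
    ≡⟨ cong suc (cong₂ _+_ (labels-leftBranch L vL) (labels-leftBranch R vR)) ⟩
  suc (lsize L + lsize R) ∎
  where
  open ≡-Reasoning
  lemma₁ : ∀ a b c d → a + b + c + d ≡ b + c + (a + d)
  lemma₁ = solve-∀
  lemma₂ : ∀ a b c d → a + b + suc (c + d) ≡ suc ((a + c) + (b + d))
  lemma₂ = solve-∀

decArities-lower : ∀ G → ValidGT G → decArities (lower G) ≡ labels G
decArities-lower lleaf         _ = refl
decArities-lower (lnode l L R) v@(_ , vL , vR) =
  trans (decArities-graftLower (lower L) l (lower R) (label≤leftBranch l L R v))
        (cong₂ (λ xs ys → xs ++ l ∷ ys) (decArities-lower L vL) (decArities-lower R vR))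

length-labels : ∀ G → length (labels G) ≡ bsize (shape G)
length-labels lleaf         = refl
length-labels (lnode l L R) = begin
  length (labels L ++ l ∷ labels R)          ≡⟨ length-++ (labels L) ⟩
  length (labels L) + suc (length (labels R)) ≡⟨ cong₂ (λ a b → a + suc b) (length-labels L) (length-labels R) ⟩
  bsize (shape L) + suc (bsize (shape R))    ≡⟨ +-suc _ _ ⟩
  suc (bsize (shape L) + bsize (shape R))    ∎
  where open ≡-Reasoning

++-∷-cancel : ∀ {A : Set} (xs ys : List A) {x y us vs} → length xs ≡ length ys →
            xs ++ x ∷ us ≡ ys ++ y ∷ vs → xs ≡ ys × x ≡ y × us ≡ vs
++-∷-cancel []       []       _ refl = refl , refl , refl
++-∷-cancel (x ∷ xs) (y ∷ ys) h e with ∷-injective e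
... | refl , e' with ++-∷-cancel xs ys (suc-injective h) e'
... | refl , refl , refl = refl , refl , refl

node-injective : ∀ {A B C D} → node A B ≡ node C D → A ≡ C × B ≡ D
node-injective refl = refl , refl

-- The shape fixes how many labels belong to each subtree, so the in-order word splits in only one
-- way.
shape-labels-injective : ∀ G H → shape G ≡ shape H → labels G ≡ labels H → G ≡ H
shape-labels-injective lleaf         lleaf         _ _ = refl
shape-labels-injective (lnode l L R) (lnode k M S) e f with node-injective e
... | eL , eR with ++-∷-cancel (labels L) (labels M)
                     (trans (length-labels L) (trans (cong bsize eL) (sym (length-labels M)))) f
... | p , refl , q = cong₂ (lnode l) (shape-labels-injective L M eL p) (shape-labels-injective R S eR q)

shape-lower-injective : ∀ G H → ValidGT G → ValidGT H → shape G ≡ shape H → lower G ≡ lower H → G ≡ H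
shape-lower-injective G H v w e f = shape-labels-injective G H e
  (trans (sym (decArities-lower G v)) (trans (cong decArities f) (decArities-lower H w)))

-- Slack and longest Tamari chains

slack : LTree → ℕ
slack lleaf         = 0
slack (lnode l L R) = (lsize R ∸ (l + labelSum R)) + slack L + slack R

-- The grafting tree of the one-element interval [T, T]: each label takes all the available
-- children.
diagonal : BinTree → LTree
diagonal leaf       = lleaf
diagonal (node L R) = lnode (leftBranch R) (diagonal L) (diagonal R)

lower-diagonal : ∀ T → lower (diagonal T) ≡ T
lower-diagonal leaf = refl
lower-diagonal (node L R) = trans
  (cong₂ (λ A B → graftLower A (leftBranch R) B) (lower-diagonal L) (lower-diagonal R)) (graftLower-≥ L (leftBranch R) R ≤-refl)

shape-diagonal : ∀ T → shape (diagonal T) ≡ T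
shape-diagonal leaf       = refl
shape-diagonal (node L R) = cong₂ node (shape-diagonal L) (shape-diagonal R)

valid-diagonal : ∀ T → ValidGT (diagonal T)
valid-diagonal leaf       = tt
valid-diagonal (node L R) = ≤-reflexive eq , valid-diagonal L , valid-diagonal R
  where
  eq : leftBranch R + labelSum (diagonal R) ≡ lsize (diagonal R)
  eq = trans (+-comm (leftBranch R) _)
    (trans (cong (λ S → labelSum (diagonal R) + leftBranch S) (sym (lower-diagonal R))) (labels-leftBranch (diagonal R) (valid-diagonal R)))

-- What a rotation of the upper bound preserves. Equal size and label sum carry validity and slack
-- over to the ancestors, equal lower bound keeps the start of the interval.
record Same (G H : LTree) : Set where
  constructor same
  field
    same-size  : lsize G ≡ lsize H
    same-sum   : labelSum G ≡ labelSum H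
    same-lower : lower G ≡ lower H

-- At the rotated pair only the contribution of the node labelled l changes, from dB to dB + dC + 1;
-- the node labelled k keeps dC.
rotate : ∀ G {T} → ValidGT G → shape G ⟶ T →
         ∃ λ H → ValidGT H × shape H ≡ T × Same G H × slack G < slack H
rotate (lnode k (lnode l A B) C) v@(hC , (hB , vA , vB) , vC) rot =
  lnode l A (lnode k B C) ,
  (h , vA , hC , vB , vC) , refl ,
  same (lemma-size (lsize A) (lsize B) (lsize C)) (lemma-sum k l (labelSum A) (labelSum B) (labelSum C))
       (sym (graftLower-assoc (lower A) l (lower B) k (lower C) (label≤leftBranch l A B (hB , vA , vB)))) ,
  (begin-strict
    dC + (dB + slack A + slack B) + slack C       ≡⟨ rearrange dC dB (slack A) (slack B) (slack C) ⟩
    dB + slack A + (dC + slack B + slack C)       <⟨ +-monoˡ-< (dC + slack B + slack C) (+-monoˡ-< (slack A) (s≤s (m≤m+n dB dC))) ⟩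
    suc (dB + dC) + slack A + (dC + slack B + slack C) ≡⟨ cong (λ n → n + slack A + (dC + slack B + slack C)) dx-eq ⟨
    slack (lnode l A (lnode k B C))               ∎)
  where
  open ≤-Reasoning
  dB = lsize B ∸ (l + labelSum B)
  dC = lsize C ∸ (k + labelSum C)
  lemma-size : ∀ a b c → suc (suc (a + b) + c) ≡ suc (a + suc (b + c))
  lemma-size = solve-∀
  lemma-sum : ∀ k l a b c → k + (l + a + b) + c ≡ l + a + (k + b + c)
  lemma-sum = solve-∀
  rearrange : ∀ c b x y z → c + (b + x + y) + z ≡ b + x + (c + y + z)
  rearrange = solve-∀
  total : suc (lsize B + lsize C) ≡ (l + (k + labelSum B + labelSum C)) + suc (dB + dC)
  total = begin-equality
    suc (lsize B + lsize C) ≡⟨ cong suc (cong₂ _+_ (sym (m+[n∸m]≡n hB)) (sym (m+[n∸m]≡n hC))) ⟩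
    suc ((l + labelSum B + dB) + (k + labelSum C + dC)) ≡⟨ lemma l (labelSum B) dB k (labelSum C) dC ⟩
    (l + (k + labelSum B + labelSum C)) + suc (dB + dC) ∎
    where
    lemma : ∀ l b x k c y → suc ((l + b + x) + (k + c + y)) ≡ (l + (k + b + c)) + suc (x + y)
    lemma = solve-∀
  h : l + (k + labelSum B + labelSum C) ≤ suc (lsize B + lsize C)
  h = subst (l + (k + labelSum B + labelSum C) ≤_) (sym total) (m≤m+n _ _)
  dx-eq : suc (lsize B + lsize C) ∸ (l + (k + labelSum B + labelSum C)) ≡ suc (dB + dC)
  dx-eq = trans (cong (_∸ (l + (k + labelSum B + labelSum C))) total) (m+n∸m≡n (l + (k + labelSum B + labelSum C)) (suc (dB + dC)))
rotate (lnode k L R) (h , vL , vR) (left r) with rotate L vL r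
... | L' , vL' , refl , same es ss el , lt =
  lnode k L' R , (h , vL' , vR) , refl ,
  same (cong (λ n → suc (n + lsize R)) es) (cong (λ n → k + n + labelSum R) ss) (cong (λ A → graftLower A k (lower R)) el) ,
  +-monoˡ-< (slack R) (+-monoʳ-< (lsize R ∸ (k + labelSum R)) lt)
rotate (lnode k L R) (h , vL , vR) (right r) with rotate R vR r
... | R' , vR' , refl , same es ss el , lt =
  lnode k L R' , (subst₂ (λ a b → k + a ≤ b) ss es h , vL , vR') , refl ,
  same (cong (λ n → suc (lsize L + n)) es) (cong (k + labelSum L +_) ss) (cong (graftLower (lower L) k) el) ,
  subst (λ d → slack (lnode k L R) < d + slack L + slack R') (cong₂ (λ a b → a ∸ (k + b)) es ss)
    (+-monoʳ-< ((lsize R ∸ (k + labelSum R)) + slack L) lt)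

rotatePath : ∀ G {T k} → ValidGT G → Path (shape G) T k →
             ∃ λ H → ValidGT H × shape H ≡ T × lower G ≡ lower H × slack G + k ≤ slack H
rotatePath G v [] = G , v , refl , refl , ≤-reflexive (+-identityʳ (slack G))
rotatePath G v (_∷_ {k = k} r p) with rotate G v r
... | H , w , refl , same _ _ e , lt with rotatePath H w p
... | K , u , f , e' , le = K , u , f , trans e e' , (begin
  slack G + suc k ≡⟨ +-suc (slack G) k ⟩
  suc (slack G) + k ≤⟨ +-monoˡ-≤ k lt ⟩
  slack H + k ≤⟨ le ⟩
  slack K ∎)
  where open ≤-Reasoning

-- The path is applied to the upper bound of [T, T], the lower bound staying fixed and each step
-- raising the slack.
graft : ∀ {T T' k} → Path T T' k → ∃ λ G → ValidGT G × lower G ≡ T × shape G ≡ T' × k ≤ slack G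
graft {T} p with rotatePath (diagonal T) (valid-diagonal T) (subst (λ S → Path S _ _) (sym (shape-diagonal T)) p)
... | G , v , f , e , le = G , v , trans (sym e) (lower-diagonal T) , f , ≤-trans (m≤n+m _ _) le

-- Any path from the lower to the upper bound builds a grafting tree with the bounds of G, hence G
-- itself.
Path≤slack : ∀ G {k} → ValidGT G → Path (lower G) (shape G) k → k ≤ slack G
Path≤slack G v p with graft p
... | H , w , e , f , le with shape-lower-injective H G w v f e
... | refl = le

-- Without slack each label reaches the number of roots of the forest on its right, and then
-- `graftLower` is plain `node`.
slack-0 : ∀ G → ValidGT G → slack G ≡ 0 → lower G ≡ shape G
slack-0 lleaf         _ _ = refl
slack-0 (lnode l L R) v@(h , vL , vR) e = trans
  (graftLower-≥ (lower L) l (lower R) lb≤) (cong₂ node (slack-0 L vL eL) (slack-0 R vR eR))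
  where
  d = lsize R ∸ (l + labelSum R)
  e₁ : d + slack L ≡ 0
  e₁ = m+n≡0⇒m≡0 (d + slack L) e
  eL : slack L ≡ 0
  eL = m+n≡0⇒n≡0 d e₁
  eR : slack R ≡ 0
  eR = m+n≡0⇒n≡0 (d + slack L) e
  lb≤ : leftBranch (lower R) ≤ l
  lb≤ = +-cancelˡ-≤ (labelSum R) _ l (begin
    labelSum R + leftBranch (lower R) ≡⟨ labels-leftBranch R vR ⟩
    lsize R                           ≤⟨ m∸n≡0⇒m≤n (m+n≡0⇒m≡0 d e₁) ⟩
    l + labelSum R                    ≡⟨ +-comm l _ ⟩
    labelSum R + l                    ∎)
    where open ≤-Reasoning

-- A node x of positive slack whose right child y has slack 0 can be rotated
-- back, which lowers the total slack by exactly one; if y has positive slack,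
-- continue with y.
unrotate : ∀ G {d} → ValidGT G → slack G ≡ suc d →
           ∃ λ H → ValidGT H × shape H ⟶ shape G × Same H G × slack H ≡ d
unrotate (lnode l L R) {d} v@(h , vL , vR) e with slack L in eqL | slack R in eqR
... | suc a | b with unrotate L vL eqL
... | L' , vL' , r , same es ss el , refl =
  lnode l L' R , (h , vL' , vR) , left r ,
  same (cong (λ n → suc (n + lsize R)) es) (cong (λ n → l + n + labelSum R) ss) (cong (λ A → graftLower A l (lower R)) el) ,
  suc-injective (begin
    suc (D + slack L' + slack R) ≡⟨ cong (_+ slack R) (+-suc D (slack L')) ⟨
    D + suc (slack L') + slack R ≡⟨ cong (D + suc (slack L') +_) eqR ⟩
    D + suc (slack L') + b       ≡⟨ e ⟩
    suc d                        ∎)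
  where
  open ≡-Reasoning
  D = lsize R ∸ (l + labelSum R)
unrotate (lnode l L R) {d} v@(h , vL , vR) e | zero | suc b with unrotate R vR eqR
... | R' , vR' , r , same es ss el , refl =
  lnode l L R' , (subst₂ (λ x y → l + x ≤ y) (sym ss) (sym es) h , vL , vR') , right r ,
  same (cong (λ n → suc (lsize L + n)) es) (cong (l + labelSum L +_) ss) (cong (graftLower (lower L) l) el) ,
  suc-injective (begin
    suc (lsize R' ∸ (l + labelSum R') + slack L + slack R') ≡⟨ cong₂ (λ x y → suc (x ∸ (l + y) + slack L + slack R')) es ss ⟩
    suc (D + slack L + slack R')  ≡⟨ +-suc (D + slack L) (slack R') ⟨
    D + slack L + suc (slack R')  ≡⟨ cong (λ x → D + x + suc (slack R')) eqL ⟩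
    D + 0 + suc (slack R')        ≡⟨ e ⟩
    suc d                         ∎)
  where
  open ≡-Reasoning
  D = lsize R ∸ (l + labelSum R)
unrotate (lnode l L (lnode k B C)) {d} v@(h , vL , vR@(hC , vB , vC)) e | zero | zero =
  lnode k (lnode l L B) C , (hC , (hB , vL , vB) , vC) , rot ,
  same (lemma-size (lsize L) (lsize B) (lsize C)) (lemma-sum k l (labelSum L) (labelSum B) (labelSum C))
       (sym (graftLower-assoc (lower L) l (lower B) k (lower C) (label≤leftBranch l L B (hB , vL , vB)))) ,
  (begin
    dC + (lsize B ∸ (l + labelSum B) + slack L + slack B) + slack C
      ≡⟨ cong (λ x → dC + (x + slack L + slack B) + slack C) (trans (cong (_∸ (l + labelSum B)) (sym hB-eq)) (m+n∸m≡n (l + labelSum B) d)) ⟩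
    dC + (d + slack L + slack B) + slack C
      ≡⟨ cong₂ (λ x y → x + (d + slack L + y) + slack C) dC≡0 sB≡0 ⟩
    d + slack L + 0 + slack C
      ≡⟨ cong₂ (λ x y → d + x + 0 + y) eqL sC≡0 ⟩
    d + 0 + 0 + 0 ≡⟨ trans (+-identityʳ _) (trans (+-identityʳ _) (+-identityʳ d)) ⟩
    d ∎)
  where
  open ≡-Reasoning
  dC = lsize C ∸ (k + labelSum C)
  sC≡0 : slack C ≡ 0
  sC≡0 = m+n≡0⇒n≡0 (dC + slack B) eqR
  sB≡0 : slack B ≡ 0
  sB≡0 = m+n≡0⇒n≡0 dC (m+n≡0⇒m≡0 (dC + slack B) eqR)
  -- A rotation gains one more than the contribution dC of the node labelled k; since this is 0
  -- here, undoing the rotation costs exactly one.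
  dC≡0 : dC ≡ 0
  dC≡0 = m+n≡0⇒m≡0 dC (m+n≡0⇒m≡0 (dC + slack B) eqR)
  lemma-size : ∀ a b c → suc (suc (a + b) + c) ≡ suc (a + suc (b + c))
  lemma-size = solve-∀
  lemma-sum : ∀ k l a b c → k + (l + a + b) + c ≡ l + a + (k + b + c)
  lemma-sum = solve-∀
  eqC : k + labelSum C ≡ lsize C
  eqC = ≤-antisym hC (m∸n≡0⇒m≤n dC≡0)
  eqx : suc (lsize B + lsize C) ∸ (l + (k + labelSum B + labelSum C)) ≡ suc d
  eqx = trans (sym (trans (+-identityʳ _) (+-identityʳ _))) e
  hB-eq : (l + labelSum B) + d ≡ lsize B
  hB-eq = +-cancelʳ-≡ (suc (lsize C)) _ _ (begin
    (l + labelSum B) + d + suc (lsize C)                  ≡⟨ cong (λ n → l + labelSum B + d + suc n) eqC ⟨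
    (l + labelSum B) + d + suc (k + labelSum C)           ≡⟨ lemma l (labelSum B) d k (labelSum C) ⟩
    (l + (k + labelSum B + labelSum C)) + suc d           ≡⟨ cong (l + (k + labelSum B + labelSum C) +_) eqx ⟨
    (l + (k + labelSum B + labelSum C)) + (suc (lsize B + lsize C) ∸ (l + (k + labelSum B + labelSum C))) ≡⟨ m+[n∸m]≡n h ⟩
    suc (lsize B + lsize C)                               ≡⟨ +-suc (lsize B) (lsize C) ⟨
    lsize B + suc (lsize C)                               ∎)
    where
    lemma : ∀ l b d k c → (l + b) + d + suc (k + c) ≡ (l + (k + b + c)) + suc d
    lemma = solve-∀
  hB : l + labelSum B ≤ lsize B
  hB = subst (l + labelSum B ≤_) hB-eq (m≤m+n _ d)
unrotate (lnode l L lleaf) (h , _ , _) e | zero | zero with trans (sym e) (cong (λ x → x + 0 + 0) (0∸n≡0 (l + 0)))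
... | ()

longestPath : ∀ G → ValidGT G → Path (lower G) (shape G) (slack G)
longestPath G v = go (slack G) G v refl
  where
  go : ∀ d G → ValidGT G → slack G ≡ d → Path (lower G) (shape G) d
  go zero    G v e = subst (λ T → Path (lower G) T 0) (slack-0 G v e) []
  go (suc d) G v e with unrotate G v e
  ... | H , w , r , same _ _ f , e' = snocᴾ (subst (λ T → Path T (shape H) d) f (go d H w e')) r

-- Both numbers are maximal path lengths, and mirroring reverses the paths of one interval into
-- those of the other.
slack-mirror : ∀ G H → ValidGT G → ValidGT H → lower H ≡ mirror (shape G) → shape H ≡ mirror (lower G) → slack G ≡ slack H
slack-mirror G H v w e f = ≤-antisym
  (Path≤slack H w (subst₂ (λ A B → Path A B (slack G)) (sym e) (sym f) (mirror-Path (longestPath G v))))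
  (Path≤slack G v (subst₂ (λ A B → Path A B (slack H))
    (trans (cong mirror f) (mirror-involutive _)) (trans (cong mirror e) (mirror-involutive _)) (mirror-Path (longestPath H w))))

lower≤shape : ∀ G → ValidGT G → lower G ≤T shape G
lower≤shape G v = fromPath (longestPath G v)

-- The left branch involution

leftmostᵀ : BinTree → BinTree → BinTree
leftmostᵀ leaf       X = X
leftmostᵀ (node A B) X = node (leftmostᵀ A X) B

LBᵀ : BinTree → BinTree
LBᵀ leaf       = leaf
LBᵀ (node L R) = leftmostᵀ (LBᵀ L) (node leaf (LBᵀ R))

shape-attachLeftmost : ∀ A X → shape (attachLeftmost A X) ≡ leftmostᵀ (shape A) (shape X)
shape-attachLeftmost lleaf         X = refl
shape-attachLeftmost (lnode l A B) X = cong (λ T → node T (shape B)) (shape-attachLeftmost A X)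

shape-LB : ∀ G → shape (LB G) ≡ LBᵀ (shape G)
shape-LB lleaf         = refl
shape-LB (lnode l L R) = trans (shape-attachLeftmost (LB L) _) (cong₂ (λ A B → leftmostᵀ A (node leaf B)) (shape-LB L) (shape-LB R))

-- The node attached at the far left was the root before; the second application of `LB` brings it
-- back to the root. This is the heart of the involution.
LB-attachLeftmost : ∀ A l X → LB (attachLeftmost A (lnode l lleaf X)) ≡ lnode l (LB A) (LB X)
LB-attachLeftmost lleaf           l X = refl
LB-attachLeftmost (lnode a A₁ A₂) l X = cong (λ Z → attachLeftmost Z (lnode a lleaf (LB A₂))) (LB-attachLeftmost A₁ l X)

LB-involutive : ∀ G → LB (LB G) ≡ G
LB-involutive lleaf         = refl
LB-involutive (lnode l L R) = trans (LB-attachLeftmost (LB L) l (LB R)) (cong₂ (lnode l) (LB-involutive L) (LB-involutive R))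

lsize-attachLeftmost : ∀ A X → lsize (attachLeftmost A X) ≡ lsize X + lsize A
lsize-attachLeftmost lleaf         X = sym (+-identityʳ _)
lsize-attachLeftmost (lnode a A B) X = trans (cong (λ n → suc (n + lsize B)) (lsize-attachLeftmost A X)) (lemma (lsize X) (lsize A) (lsize B))
  where
  lemma : ∀ x a b → suc (x + a + b) ≡ x + suc (a + b)
  lemma = solve-∀

lsize-LB : ∀ G → lsize (LB G) ≡ lsize G
lsize-LB lleaf         = refl
lsize-LB (lnode l L R) = trans (lsize-attachLeftmost (LB L) (lnode l lleaf (LB R)))
  (cong suc (trans (cong₂ _+_ (lsize-LB R) (lsize-LB L)) (+-comm (lsize R) (lsize L))))

labels-attachLeftmost : ∀ A X → labels (attachLeftmost A X) ≡ labels X ++ labels A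
labels-attachLeftmost lleaf         X = sym (++-identityʳ _)
labels-attachLeftmost (lnode a A B) X = trans (cong (_++ a ∷ labels B) (labels-attachLeftmost A X)) (++-assoc (labels X) (labels A) _)

labels-LB : ∀ G → labels (LB G) ↭ labels G
labels-LB lleaf         = ↭-refl
labels-LB (lnode l L R) = begin
  labels (attachLeftmost (LB L) (lnode l lleaf (LB R))) ≡⟨ labels-attachLeftmost (LB L) _ ⟩
  (l ∷ labels (LB R)) ++ labels (LB L)                  ↭⟨ ++-comm (l ∷ labels (LB R)) (labels (LB L)) ⟩
  labels (LB L) ++ l ∷ labels (LB R)                    ↭⟨ ++⁺ (labels-LB L) (↭-prep l (labels-LB R)) ⟩
  labels L ++ l ∷ labels R                              ∎
  where open PermutationReasoning

labelSum-LB : ∀ G → labelSum (LB G) ≡ labelSum G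
labelSum-LB G = trans (sym (sum-labels (LB G))) (trans (sum-↭ (labels-LB G)) (sum-labels G))

valid-attachLeftmost : ∀ A X → ValidGT A → ValidGT X → ValidGT (attachLeftmost A X)
valid-attachLeftmost lleaf         X _            w = w
valid-attachLeftmost (lnode a A B) X (h , vA , vB) w = h , valid-attachLeftmost A X vA w , vB

valid-LB : ∀ G → ValidGT G → ValidGT (LB G)
valid-LB lleaf         _             = tt
valid-LB (lnode l L R) (h , vL , vR) = valid-attachLeftmost (LB L) _ (valid-LB L vL)
  (subst₂ (λ x y → l + x ≤ y) (sym (labelSum-LB R)) (sym (lsize-LB R)) h , tt , valid-LB R vR)

slack-attachLeftmost : ∀ A X → slack (attachLeftmost A X) ≡ slack X + slack A
slack-attachLeftmost lleaf         X = sym (+-identityʳ _)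
slack-attachLeftmost (lnode a A B) X = trans (cong (λ n → d + n + slack B) (slack-attachLeftmost A X)) (lemma d (slack X) (slack A) (slack B))
  where
  d = lsize B ∸ (a + labelSum B)
  lemma : ∀ d x a b → d + (x + a) + b ≡ x + (d + a + b)
  lemma = solve-∀

slack-LB : ∀ G → slack (LB G) ≡ slack G
slack-LB lleaf         = refl
slack-LB (lnode l L R) = begin
  slack (attachLeftmost (LB L) (lnode l lleaf (LB R)))
    ≡⟨ slack-attachLeftmost (LB L) _ ⟩
  (lsize (LB R) ∸ (l + labelSum (LB R))) + 0 + slack (LB R) + slack (LB L)
    ≡⟨ cong₂ (λ x y → (x ∸ (l + y)) + 0 + slack (LB R) + slack (LB L)) (lsize-LB R) (labelSum-LB R) ⟩
  d + 0 + slack (LB R) + slack (LB L)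
    ≡⟨ cong₂ (λ x y → d + 0 + x + y) (slack-LB R) (slack-LB L) ⟩
  d + 0 + slack R + slack L
    ≡⟨ lemma d (slack R) (slack L) ⟩
  d + slack L + slack R ∎
  where
  open ≡-Reasoning
  d = lsize R ∸ (l + labelSum R)
  lemma : ∀ d r l → d + 0 + r + l ≡ d + l + r
  lemma = solve-∀

-- Dyck words

dyck : BinTree → List Bool
dyck leaf       = []
dyck (node L R) = dyck L ++ true ∷ dyck R ++ false ∷ []

dyck-node-++ : ∀ L R w → dyck (node L R) ++ w ≡ dyck L ++ true ∷ dyck R ++ false ∷ w
dyck-node-++ L R w = trans (++-assoc (dyck L) _ w) (cong (λ u → dyck L ++ true ∷ u) (++-assoc (dyck R) (false ∷ []) w))

dyck-leftmostᵀ : ∀ A X → dyck (leftmostᵀ A X) ≡ dyck X ++ dyck A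
dyck-leftmostᵀ leaf       X = sym (++-identityʳ _)
dyck-leftmostᵀ (node A B) X = trans (cong (_++ true ∷ dyck B ++ false ∷ []) (dyck-leftmostᵀ A X)) (++-assoc (dyck X) (dyck A) _)

-- `dyck` splits a word at its last return; `LBᵀ` turns this into the decomposition at the first
-- return, where the initial rise is visible.
dyck-LBᵀ : ∀ L R → dyck (LBᵀ (node L R)) ≡ true ∷ dyck (LBᵀ R) ++ false ∷ dyck (LBᵀ L)
dyck-LBᵀ L R = trans (dyck-leftmostᵀ (LBᵀ L) _) (cong (true ∷_) (++-assoc (dyck (LBᵀ R)) (false ∷ []) _))

leading-++-false : ∀ u v → leading (u ++ false ∷ v) ≡ leading u
leading-++-false []          v = refl
leading-++-false (true  ∷ u) v = cong suc (leading-++-false u v)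
leading-++-false (false ∷ u) v = refl

rList-++-false : ∀ u v → rList (u ++ false ∷ v) ≡ rList u ++ leading v ∷ rList v
rList-++-false []          v = refl
rList-++-false (true  ∷ u) v = rList-++-false u v
rList-++-false (false ∷ u) v = cong₂ _∷_ (leading-++-false u v) (rList-++-false u v)

leading-LBᵀ : ∀ T → leading (dyck (LBᵀ T)) ≡ leftBranch (mirror T)
leading-LBᵀ leaf       = refl
leading-LBᵀ (node L R) = begin
  leading (dyck (LBᵀ (node L R)))                                ≡⟨ cong leading (dyck-LBᵀ L R) ⟩
  suc (leading (dyck (LBᵀ R) ++ false ∷ dyck (LBᵀ L)))           ≡⟨ cong suc (leading-++-false (dyck (LBᵀ R)) _) ⟩
  suc (leading (dyck (LBᵀ R)))                                   ≡⟨ cong suc (leading-LBᵀ R) ⟩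
  suc (leftBranch (mirror R))                                    ∎
  where open ≡-Reasoning

-- The down step matching the first up step is followed by the word of L, so the rise there is the
-- length of the right branch of L, which is the arity of the root in the mirror image.
rList-LBᵀ : ∀ T → rList (dyck (LBᵀ T)) ≡ decArities (mirror T)
rList-LBᵀ leaf       = refl
rList-LBᵀ (node L R) = begin
  rList (dyck (LBᵀ (node L R)))
    ≡⟨ cong rList (dyck-LBᵀ L R) ⟩
  rList (dyck (LBᵀ R) ++ false ∷ dyck (LBᵀ L))
    ≡⟨ rList-++-false (dyck (LBᵀ R)) _ ⟩
  rList (dyck (LBᵀ R)) ++ leading (dyck (LBᵀ L)) ∷ rList (dyck (LBᵀ L))
    ≡⟨ cong₂ _++_ (rList-LBᵀ R) (cong₂ _∷_ (leading-LBᵀ L) (rList-LBᵀ L)) ⟩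
  decArities (mirror R) ++ leftBranch (mirror L) ∷ decArities (mirror L) ∎
  where open ≡-Reasoning

-- Relations of a tree, read off the sizes of the right and left subtrees

rightSizes leftSizes : BinTree → List ℕ
rightSizes leaf       = []
rightSizes (node L R) = rightSizes L ++ bsize R ∷ rightSizes R
leftSizes leaf       = []
leftSizes (node L R) = leftSizes L ++ bsize L ∷ leftSizes R

length-rightSizes : ∀ T → length (rightSizes T) ≡ bsize T
length-rightSizes leaf       = refl
length-rightSizes (node L R) = trans (length-++ (rightSizes L))
  (trans (cong₂ (λ a b → a + suc b) (length-rightSizes L) (length-rightSizes R)) (+-suc _ _))

length-leftSizes : ∀ T → length (leftSizes T) ≡ bsize T
length-leftSizes leaf       = refl
length-leftSizes (node L R) = trans (length-++ (leftSizes L))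
  (trans (cong₂ (λ a b → a + suc b) (length-leftSizes L) (length-leftSizes R)) (+-suc _ _))

-- The entry at a position counted from 1 (0 outside the list).
at : List ℕ → ℕ → ℕ
at []       _             = 0
at (x ∷ xs) 0             = 0
at (x ∷ xs) 1             = x
at (x ∷ xs) (suc (suc i)) = at xs (suc i)

In : ℕ → ℕ → Set
In n a = 1 ≤ a × a ≤ n

at-left : ∀ xs {n a} ys → length xs ≡ n → In n a → at (xs ++ ys) a ≡ at xs a
at-left (x ∷ xs) {a = 1}           ys refl _             = refl
at-left (x ∷ xs) {a = suc (suc a)} ys refl (_ , s≤s a≤n) = at-left xs ys refl (s≤s z≤n , a≤n)
at-left []       {a = suc a}       ys refl (_ , ())

at-middle : ∀ xs {n} y ys → length xs ≡ n → at (xs ++ y ∷ ys) (suc n) ≡ y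
at-middle []       y ys refl = refl
at-middle (x ∷ xs) y ys refl = at-middle xs y ys refl

at-right : ∀ xs {n a} y ys → length xs ≡ n → 1 ≤ a → at (xs ++ y ∷ ys) (suc n + a) ≡ at ys a
at-right []       {a = suc a} y ys refl _ = refl
at-right (x ∷ xs) {a = suc a} y ys refl h = at-right xs y ys refl h

data Zone (n k : ℕ) : ℕ → Set where
  inˡ : ∀ {a} → In n a → Zone n k a
  inᵐ : Zone n k (suc n)
  inʳ : ∀ {a} → In k a → Zone n k (suc n + a)

zone : ∀ n k {a} → In (suc (n + k)) a → Zone n k a
zone n k {a} (1≤a , a≤) with a ≤? n
... | yes a≤n = inˡ (1≤a , a≤n)
... | no  a≰n with m≤n⇒∃[o]m+o≡n (≰⇒> a≰n)
... | zero  , refl = subst (Zone n k) (cong suc (sym (+-identityʳ n))) inᵐ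
... | suc i , refl = inʳ (s≤s z≤n , +-cancelˡ-≤ (suc n) (suc i) k a≤)

rightSizes-bound : ∀ T {a} → In (bsize T) a → a + at (rightSizes T) a ≤ bsize T
rightSizes-bound leaf (s≤s _ , ())
rightSizes-bound (node L R) h with zone (bsize L) (bsize R) h
... | inˡ {a} i rewrite at-left (rightSizes L) (bsize R ∷ rightSizes R) (length-rightSizes L) i =
  ≤-trans (rightSizes-bound L i) (≤-trans (m≤m+n (bsize L) (bsize R)) (n≤1+n _))
... | inᵐ rewrite at-middle (rightSizes L) (bsize R) (rightSizes R) (length-rightSizes L) = ≤-refl
... | inʳ {a} i rewrite at-right (rightSizes L) (bsize R) (rightSizes R) (length-rightSizes L) (proj₁ i)
                      | +-assoc (bsize L) a (at (rightSizes R) a) = s≤s (+-monoʳ-≤ (bsize L) (rightSizes-bound R i))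

leftSizes-bound : ∀ T {a} → In (bsize T) a → at (leftSizes T) a < a
leftSizes-bound leaf (s≤s _ , ())
leftSizes-bound (node L R) h with zone (bsize L) (bsize R) h
... | inˡ i rewrite at-left (leftSizes L) (bsize L ∷ leftSizes R) (length-leftSizes L) i = leftSizes-bound L i
... | inᵐ rewrite at-middle (leftSizes L) (bsize L) (leftSizes R) (length-leftSizes L) = ≤-refl
... | inʳ {a} i rewrite at-right (leftSizes L) (bsize L) (leftSizes R) (length-leftSizes L) (proj₁ i) =
  ≤-trans (leftSizes-bound R i) (m≤n+m a (suc (bsize L)))

at-mirror : ∀ T {a b} → 1 ≤ a → 1 ≤ b → a + b ≡ suc (bsize T) → at (leftSizes T) a ≡ at (rightSizes (mirror T)) b
at-mirror leaf 1≤a 1≤b _ = refl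
at-mirror (node L R) {a} {b} 1≤a 1≤b e with zone (bsize L) (bsize R) {a} (1≤a , s≤s⁻¹ a<)
  where
  a< : a < suc (suc (bsize L + bsize R))
  a< = subst (a <_) e (m<m+n a 1≤b)
... | inˡ i@(_ , a≤L) with m≤n⇒∃[o]m+o≡n a≤L
... | o , o-eq = begin
  at (leftSizes L ++ bsize L ∷ leftSizes R) a ≡⟨ at-left (leftSizes L) _ (length-leftSizes L) i ⟩
  at (leftSizes L) a                          ≡⟨ at-mirror L 1≤a (s≤s z≤n) (trans (+-suc a o) (cong suc o-eq)) ⟩
  at (rightSizes (mirror L)) (suc o)
    ≡⟨ at-right (rightSizes (mirror R)) (bsize (mirror L)) _ (trans (length-rightSizes (mirror R)) (bsize-mirror R)) (s≤s z≤n) ⟨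
  at (rightSizes (mirror (node L R))) (suc (bsize R) + suc o) ≡⟨ cong (at (rightSizes (mirror (node L R)))) b-eq ⟨
  at (rightSizes (mirror (node L R))) b       ∎
  where
  open ≡-Reasoning
  lemma : ∀ a o r → suc (suc (a + o + r)) ≡ a + (suc r + suc o)
  lemma = solve-∀
  b-eq : b ≡ suc (bsize R) + suc o
  b-eq = +-cancelˡ-≡ a b _ (trans e (trans (cong (λ x → suc (suc (x + bsize R))) (sym o-eq)) (lemma a o (bsize R))))
at-mirror (node L R) {_} {b} 1≤a 1≤b e | inᵐ = begin
  at (leftSizes L ++ bsize L ∷ leftSizes R) (suc (bsize L)) ≡⟨ at-middle (leftSizes L) _ _ (length-leftSizes L) ⟩
  bsize L ≡⟨ bsize-mirror L ⟨
  bsize (mirror L) ≡⟨ at-middle (rightSizes (mirror R)) _ _ (trans (length-rightSizes (mirror R)) (bsize-mirror R)) ⟨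
  at (rightSizes (mirror (node L R))) (suc (bsize R)) ≡⟨ cong (at (rightSizes (mirror (node L R)))) b-eq ⟨
  at (rightSizes (mirror (node L R))) b ∎
  where
  open ≡-Reasoning
  b-eq : b ≡ suc (bsize R)
  b-eq = +-cancelˡ-≡ (suc (bsize L)) b _ (trans e (cong suc (sym (+-suc (bsize L) (bsize R)))))
at-mirror (node L R) {_} {b} 1≤a 1≤b e | inʳ {a} i = begin
  at (leftSizes L ++ bsize L ∷ leftSizes R) (suc (bsize L) + a) ≡⟨ at-right (leftSizes L) _ _ (length-leftSizes L) (proj₁ i) ⟩
  at (leftSizes R) a ≡⟨ at-mirror R (proj₁ i) 1≤b e' ⟩
  at (rightSizes (mirror R)) b ≡⟨ at-left (rightSizes (mirror R)) _ (trans (length-rightSizes (mirror R)) (bsize-mirror R)) (1≤b , b≤) ⟨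
  at (rightSizes (mirror (node L R))) b ∎
  where
  open ≡-Reasoning
  e' : a + b ≡ suc (bsize R)
  e' = +-cancelˡ-≡ (suc (bsize L)) _ _ (trans (sym (+-assoc (suc (bsize L)) a b)) (trans e (cong suc (sym (+-suc (bsize L) (bsize R))))))
  b≤ : b ≤ bsize R
  b≤ = s≤s⁻¹ (subst (b <_) e' (m<n+m b (proj₁ i)))

-- The root is recognised as the first position a for which a plus its right size reaches the end;
-- positions in the left subtree stop before the root.
rightSizes-injective : ∀ T T' → bsize T ≡ bsize T' → (∀ a → In (bsize T) a → at (rightSizes T) a ≡ at (rightSizes T') a) → T ≡ T'
rightSizes-injective leaf       leaf         e h = refl
rightSizes-injective (node L R) (node L' R') e h =
  cong₂ node (rightSizes-injective L L' eL λ a i → trans (sym (atL i)) (trans (h a (inL i)) (atL' i)))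
             (rightSizes-injective R R' eR λ a i → trans (sym (atR i)) (trans (h _ (inR i)) (atR' i)))
  where
  root≮ : ∀ L R L' R' → bsize (node L R) ≡ bsize (node L' R') →
          (∀ a → In (bsize (node L R)) a → at (rightSizes (node L R)) a ≡ at (rightSizes (node L' R')) a) → ¬ (bsize L < bsize L')
  root≮ L R L' R' e h lt = <⇒≱ (≤-trans (s≤s (m≤m+n (bsize L') (bsize R'))) (≤-reflexive (sym e))) (begin
    suc (bsize L) + bsize R                              ≡⟨ cong (suc (bsize L) +_) (at-middle (rightSizes L) _ _ (length-rightSizes L)) ⟨
    suc (bsize L) + at (rightSizes (node L R)) (suc (bsize L))   ≡⟨ cong (suc (bsize L) +_) (h _ (s≤s z≤n , s≤s (m≤m+n _ _))) ⟩
    suc (bsize L) + at (rightSizes (node L' R')) (suc (bsize L)) ≡⟨ cong (suc (bsize L) +_) (at-left (rightSizes L') _ (length-rightSizes L') (s≤s z≤n , lt)) ⟩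
    suc (bsize L) + at (rightSizes L') (suc (bsize L))   ≤⟨ rightSizes-bound L' (s≤s z≤n , lt) ⟩
    bsize L' ∎)
    where open ≤-Reasoning
  eL : bsize L ≡ bsize L'
  eL = ≤-antisym (≮⇒≥ (root≮ L' R' L R (sym e) λ a i → sym (h a (subst (λ n → In n a) (sym e) i)))) (≮⇒≥ (root≮ L R L' R' e h))
  eR : bsize R ≡ bsize R'
  eR = +-cancelˡ-≡ (bsize L) _ _ (trans (suc-injective e) (cong (_+ bsize R') (sym eL)))
  inL : ∀ {a} → In (bsize L) a → In (bsize (node L R)) a
  inL (p , q) = p , ≤-trans q (≤-trans (m≤m+n _ _) (n≤1+n _))
  inR : ∀ {a} → In (bsize R) a → In (bsize (node L R)) (suc (bsize L) + a)
  inR (p , q) = s≤s z≤n , s≤s (+-monoʳ-≤ (bsize L) q)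
  atL : ∀ {a} → In (bsize L) a → at (rightSizes (node L R)) a ≡ at (rightSizes L) a
  atL i = at-left (rightSizes L) _ (length-rightSizes L) i
  atL' : ∀ {a} → In (bsize L) a → at (rightSizes (node L' R')) a ≡ at (rightSizes L') a
  atL' i = at-left (rightSizes L') _ (trans (length-rightSizes L') (sym eL)) i
  atR : ∀ {a} → In (bsize R) a → at (rightSizes (node L R)) (suc (bsize L) + a) ≡ at (rightSizes R) a
  atR i = at-right (rightSizes L) _ _ (length-rightSizes L) (proj₁ i)
  atR' : ∀ {a} → In (bsize R) a → at (rightSizes (node L' R')) (suc (bsize L) + a) ≡ at (rightSizes R') a
  atR' i = at-right (rightSizes L') _ _ (trans (length-rightSizes L') (sym eL)) (proj₁ i)

-- In in-order a right subtree occupies the positions just after its node and a left subtree those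
-- just before. So both tree relations become inequalities, which behave well under concatenation of
-- lists.
Dec◁ Inc◁ : List ℕ → ℕ → ℕ → Set
Dec◁ v a b = b < a × a ≤ b + at v b
Inc◁ w a b = a < b × b ≤ a + at w b

Rel : List ℕ → List ℕ → ℕ → ℕ → Set
Rel v w a b = a ≡ b ⊎ Dec◁ v a b ⊎ Inc◁ w a b

if-true : ∀ {A : Set} b {x y : A} → T b → (if b then x else y) ≡ x
if-true true _ = refl

if-false : ∀ {A : Set} b {x y : A} → ¬ T b → (if b then x else y) ≡ y
if-false true  h = ⊥-elim (h tt)
if-false false h = refl

T-ext : ∀ {x y} → (T x → T y) → (T y → T x) → x ≡ y
T-ext {true}  {true}  f g = refl
T-ext {true}  {false} f g = ⊥-elim (f tt)
T-ext {false} {true}  f g = ⊥-elim (g tt)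
T-ext {false} {false} f g = refl

T∧ : ∀ {x y} → T x → T y → T (x ∧ y)
T∧ p q = Equivalence.from T-∧ (p , q)

T∧⁻ : ∀ {x y} → T (x ∧ y) → T x × T y
T∧⁻ = Equivalence.to T-∧

T∨⁻ : ∀ {x y} → T (x ∨ y) → T x ⊎ T y
T∨⁻ = Equivalence.to T-∨

T∨ˡ : ∀ {x y} → T x → T (x ∨ y)
T∨ˡ p = Equivalence.from T-∨ (inj₁ p)

T∨ʳ : ∀ {x y} → T y → T (x ∨ y)
T∨ʳ {x} p = Equivalence.from (T-∨ {x}) (inj₂ p)

inRight⇔ : ∀ T {a} b → In (bsize T) a → Data.Bool.Base.T (inRight T a b) ⇔ Dec◁ (rightSizes T) b a
inRight⇔ leaf b (s≤s _ , ())
inRight⇔ (node L R) b i with zone (bsize L) (bsize R) i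
... | inˡ {a} j rewrite at-left (rightSizes L) (bsize R ∷ rightSizes R) (length-rightSizes L) j
  | if-false (a ≡ᵇ suc (bsize L)) {(suc (bsize L) <ᵇ b) ∧ (b ≤ᵇ suc (bsize L) + bsize R)}
      {if a <ᵇ suc (bsize L) then inRight L a b else inRight R (a ∸ suc (bsize L)) (b ∸ suc (bsize L))}
      (λ t → <⇒≢ (s≤s (proj₂ j)) (≡ᵇ⇒≡ a _ t))
  | if-true (a <ᵇ suc (bsize L)) {inRight L a b} {inRight R (a ∸ suc (bsize L)) (b ∸ suc (bsize L))} (<⇒<ᵇ (s≤s (proj₂ j)))
  = inRight⇔ L b j
... | inᵐ rewrite at-middle (rightSizes L) (bsize R) (rightSizes R) (length-rightSizes L)
  | if-true (bsize L ≡ᵇ bsize L) {(suc (bsize L) <ᵇ b) ∧ (b ≤ᵇ suc (bsize L) + bsize R)}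
      {if bsize L <ᵇ bsize L then inRight L (suc (bsize L)) b else inRight R (bsize L ∸ bsize L) (b ∸ suc (bsize L))}
      (≡⇒≡ᵇ (bsize L) _ refl)
  = mk⇔ (λ t → let p , q = T∧⁻ t in <ᵇ⇒< _ b p , ≤ᵇ⇒≤ b _ q) (λ (p , q) → T∧ (<⇒<ᵇ p) (≤⇒≤ᵇ q))
... | inʳ {a} j rewrite at-right (rightSizes L) (bsize R) (rightSizes R) (length-rightSizes L) (proj₁ j)
  | if-false (bsize L + a ≡ᵇ bsize L) {(suc (bsize L) <ᵇ b) ∧ (b ≤ᵇ suc (bsize L) + bsize R)}
      {if bsize L + a <ᵇ bsize L then inRight L (suc (bsize L + a)) b else inRight R (bsize L + a ∸ bsize L) (b ∸ suc (bsize L))}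
      (λ t → <⇒≢ (m<m+n (bsize L) (proj₁ j)) (sym (≡ᵇ⇒≡ (bsize L + a) _ t)))
  | if-false (bsize L + a <ᵇ bsize L) {inRight L (suc (bsize L + a)) b} {inRight R (bsize L + a ∸ bsize L) (b ∸ suc (bsize L))}
      (λ t → <⇒≱ (<ᵇ⇒< (bsize L + a) _ t) (m≤m+n (bsize L) a))
  | m+n∸m≡n (bsize L) a
  = mk⇔ (λ t → let p , q = Equivalence.to IH t in
          m<n∸o⇒o+m<n p , ≤-trans (m∸n≤o⇒m≤n+o b q) (≤-reflexive (sym (+-assoc (suc (bsize L)) a x))))
        (λ (p , q) → Equivalence.from IH (o+m<n⇒m<n∸o p , m≤n+o⇒m∸n≤o b _ (≤-trans q (≤-reflexive (+-assoc (suc (bsize L)) a x)))))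
  where
  x = at (rightSizes R) a
  IH = inRight⇔ R (b ∸ suc (bsize L)) j
  m<n∸o⇒o+m<n : ∀ {m n o} → m < n ∸ o → o + m < n
  m<n∸o⇒o+m<n {o = zero}              h = h
  m<n∸o⇒o+m<n {m} {suc n} {o = suc o} h = s≤s (m<n∸o⇒o+m<n {m} {n} {o} h)
  o+m<n⇒m<n∸o : ∀ {m n o} → o + m < n → m < n ∸ o
  o+m<n⇒m<n∸o {o = zero}              h       = h
  o+m<n⇒m<n∸o {m} {suc n} {o = suc o} (s≤s h) = o+m<n⇒m<n∸o {m} {n} {o} h
  m∸n≤o⇒m≤n+o : ∀ m {n o} → m ∸ n ≤ o → m ≤ n + o
  m∸n≤o⇒m≤n+o m       {zero}  h = h
  m∸n≤o⇒m≤n+o zero    {suc n} h = z≤n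
  m∸n≤o⇒m≤n+o (suc m) {suc n} h = s≤s (m∸n≤o⇒m≤n+o m {n} h)

inLeft⇔ : ∀ T a {b} → In (bsize T) b → Data.Bool.Base.T (inLeft T a b) ⇔ Inc◁ (leftSizes T) a b
inLeft⇔ leaf b (s≤s _ , ())
inLeft⇔ (node L R) a i with zone (bsize L) (bsize R) i
... | inˡ {b} j rewrite at-left (leftSizes L) (bsize L ∷ leftSizes R) (length-leftSizes L) j
  | if-false (b ≡ᵇ suc (bsize L)) {(1 ≤ᵇ a) ∧ (a <ᵇ suc (bsize L))}
      {if b <ᵇ suc (bsize L) then inLeft L a b else inLeft R (a ∸ suc (bsize L)) (b ∸ suc (bsize L))}
      (λ t → <⇒≢ (s≤s (proj₂ j)) (≡ᵇ⇒≡ b _ t))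
  | if-true (b <ᵇ suc (bsize L)) {inLeft L a b} {inLeft R (a ∸ suc (bsize L)) (b ∸ suc (bsize L))} (<⇒<ᵇ (s≤s (proj₂ j)))
  = inLeft⇔ L a j
... | inᵐ rewrite at-middle (leftSizes L) (bsize L) (leftSizes R) (length-leftSizes L)
  | if-true (bsize L ≡ᵇ bsize L) {(1 ≤ᵇ a) ∧ (a <ᵇ suc (bsize L))}
      {if bsize L <ᵇ bsize L then inLeft L a (suc (bsize L)) else inLeft R (a ∸ suc (bsize L)) (bsize L ∸ bsize L)}
      (≡⇒≡ᵇ (bsize L) _ refl)
  = mk⇔ (λ t → let p , q = T∧⁻ t in <ᵇ⇒< a _ q , +-monoˡ-≤ (bsize L) (≤ᵇ⇒≤ 1 a p))
        (λ (p , q) → T∧ (≤⇒≤ᵇ (+-cancelʳ-≤ (bsize L) 1 a q)) (<⇒<ᵇ p))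
... | inʳ {b} j rewrite at-right (leftSizes L) (bsize L) (leftSizes R) (length-leftSizes L) (proj₁ j)
  | if-false (bsize L + b ≡ᵇ bsize L) {(1 ≤ᵇ a) ∧ (a <ᵇ suc (bsize L))}
      {if bsize L + b <ᵇ bsize L then inLeft L a (suc (bsize L + b)) else inLeft R (a ∸ suc (bsize L)) (bsize L + b ∸ bsize L)}
      (λ t → <⇒≢ (m<m+n (bsize L) (proj₁ j)) (sym (≡ᵇ⇒≡ (bsize L + b) _ t)))
  | if-false (bsize L + b <ᵇ bsize L) {inLeft L a (suc (bsize L + b))} {inLeft R (a ∸ suc (bsize L)) (bsize L + b ∸ bsize L)}
      (λ t → <⇒≱ (<ᵇ⇒< (bsize L + b) _ t) (m≤m+n (bsize L) b))
  | m+n∸m≡n (bsize L) b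
  = mk⇔ (λ t → let p , q = Equivalence.to IH t in to (r ≤? a) p q) λ (p , q) → Equivalence.from IH (from p q)
  where
  r = suc (bsize L)
  x = at (leftSizes R) b
  x<b : x < b
  x<b = leftSizes-bound R j
  IH = inLeft⇔ R (a ∸ r) j
  to : Dec (r ≤ a) → a ∸ r < b → b ≤ (a ∸ r) + x → a < r + b × r + b ≤ a + x
  to (yes r≤a) p q = subst (_< r + b) (m+[n∸m]≡n r≤a) (+-monoʳ-< r p) ,
    ≤-trans (+-monoʳ-≤ r q) (≤-reflexive (trans (sym (+-assoc r (a ∸ r) x)) (cong (_+ x) (m+[n∸m]≡n r≤a))))
  -- Truncated subtraction sends every position up to the root to 0. Such an a is excluded because
  -- the left subtree of b occupies positive positions only.
  to (no r≰a) p q = ⊥-elim (<⇒≱ x<b (subst (λ z → b ≤ z + x) (m≤n⇒m∸n≡0 (<⇒≤ (≰⇒> r≰a))) q))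
  from : a < r + b → r + b ≤ a + x → a ∸ r < b × b ≤ (a ∸ r) + x
  from p q = +-cancelˡ-< r _ _ (subst (_< r + b) (sym eq) p) ,
    +-cancelˡ-≤ r _ _ (≤-trans q (≤-reflexive (trans (cong (_+ x) (sym eq)) (+-assoc r (a ∸ r) x))))
    where
    r≤a : r ≤ a
    r≤a = +-cancelʳ-≤ b r a (≤-trans q (+-monoʳ-≤ a (<⇒≤ x<b)))
    eq : r + (a ∸ r) ≡ a
    eq = m+[n∸m]≡n r≤a

-- Interval-posets of pairs of trees, their complement and injectivity

record Represents (P : IPoset) (n : ℕ) (S : ℕ → ℕ → Set) : Set where
  constructor represents
  field
    size : isz P ≡ n
    spec : ∀ {a b} → In n a → In n b → T (rel P a b) ⇔ S a b
open Represents

inRange⁺ : ∀ {n a} → In n a → T (inRange n a)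
inRange⁺ (p , q) = T∧ (≤⇒≤ᵇ p) (≤⇒≤ᵇ q)

inRange⁻ : ∀ {n a} → T (inRange n a) → In n a
inRange⁻ {n} {a} t = let p , q = T∧⁻ {1 ≤ᵇ a} t in ≤ᵇ⇒≤ 1 a p , ≤ᵇ⇒≤ a n q

ipOfTrees-represents : ∀ T₁ T₂ → bsize T₁ ≡ bsize T₂ →
  Represents (ipOfTrees T₁ T₂) (bsize T₁) (Rel (rightSizes T₁) (leftSizes T₂))
ipOfTrees-represents T₁ T₂ e = represents refl λ {a} {b} i j → mk⇔ (to i j) (from i j)
  where
  to : ∀ {a b} → In (bsize T₁) a → In (bsize T₁) b → T (rel (ipOfTrees T₁ T₂) a b) → Rel (rightSizes T₁) (leftSizes T₂) a b
  to {a} {b} i j t with T∨⁻ (proj₂ (T∧⁻ {inRange _ b} (proj₂ (T∧⁻ {inRange _ a} t))))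
  ... | inj₁ p = inj₁ (≡ᵇ⇒≡ a b p)
  ... | inj₂ t' with T∨⁻ {inRight T₁ b a} t'
  ... | inj₁ p = inj₂ (inj₁ (Equivalence.to (inRight⇔ T₁ a j) p))
  ... | inj₂ p = inj₂ (inj₂ (Equivalence.to (inLeft⇔ T₂ a (subst (λ n → In n b) e j)) p))
  from : ∀ {a b} → In (bsize T₁) a → In (bsize T₁) b → Rel (rightSizes T₁) (leftSizes T₂) a b → T (rel (ipOfTrees T₁ T₂) a b)
  from {a} {b} i j s = T∧ (inRange⁺ i) (T∧ (inRange⁺ j) (body s))
    where
    body : Rel (rightSizes T₁) (leftSizes T₂) a b → T ((a ≡ᵇ b) ∨ inRight T₁ b a ∨ inLeft T₂ a b)
    body (inj₁ p)        = T∨ˡ (≡⇒≡ᵇ a b p)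
    body (inj₂ (inj₁ p)) = T∨ʳ {a ≡ᵇ b} (T∨ˡ (Equivalence.from (inRight⇔ T₁ a j) p))
    body (inj₂ (inj₂ p)) = T∨ʳ {a ≡ᵇ b} (T∨ʳ {inRight T₁ b a} (Equivalence.from (inLeft⇔ T₂ a (subst (λ n → In n b) e j)) p))

represents-unique : ∀ {P Q n S} → Represents P n S → Represents Q n S → P ≈IP Q
represents-unique {P} {Q} p q = trans (size p) (sym (size q)) , λ a b 1≤a a≤ 1≤b b≤ →
  let i = 1≤a , subst (a ≤_) (size p) a≤
      j = 1≤b , subst (b ≤_) (size p) b≤
  in T-ext (λ t → Equivalence.from (spec q i j) (Equivalence.to (spec p i j) t))
           (λ t → Equivalence.from (spec p i j) (Equivalence.to (spec q i j) t))

≈IP-refl : ∀ {P} → P ≈IP P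
≈IP-refl = refl , λ _ _ _ _ _ _ → refl

≈IP-sym : ∀ {P Q} → P ≈IP Q → Q ≈IP P
≈IP-sym (e , h) = sym e , λ a b p q r s → sym (h a b p (subst (a ≤_) (sym e) q) r (subst (b ≤_) (sym e) s))

≈IP-trans : ∀ {P Q R} → P ≈IP Q → Q ≈IP R → P ≈IP R
≈IP-trans (e , h) (f , k) = trans e f , λ a b p q r s → trans (h a b p q r s) (k a b p (subst (a ≤_) e q) r (subst (b ≤_) e s))

compl-cong : ∀ {P Q} → P ≈IP Q → compl P ≈IP compl Q
compl-cong {P} {Q} (refl , h) = refl , λ a b p q r s →
  cong (λ x → inRange (isz P) a ∧ inRange (isz P) b ∧ x) (h _ _ (m<n⇒0<n∸m (s≤s q)) (flip≤ p) (m<n⇒0<n∸m (s≤s s)) (flip≤ r))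
  where
  flip≤ : ∀ {a n} → 1 ≤ a → suc n ∸ a ≤ n
  flip≤ {suc a} {n} _ = m∸n≤m n a

-- The reflection a + c = N + 1 exchanges right subtrees with left subtrees of the mirror image.
-- Decreasing and increasing relations trade places, and the two trees with them.
Rel-mirror : ∀ T₁ T₂ {a b c d} → bsize T₁ ≡ bsize T₂ → 1 ≤ a → 1 ≤ b → 1 ≤ c → 1 ≤ d →
  a + c ≡ suc (bsize T₁) → b + d ≡ suc (bsize T₁) →
  Rel (rightSizes T₁) (leftSizes T₂) a b → Rel (rightSizes (mirror T₂)) (leftSizes (mirror T₁)) c d
Rel-mirror T₁ T₂ {a} {b} {c} {d} e ha hb hc hd eac ebd = λ where
    (inj₁ refl)           → inj₁ (+-cancelˡ-≡ a c d eq)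
    (inj₂ (inj₁ (p , q))) → inj₂ (inj₂ (anti eq p , anti′ d (sym eq) (subst (λ x → a ≤ b + x) atb q)))
    (inj₂ (inj₂ (p , q))) → inj₂ (inj₁ (anti (sym eq) p , anti′ c eq (subst (λ x → b ≤ a + x) atb′ q)))
  where
  open ≤-Reasoning
  eq : a + c ≡ b + d
  eq = trans eac (sym ebd)
  anti : ∀ {a b c d} → a + c ≡ b + d → b < a → c < d
  anti {a} {b} {c} {d} e lt = +-cancelˡ-< b c d (begin-strict
    b + c <⟨ +-monoˡ-< c lt ⟩
    a + c ≡⟨ e ⟩
    b + d ∎)
  anti′ : ∀ {a b c x} d → b + d ≡ a + c → a ≤ b + x → d ≤ c + x
  anti′ {a} {b} {c} {x} d e le = +-cancelˡ-≤ b d _ (begin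
    b + d       ≡⟨ e ⟩
    a + c       ≤⟨ +-monoˡ-≤ c le ⟩
    b + x + c   ≡⟨ lemma b x c ⟩
    b + (c + x) ∎)
    where
    lemma : ∀ b x c → b + x + c ≡ b + (c + x)
    lemma = solve-∀
  atb : at (rightSizes T₁) b ≡ at (leftSizes (mirror T₁)) d
  atb = sym (trans (at-mirror (mirror T₁) hd hb (trans (+-comm d b) (trans ebd (cong suc (sym (bsize-mirror T₁))))))
                   (cong (λ S → at (rightSizes S) b) (mirror-involutive T₁)))
  atb′ : at (leftSizes T₂) b ≡ at (rightSizes (mirror T₂)) d
  atb′ = at-mirror T₂ hb hd (trans ebd (cong suc e))

compl-ipOfTrees : ∀ T₁ T₂ → bsize T₁ ≡ bsize T₂ → compl (ipOfTrees T₁ T₂) ≈IP ipOfTrees (mirror T₂) (mirror T₁)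
compl-ipOfTrees T₁ T₂ e = represents-unique
  (represents refl λ {a} {b} i j → mk⇔
    (λ t → Rel-mirror T₁ T₂ e (1≤ i) (1≤ j) (proj₁ i) (proj₁ j) (flip-sum i) (flip-sum j)
      (Equivalence.to (spec P (flipIn i) (flipIn j)) (proj₂ (T∧⁻ {inRange N b} (proj₂ (T∧⁻ {inRange N a} t))))))
    (λ r → T∧ (inRange⁺ i) (T∧ (inRange⁺ j) (Equivalence.from (spec P (flipIn i) (flipIn j)) (back i j r)))))
  (subst (λ n → Represents (ipOfTrees (mirror T₂) (mirror T₁)) n (Rel (rightSizes (mirror T₂)) (leftSizes (mirror T₁)))) (trans (bsize-mirror T₂) (sym e)) (ipOfTrees-represents (mirror T₂) (mirror T₁) e′))
  where
  N = bsize T₁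
  P = ipOfTrees-represents T₁ T₂ e
  e′ : bsize (mirror T₂) ≡ bsize (mirror T₁)
  e′ = trans (bsize-mirror T₂) (trans (sym e) (sym (bsize-mirror T₁)))
  1≤ : ∀ {a} → In N a → 1 ≤ suc N ∸ a
  1≤ (_ , q) = m<n⇒0<n∸m (s≤s q)
  flipIn : ∀ {a} → In N a → In N (suc N ∸ a)
  flipIn {suc a} i = 1≤ i , m∸n≤m N a
  flip-sum : ∀ {a} → In N a → suc N ∸ a + a ≡ suc N
  flip-sum (_ , q) = m∸n+n≡m (≤-trans q (n≤1+n N))
  back : ∀ {a b} → In N a → In N b → Rel (rightSizes (mirror T₂)) (leftSizes (mirror T₁)) a b →
         Rel (rightSizes T₁) (leftSizes T₂) (suc N ∸ a) (suc N ∸ b)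
  back {a} {b} i j r = subst₂ (λ A B → Rel (rightSizes A) (leftSizes B) (suc N ∸ a) (suc N ∸ b))
    (mirror-involutive T₁) (mirror-involutive T₂)
    (Rel-mirror (mirror T₂) (mirror T₁) e′ (proj₁ i) (proj₁ j) (1≤ i) (1≤ j) (total i) (total j) r)
    where
    total : ∀ {a} → In N a → a + (suc N ∸ a) ≡ suc (bsize (mirror T₂))
    total {a} i = trans (+-comm a _) (trans (flip-sum i) (cong suc (trans e (sym (bsize-mirror T₂)))))

-- The farthest vertex that is below a by a decreasing relation recovers the size of the right
-- subtree of a.
ipOfTrees-injectiveˡ : ∀ {T₁ T₂ T₁′ T₂′} → bsize T₁ ≡ bsize T₂ → bsize T₁′ ≡ bsize T₂′ →
                       ipOfTrees T₁ T₂ ≈IP ipOfTrees T₁′ T₂′ → T₁ ≡ T₁′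
ipOfTrees-injectiveˡ {T₁} {T₂} {T₁′} {T₂′} e e′ E@(f , _) = rightSizes-injective T₁ T₁′ f λ a i →
  ≤-antisym (at≤ {T₁} {T₂} {T₁′} {T₂′} e e′ E i) (at≤ {T₁′} {T₂′} {T₁} {T₂} e′ e (≈IP-sym E) (subst (λ n → In n a) f i))
  where
  at≤ : ∀ {T₁ T₂ T₁′ T₂′} → bsize T₁ ≡ bsize T₂ → bsize T₁′ ≡ bsize T₂′ → ipOfTrees T₁ T₂ ≈IP ipOfTrees T₁′ T₂′ →
        ∀ {a} → In (bsize T₁) a → at (rightSizes T₁) a ≤ at (rightSizes T₁′) a
  at≤ {T₁} {T₂} {T₁′} {T₂′} e e′ (f , h) {a} i with at (rightSizes T₁) a in eq
  ... | zero  = z≤n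
  ... | suc x with Equivalence.to (spec (ipOfTrees-represents T₁′ T₂′ e′) (subst (λ n → In n b) f ib) (subst (λ n → In n a) f i))
                     (subst T (h b a (proj₁ ib) (proj₂ ib) (proj₁ i) (proj₂ i))
                       (Equivalence.from (spec (ipOfTrees-represents T₁ T₂ e) ib i) (inj₂ (inj₁ (a<b , b≤)))))
    where
    b = a + suc x
    a<b : a < b
    a<b = m<m+n a (s≤s z≤n)
    b≤ : b ≤ a + at (rightSizes T₁) a
    b≤ = ≤-reflexive (cong (a +_) (sym eq))
    ib : In (bsize T₁) b
    ib = ≤-trans (proj₁ i) (m≤m+n a _) , ≤-trans b≤ (rightSizes-bound T₁ i)
  ... | inj₁ e″           = ⊥-elim (<⇒≢ (m<m+n a {suc x} (s≤s z≤n)) (sym e″))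
  ... | inj₂ (inj₁ (_ , q)) = +-cancelˡ-≤ a _ _ q
  ... | inj₂ (inj₂ (p , _)) = ⊥-elim (<⇒≱ p (m≤m+n a (suc x)))

-- `compl` makes the mirrored upper bound a lower bound, so the second tree is recovered like the
-- first.
ipOfTrees-injective : ∀ {T₁ T₂ T₁′ T₂′} → bsize T₁ ≡ bsize T₂ → bsize T₁′ ≡ bsize T₂′ →
                      ipOfTrees T₁ T₂ ≈IP ipOfTrees T₁′ T₂′ → T₁ ≡ T₁′ × T₂ ≡ T₂′
ipOfTrees-injective {T₁} {T₂} {T₁′} {T₂′} e e′ E =
  ipOfTrees-injectiveˡ e e′ E ,
  trans (sym (mirror-involutive T₂)) (trans (cong mirror
    (ipOfTrees-injectiveˡ (mirrored T₁ T₂ e) (mirrored T₁′ T₂′ e′)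
      (≈IP-trans (≈IP-sym (compl-ipOfTrees T₁ T₂ e)) (≈IP-trans (compl-cong E) (compl-ipOfTrees T₁′ T₂′ e′)))))
    (mirror-involutive T₂′))
  where
  mirrored : ∀ T₁ T₂ → bsize T₁ ≡ bsize T₂ → bsize (mirror T₂) ≡ bsize (mirror T₁)
  mirrored T₁ T₂ e = trans (bsize-mirror T₂) (trans (sym e) (sym (bsize-mirror T₁)))

-- Transitive closures

module _ (R : ℕ → ℕ → Bool) where

  warshall-⊇ : ∀ k {a b} → T (R a b) → T (warshall k R a b)
  warshall-⊇ zero    t = t
  warshall-⊇ (suc k) t = T∨ˡ (warshall-⊇ k t)

  warshall-∘ : ∀ k {a b c} → In k c → T (R a c) → T (R c b) → T (warshall k R a b)
  warshall-∘ zero    {c = suc _} (_ , ()) s t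
  warshall-∘ (suc k) {a} {b} {c} (p , q) s t with m≤n⇒m<n∨m≡n q
  ... | inj₁ (s≤s c≤k) = T∨ˡ (warshall-∘ k (p , c≤k) s t)
  ... | inj₂ refl      = T∨ʳ {warshall k R a b} (T∧ (warshall-⊇ k s) (warshall-⊇ k t))

  warshall-⊆ : ∀ {n} {S : ℕ → ℕ → Set} →
    (∀ {a b} → In n a → In n b → T (R a b) → S a b) →
    (∀ {a b c} → In n a → In n b → In n c → S a b → S b c → S a c) →
    ∀ k → k ≤ n → ∀ {a b} → In n a → In n b → T (warshall k R a b) → S a b
  warshall-⊆ R⊆S tr zero    k≤n i j t = R⊆S i j t
  warshall-⊆ R⊆S tr (suc k) k≤n {a} {b} i j t with T∨⁻ t
  ... | inj₁ t₁ = warshall-⊆ R⊆S tr k (<⇒≤ k≤n) i j t₁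
  ... | inj₂ t₂ with T∧⁻ {warshall k R a (suc k)} t₂
  ... | t₃ , t₄ = tr i m j (warshall-⊆ R⊆S tr k (<⇒≤ k≤n) i m t₃) (warshall-⊆ R⊆S tr k (<⇒≤ k≤n) m j t₄)
    where m = s≤s z≤n , k≤n

  -- Compositions of two generators suffice for grafting: only roots receive an edge to the new
  -- vertex, and every other vertex of a grafted tree lies directly below its root.
  closure-represents : ∀ {n} {S : ℕ → ℕ → Set} →
    (∀ a → S a a) →
    (∀ {a b c} → In n a → In n b → In n c → S a b → S b c → S a c) →
    (∀ {a b} → In n a → In n b → T (R a b) → S a b) →
    (∀ {a b} → In n a → In n b → S a b → T (R a b) ⊎ ∃ λ c → In n c × T (R a c) × T (R c b)) →
    Represents (closure n R) n S
  closure-represents {n} {S} rf tr R⊆S S⊆RR = represents refl λ i j → mk⇔ (to i j) (from i j)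
    where
    to : ∀ {a b} → In n a → In n b → T (rel (closure n R) a b) → S a b
    to {a} {b} i j t with T∨⁻ (proj₂ (T∧⁻ {inRange n b} (proj₂ (T∧⁻ {inRange n a} t))))
    ... | inj₁ p = subst (S a) (≡ᵇ⇒≡ a b p) (rf a)
    ... | inj₂ p = warshall-⊆ R⊆S tr n ≤-refl i j p
    from : ∀ {a b} → In n a → In n b → S a b → T (rel (closure n R) a b)
    from {a} {b} i j s = T∧ (inRange⁺ i) (T∧ (inRange⁺ j) (T∨ʳ {a ≡ᵇ b} (body (S⊆RR i j s))))
      where
      body : T (R a b) ⊎ (∃ λ c → In n c × T (R a c) × T (R c b)) → T (warshall n R a b)
      body (inj₁ t)                = warshall-⊇ n t
      body (inj₂ (c , h , t , t′)) = warshall-∘ n h t t′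

-- Roots of the decreasing forest

roots : BinTree → List ℕ
roots leaf       = []
roots (node L R) = roots L ++ suc (bsize L) ∷ []

length-roots : ∀ T → length (roots T) ≡ leftBranch T
length-roots leaf       = refl
length-roots (node L R) = trans (length-++ (roots L)) (trans (+-comm _ 1) (cong suc (length-roots L)))

-- The size of the first l trees of the decreasing forest.
prefixSize : ℕ → BinTree → ℕ
prefixSize l leaf       = 0
prefixSize l (node X Y) with leftBranch (node X Y) ≤? l
... | yes _ = bsize (node X Y)
... | no  _ = prefixSize l X

rightSizes-graftLower : ∀ A l R → rightSizes (graftLower A l R) ≡ rightSizes A ++ prefixSize l R ∷ rightSizes R
rightSizes-graftLower A l leaf = refl
rightSizes-graftLower A l (node X Y) with leftBranch (node X Y) ≤? l
... | yes _ = refl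
... | no  _ = trans (cong (_++ bsize Y ∷ rightSizes Y) (rightSizes-graftLower A l X)) (++-assoc (rightSizes A) _ _)

prefixSize≤ : ∀ l T → prefixSize l T ≤ bsize T
prefixSize≤ l leaf = z≤n
prefixSize≤ l (node X Y) with leftBranch (node X Y) ≤? l
... | yes _ = ≤-refl
... | no  _ = ≤-trans (prefixSize≤ l X) (≤-trans (m≤m+n _ _) (n≤1+n _))

-- The first l trees of the forest occupy an initial segment that no right subtree leaves;
-- transitivity at the grafted vertex rests on this.
prefixSize-closed : ∀ l T {a} → 1 ≤ a → a ≤ prefixSize l T → a + at (rightSizes T) a ≤ prefixSize l T
prefixSize-closed l leaf (s≤s _) ()
prefixSize-closed l (node X Y) 1≤a a≤ with leftBranch (node X Y) ≤? l
... | yes _ = rightSizes-bound (node X Y) (1≤a , a≤)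
... | no  _ = subst (λ x → _ + x ≤ prefixSize l X)
  (sym (at-left (rightSizes X) _ (length-rightSizes X) (1≤a , ≤-trans a≤ (prefixSize≤ l X)))) (prefixSize-closed l X 1≤a a≤)

roots-bound : ∀ T {c} → c ∈ roots T → In (bsize T) c
roots-bound (node X Y) c∈ with ∈-++⁻ (roots X) c∈
... | inj₁ p with roots-bound X p
... | 1≤c , c≤ = 1≤c , ≤-trans c≤ (≤-trans (m≤m+n _ _) (n≤1+n _))
roots-bound (node X Y) c∈ | inj₂ (here refl) = s≤s z≤n , s≤s (m≤m+n _ _)

take-++-≤ : ∀ {A : Set} l (xs ys : List A) → l ≤ length xs → take l (xs ++ ys) ≡ take l xs
take-++-≤ zero    xs       ys h       = refl
take-++-≤ (suc l) (x ∷ xs) ys (s≤s h) = cong (x ∷_) (take-++-≤ l xs ys h)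

take-roots-≥ : ∀ l T → leftBranch T ≤ l → take l (roots T) ≡ roots T
take-roots-≥ l T h = take-all l (roots T) (≤-trans (≤-reflexive (length-roots T)) h)

take-roots-< : ∀ l X Y → ¬ (leftBranch (node X Y) ≤ l) → take l (roots (node X Y)) ≡ take l (roots X)
take-roots-< l X Y h = take-++-≤ l (roots X) _ (≤-trans (s≤s⁻¹ (≰⇒> h)) (≤-reflexive (sym (length-roots X))))

take-roots≤ : ∀ l T {c} → c ∈ take l (roots T) → In (prefixSize l T) c
take-roots≤ zero    leaf ()
take-roots≤ (suc l) leaf ()
take-roots≤ l (node X Y) {c} c∈ with leftBranch (node X Y) ≤? l
... | yes h = roots-bound (node X Y) (subst (c ∈_) (take-roots-≥ l (node X Y) h) c∈)
... | no ¬h = take-roots≤ l X (subst (c ∈_) (take-roots-< l X Y ¬h) c∈)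

Dec◁-left : ∀ X Y {a c} → In (bsize X) c → Dec◁ (rightSizes X) a c → Dec◁ (rightSizes (node X Y)) a c
Dec◁-left X Y {a} {c} i (p , q) = p , subst (λ x → a ≤ c + x) (sym (at-left (rightSizes X) _ (length-rightSizes X) i)) q

roots-cover : ∀ T {a} → In (bsize T) a → a ∈ roots T ⊎ ∃ λ c → c ∈ roots T × Dec◁ (rightSizes T) a c
roots-cover leaf (s≤s _ , ())
roots-cover (node X Y) i with zone (bsize X) (bsize Y) i
... | inˡ j with roots-cover X j
... | inj₁ p           = inj₁ (∈-++⁺ˡ p)
... | inj₂ (c , p , d) = inj₂ (c , ∈-++⁺ˡ p , Dec◁-left X Y (roots-bound X p) d)
roots-cover (node X Y) i | inᵐ = inj₁ (∈-++⁺ʳ (roots X) (here refl))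
roots-cover (node X Y) i | inʳ {a} (p , q) = inj₂ (suc (bsize X) , ∈-++⁺ʳ (roots X) (here refl) , m<m+n _ p ,
  subst (λ x → suc (bsize X) + a ≤ suc (bsize X) + x) (sym (at-middle (rightSizes X) _ _ (length-rightSizes X))) (+-monoʳ-≤ (suc (bsize X)) q))

take-roots-cover : ∀ l T {a} → In (prefixSize l T) a →
                   a ∈ take l (roots T) ⊎ ∃ λ c → c ∈ take l (roots T) × Dec◁ (rightSizes T) a c
take-roots-cover l leaf (s≤s _ , ())
take-roots-cover l (node X Y) i with leftBranch (node X Y) ≤? l
... | yes h rewrite take-roots-≥ l (node X Y) h = roots-cover (node X Y) i
... | no ¬h rewrite take-roots-< l X Y ¬h with take-roots-cover l X i
... | inj₁ p           = inj₁ p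
... | inj₂ (c , p , d) = inj₂ (c , p , Dec◁-left X Y (let u , v = take-roots≤ l X p in u , ≤-trans v (prefixSize≤ l X)) d)

IsRoot : BinTree → ℕ → Set
IsRoot T b = ∀ a → 1 ≤ a → a < b → ¬ Dec◁ (rightSizes T) b a

range1-++ : ∀ n k → range1 (suc (n + k)) ≡ range1 n ++ suc n ∷ map (suc n +_) (range1 k)
range1-++ n k = begin
  map suc (upTo (suc (n + k)))                                ≡⟨ map-applyUpTo id suc (suc (n + k)) ⟩
  applyUpTo suc (suc (n + k))                                 ≡⟨ split suc n k ⟩
  applyUpTo suc n ++ suc n ∷ applyUpTo (λ i → suc (suc n + i)) k ≡⟨ cong₂ (λ xs ys → xs ++ suc n ∷ ys) (sym (map-applyUpTo id suc n)) tail-eq ⟩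
  range1 n ++ suc n ∷ map (suc n +_) (range1 k)               ∎
  where
  open ≡-Reasoning
  split : ∀ (f : ℕ → ℕ) n k → applyUpTo f (suc (n + k)) ≡ applyUpTo f n ++ f n ∷ applyUpTo (λ i → f (suc n + i)) k
  split f zero    k = refl
  split f (suc n) k = cong (f 0 ∷_) (split (f ∘ suc) n k)
  applyUpTo-cong : ∀ {f g : ℕ → ℕ} → (∀ i → f i ≡ g i) → ∀ n → applyUpTo f n ≡ applyUpTo g n
  applyUpTo-cong h zero    = refl
  applyUpTo-cong h (suc n) = cong₂ _∷_ (h 0) (applyUpTo-cong (h ∘ suc) n)
  tail-eq : applyUpTo (λ i → suc (suc n + i)) k ≡ map (suc n +_) (range1 k)
  tail-eq = trans (applyUpTo-cong (λ i → sym (+-suc (suc n) i)) k)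
    (trans (sym (map-applyUpTo suc (suc n +_) k)) (cong (map (suc n +_)) (sym (map-applyUpTo id suc k))))

∈-range1⁻ : ∀ {n a} → a ∈ range1 n → In n a
∈-range1⁻ a∈ with ∈-map⁻ suc a∈
... | i , i∈ , refl = s≤s z≤n , ∈-upTo⁻ i∈

∈-range1⁺ : ∀ {n a} → In n a → a ∈ range1 n
∈-range1⁺ {a = suc a} (_ , h) = ∈-map⁺ suc (∈-upTo⁺ h)

filterᵇ-none : ∀ {A : Set} (p : A → Bool) xs → (∀ x → x ∈ xs → ¬ T (p x)) → filterᵇ p xs ≡ []
filterᵇ-none p xs h = filter-none (T? ∘ p) (All.tabulate (h _))

-- The predicate is arbitrary so that the induction can pass the same p to the left subtree;
-- positions in the right subtree all lie below the root of the tree and are filtered out.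
filter-roots : ∀ Tr (p : ℕ → Bool) → (∀ b → In (bsize Tr) b → T (p b) ⇔ IsRoot Tr b) → filterᵇ p (range1 (bsize Tr)) ≡ roots Tr
filter-roots leaf       p h = refl
filter-roots (node X Y) p h = begin
  filterᵇ p (range1 (suc (x + y)))
    ≡⟨ cong (filterᵇ p) (range1-++ x y) ⟩
  filterᵇ p (range1 x ++ suc x ∷ map (suc x +_) (range1 y))
    ≡⟨ filter-++ (T? ∘ p) (range1 x) _ ⟩
  filterᵇ p (range1 x) ++ filterᵇ p (suc x ∷ map (suc x +_) (range1 y))
    ≡⟨ cong₂ _++_ (filter-roots X p λ b i → mk⇔ (toX b i) (fromX b i)) (filter-accept (T? ∘ p) root) ⟩
  roots X ++ suc x ∷ filterᵇ p (map (suc x +_) (range1 y))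
    ≡⟨ cong (λ zs → roots X ++ suc x ∷ zs) (filterᵇ-none p _ notRoot) ⟩
  roots X ++ suc x ∷ [] ∎
  where
  open ≡-Reasoning
  x = bsize X
  y = bsize Y
  inX : ∀ {b} → In x b → In (suc (x + y)) b
  inX (u , v) = u , ≤-trans v (≤-trans (m≤m+n x y) (n≤1+n _))
  atX : ∀ {a} → In x a → at (rightSizes (node X Y)) a ≡ at (rightSizes X) a
  atX i = at-left (rightSizes X) _ (length-rightSizes X) i
  toX : ∀ b → In x b → T (p b) → IsRoot X b
  toX b i t a 1≤a a<b d = Equivalence.to (h b (inX i)) t a 1≤a a<b (Dec◁-left X Y (1≤a , <⇒≤ (≤-trans a<b (proj₂ i))) d)
  fromX : ∀ b → In x b → IsRoot X b → T (p b)
  fromX b i r = Equivalence.from (h b (inX i)) λ a 1≤a a<b (u , v) →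
    r a 1≤a a<b (u , subst (λ z → b ≤ a + z) (atX (1≤a , <⇒≤ (≤-trans a<b (proj₂ i)))) v)
  root : T (p (suc x))
  root = Equivalence.from (h (suc x) (s≤s z≤n , s≤s (m≤m+n x y))) λ a 1≤a a<x (u , v) →
    let i = 1≤a , s≤s⁻¹ a<x in <⇒≱ (subst (λ z → x < a + z) (atX i) v) (rightSizes-bound X i)
  notRoot : ∀ b → b ∈ map (suc x +_) (range1 y) → ¬ T (p b)
  notRoot b b∈ t with ∈-map⁻ (suc x +_) b∈
  ... | c , c∈ , refl with ∈-range1⁻ {y} c∈
  ... | 1≤c , c≤y = Equivalence.to (h (suc x + c) (s≤s z≤n , s≤s (+-monoʳ-≤ x c≤y))) t (suc x) (s≤s z≤n) (m<m+n (suc x) 1≤c)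
    (m<m+n (suc x) 1≤c , subst (λ z → suc x + c ≤ suc x + z) (sym (at-middle (rightSizes X) _ _ (length-rightSizes X))) (+-monoʳ-≤ (suc x) c≤y))

any⁻ : ∀ (f : ℕ → Bool) xs → T (any f xs) → ∃ λ x → x ∈ xs × T (f x)
any⁻ f (x ∷ xs) t with T∨⁻ t
... | inj₁ u = x , here refl , u
... | inj₂ u = let y , y∈ , v = any⁻ f xs u in y , there y∈ , v

any⁺ : ∀ (f : ℕ → Bool) {x xs} → x ∈ xs → T (f x) → T (any f xs)
any⁺ f (here refl) t = T∨ˡ t
any⁺ f {xs = x ∷ xs} (there x∈) t = T∨ʳ {f x} (any⁺ f x∈ t)

member⁻ : ∀ x ys → T (member x ys) → x ∈ ys
member⁻ x ys t with any⁻ (x ≡ᵇ_) ys t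
... | y , y∈ , u = subst (_∈ ys) (sym (≡ᵇ⇒≡ x y u)) y∈

member⁺ : ∀ {x ys} → x ∈ ys → T (member x ys)
member⁺ {x} x∈ = any⁺ (x ≡ᵇ_) x∈ (≡⇒≡ᵇ x x refl)

T-not⁺ : ∀ {b} → ¬ T b → T (not b)
T-not⁺ {false} _ = tt
T-not⁺ {true}  h = h tt

T-not⁻ : ∀ {b} → T (not b) → ¬ T b
T-not⁻ {false} _ ()
T-not⁻ {true}  ()

decRoots-roots : ∀ {P w} Tr → Represents P (bsize Tr) (Rel (rightSizes Tr) w) → decRoots P ≡ roots Tr
decRoots-roots {ip _ R} {w} Tr (represents refl sp) = filter-roots Tr _ λ b i → mk⇔ (to b i) (from b i)
  where
  Q : ℕ → Bool
  Q b = not (any (λ a → R b a) (range1 (b ∸ 1)))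
  to : ∀ b → In (bsize Tr) b → T (Q b) → IsRoot Tr b
  to (suc b) i t a 1≤a a<b d = T-not⁻ t (any⁺ (R (suc b)) (∈-range1⁺ (1≤a , s≤s⁻¹ a<b))
    (Equivalence.from (sp i (1≤a , ≤-trans (<⇒≤ a<b) (proj₂ i))) (inj₂ (inj₁ d))))
  from : ∀ b → In (bsize Tr) b → IsRoot Tr b → T (Q b)
  from (suc b) i r = T-not⁺ λ t → contra (any⁻ (R (suc b)) (range1 b) t)
    where
    contra : ¬ (∃ λ a → a ∈ range1 b × T (R (suc b) a))
    contra (a , a∈ , t) with ∈-range1⁻ {b} a∈
    ... | 1≤a , a≤b with Equivalence.to (sp i (1≤a , ≤-trans (≤-trans a≤b (n≤1+n b)) (proj₂ i))) t
    ... | inj₁ e              = <⇒≢ (s≤s a≤b) (sym e)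
    ... | inj₂ (inj₁ d)       = r a 1≤a (s≤s a≤b) d
    ... | inj₂ (inj₂ (u , _)) = <⇒≱ u (≤-trans a≤b (n≤1+n b))

-- Graft⁻¹ as a pair of trees

-- The bounds say that no subtree sticks out of its block of positions, so concatenating lists
-- creates no relation between blocks by accident.
record Fits (n : ℕ) (v w : List ℕ) : Set where
  field
    lengthᵛ : length v ≡ n
    lengthʷ : length w ≡ n
    boundᵛ  : ∀ {a} → In n a → a + at v a ≤ n
    boundʷ  : ∀ {a} → In n a → at w a < a

Transitive◁ : ℕ → (ℕ → ℕ → Set) → Set
Transitive◁ n S = ∀ {a b c} → In n a → In n b → In n c → S a b → S b c → S a c

data Pos : Set where
  lft rgt : ℕ → Pos
  mid     : Pos

-- Positions of a left block, one middle vertex and a right block. The middle vertex lies above the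
-- whole left block and above the first p vertices of the right one. With an empty left block this
-- models `≻`, with both blocks `≺`.
module Zones {n k} {v₁ w₁ v₂ w₂ : List ℕ} (p : ℕ) (F₁ : Fits n v₁ w₁) (F₂ : Fits k v₂ w₂) where
  open Fits

  v w : List ℕ
  v = v₁ ++ p ∷ v₂
  w = w₁ ++ n ∷ w₂

  val : Pos → ℕ
  val (lft a) = a
  val mid     = suc n
  val (rgt a) = suc n + a

  InP : Pos → Set
  InP (lft a) = In n a
  InP mid     = ⊤
  InP (rgt a) = In k a

  RelP : Pos → Pos → Set
  RelP (lft a) (lft b) = Rel v₁ w₁ a b
  RelP (lft a) mid     = ⊤
  RelP (lft a) (rgt b) = ⊥
  RelP mid     (lft b) = ⊥
  RelP mid     mid     = ⊤
  RelP mid     (rgt b) = ⊥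
  RelP (rgt a) (lft b) = ⊥
  RelP (rgt a) mid     = a ≤ p
  RelP (rgt a) (rgt b) = Rel v₂ w₂ a b

  data View : ℕ → Set where
    view : ∀ x → InP x → View (val x)

  toView : ∀ {a} → In (suc (n + k)) a → View a
  toView i with zone n k i
  ... | inˡ j = view (lft _) j
  ... | inᵐ   = view mid tt
  ... | inʳ j = view (rgt _) j

  valIn : ∀ x → InP x → In (suc (n + k)) (val x)
  valIn (lft a) (h , h′) = h , ≤-trans h′ (≤-trans (m≤m+n n k) (n≤1+n _))
  valIn mid     _        = s≤s z≤n , s≤s (m≤m+n n k)
  valIn (rgt a) (h , h′) = s≤s z≤n , s≤s (+-monoʳ-≤ n h′)

  ¬above-left : ∀ {x b} → n < x → In n b → ¬ Rel v₁ w₁ x b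
  ¬above-left n<x (_ , b≤n) (inj₁ refl)         = <⇒≱ n<x b≤n
  ¬above-left n<x i (inj₂ (inj₁ (_ , q)))       = <⇒≱ n<x (≤-trans q (boundᵛ F₁ i))
  ¬above-left n<x (_ , b≤n) (inj₂ (inj₂ (q , _))) = <⇒≱ (<-≤-trans q b≤n) (<⇒≤ n<x)

  ¬below-right : ∀ {x b} → x ≤ suc n → In k b →
    ¬ (x ≡ suc n + b ⊎ (suc n + b < x × x ≤ suc n + b + at v₂ b) ⊎ (x < suc n + b × suc n + b ≤ x + at w₂ b))
  ¬below-right x≤ (1≤b , _) (inj₁ refl)             = <⇒≱ (m<m+n (suc n) 1≤b) x≤
  ¬below-right x≤ _ (inj₂ (inj₁ (q , _)))           = <⇒≱ q (≤-trans x≤ (m≤m+n (suc n) _))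
  ¬below-right {x} {b} x≤ i (inj₂ (inj₂ (_ , q)))   = <⇒≱ (+-mono-≤-< x≤ (boundʷ F₂ i)) q

  Rel⇔ : ∀ x y → InP x → InP y → Rel v w (val x) (val y) ⇔ RelP x y
  Rel⇔ x (lft b) i j rewrite at-left v₁ (p ∷ v₂) (lengthᵛ F₁) j | at-left w₁ (n ∷ w₂) (lengthʷ F₁) j = go x i
    where
    go : ∀ x → InP x → Rel v₁ w₁ (val x) b ⇔ RelP x (lft b)
    go (lft a) i = mk⇔ id id
    go mid     i = mk⇔ (¬above-left ≤-refl j) λ ()
    go (rgt a) i = mk⇔ (¬above-left (m≤m+n (suc n) a) j) λ ()
  Rel⇔ x mid i j rewrite at-middle v₁ p v₂ (lengthᵛ F₁) | at-middle w₁ n w₂ (lengthʷ F₁) = go x i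
    where
    go : ∀ x → InP x →
      (val x ≡ suc n ⊎ (suc n < val x × val x ≤ suc n + p) ⊎ (val x < suc n × suc n ≤ val x + n)) ⇔ RelP x mid
    go (lft a) (1≤a , a≤n) = mk⇔ (λ _ → tt) (λ _ → inj₂ (inj₂ (s≤s a≤n , +-monoˡ-≤ n 1≤a)))
    go mid     _           = mk⇔ (λ _ → tt) (λ _ → inj₁ refl)
    go (rgt a) (1≤a , _)   = mk⇔ to λ a≤p → inj₂ (inj₁ (m<m+n (suc n) 1≤a , +-monoʳ-≤ (suc n) a≤p))
      where
      to : (suc n + a ≡ suc n ⊎ (suc n < suc n + a × suc n + a ≤ suc n + p) ⊎ (suc n + a < suc n × suc n ≤ suc n + a + n)) → a ≤ p
      to (inj₁ e)              = ⊥-elim (<⇒≢ (m<m+n (suc n) 1≤a) (sym e))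
      to (inj₂ (inj₁ (_ , q))) = +-cancelˡ-≤ (suc n) a p q
      to (inj₂ (inj₂ (q , _))) = ⊥-elim (<⇒≱ q (m≤m+n (suc n) a))
  Rel⇔ x (rgt b) i j rewrite at-right v₁ p v₂ (lengthᵛ F₁) (proj₁ j) | at-right w₁ n w₂ (lengthʷ F₁) (proj₁ j) = go x i
    where
    go : ∀ x → InP x →
      (val x ≡ suc n + b ⊎ (suc n + b < val x × val x ≤ suc n + b + at v₂ b) ⊎ (val x < suc n + b × suc n + b ≤ val x + at w₂ b))
      ⇔ RelP x (rgt b)
    go (lft a) (_ , a≤n) = mk⇔ (¬below-right (≤-trans a≤n (n≤1+n n)) j) λ ()
    go mid     _         = mk⇔ (¬below-right ≤-refl j) λ ()
    go (rgt a) _         = mk⇔ to from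
      where
      to : _ → Rel v₂ w₂ a b
      to (inj₁ e)              = inj₁ (+-cancelˡ-≡ (suc n) a b e)
      to (inj₂ (inj₁ (q , r))) = inj₂ (inj₁ (+-cancelˡ-< (suc n) b a q ,
        +-cancelˡ-≤ (suc n) _ _ (≤-trans r (≤-reflexive (+-assoc (suc n) b _)))))
      to (inj₂ (inj₂ (q , r))) = inj₂ (inj₂ (+-cancelˡ-< (suc n) a b q ,
        +-cancelˡ-≤ (suc n) _ _ (≤-trans r (≤-reflexive (+-assoc (suc n) a _)))))
      from : Rel v₂ w₂ a b → _
      from (inj₁ e)              = inj₁ (cong (suc n +_) e)
      from (inj₂ (inj₁ (q , r))) = inj₂ (inj₁ (+-monoʳ-< (suc n) q ,
        ≤-trans (+-monoʳ-≤ (suc n) r) (≤-reflexive (sym (+-assoc (suc n) b _)))))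
      from (inj₂ (inj₂ (q , r))) = inj₂ (inj₂ (+-monoʳ-< (suc n) q ,
        ≤-trans (+-monoʳ-≤ (suc n) r) (≤-reflexive (sym (+-assoc (suc n) a _)))))

  transitive : Transitive◁ n (Rel v₁ w₁) → Transitive◁ k (Rel v₂ w₂) →
               (∀ {a} → 1 ≤ a → a ≤ p → a + at v₂ a ≤ p) → Transitive◁ (suc (n + k)) (Rel v w)
  transitive tr₁ tr₂ closed i j l r s with toView i | toView j | toView l
  ... | view x ix | view y iy | view z iz = Equivalence.from (Rel⇔ x z ix iz)
    (go x y z ix iy iz (Equivalence.to (Rel⇔ x y ix iy) r) (Equivalence.to (Rel⇔ y z iy iz) s))
    where
    go : ∀ x y z → InP x → InP y → InP z → RelP x y → RelP y z → RelP x z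
    go (lft a) (lft b) (lft c) i j l r s = tr₁ i j l r s
    go (lft a) y       mid     i j l r s = tt
    go (lft a) (lft b) (rgt c) i j l r ()
    go (lft a) mid     (lft c) i j l r ()
    go (lft a) mid     (rgt c) i j l r ()
    go (lft a) (rgt b) (lft c) i j l ()
    go mid     mid     z       i j l r s = s
    go (rgt a) mid     mid     i j l r s = r
    go (rgt a) mid     (lft c) i j l r ()
    go (rgt a) mid     (rgt c) i j l r ()
    go (rgt a) (rgt b) (lft c) i j l r ()
    -- The first p positions must absorb everything below them: decreasing relations by `closed`,
    -- increasing ones because they come from smaller positions.
    go (rgt a) (rgt b) mid     i (1≤b , _) l (inj₁ refl) s              = s
    go (rgt a) (rgt b) mid     i (1≤b , _) l (inj₂ (inj₁ (_ , q))) s    = ≤-trans q (closed 1≤b s)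
    go (rgt a) (rgt b) mid     i (1≤b , _) l (inj₂ (inj₂ (q , _))) s    = ≤-trans (<⇒≤ q) s
    go (rgt a) (rgt b) (rgt c) i j l r s = tr₂ i j l r s

Fits-[] : Fits 0 [] []
Fits-[] = record { lengthᵛ = refl ; lengthʷ = refl ; boundᵛ = λ { (s≤s _ , ()) } ; boundʷ = λ { (s≤s _ , ()) } }

Fits-trees : ∀ T₁ T₂ → bsize T₁ ≡ bsize T₂ → Fits (bsize T₁) (rightSizes T₁) (leftSizes T₂)
Fits-trees T₁ T₂ e = record
  { lengthᵛ = length-rightSizes T₁ ; lengthʷ = trans (length-leftSizes T₂) (sym e)
  ; boundᵛ = rightSizes-bound T₁ ; boundʷ = λ i → leftSizes-bound T₂ (subst (λ n → In n _) e i) }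

≻-represents : ∀ Q l {T₁ T₂} → bsize T₁ ≡ bsize T₂ →
  Represents Q (bsize T₁) (Rel (rightSizes T₁) (leftSizes T₂)) →
  Transitive◁ (bsize T₁) (Rel (rightSizes T₁) (leftSizes T₂)) →
  Represents (uIP ≻[ l ] Q) (suc (bsize T₁)) (Rel (prefixSize l T₁ ∷ rightSizes T₁) (0 ∷ leftSizes T₂))
≻-represents Q@(ip _ _) l {T₁} {T₂} e rep@(represents refl sp) tr =
  closure-represents R (λ _ → inj₁ refl) (transitive (λ { (s≤s _ , ()) }) tr (prefixSize-closed l T₁)) sound complete
  where
  k = bsize T₁
  open Zones (prefixSize l T₁) Fits-[] (Fits-trees T₁ T₂ e)
  R : ℕ → ℕ → Bool
  R a b = shiftRel uIP Q a b ∨ (member a (map (1 +_) (take l (decRoots Q))) ∧ (b ≡ᵇ 1))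
  roots-eq : decRoots Q ≡ roots T₁
  roots-eq = decRoots-roots {w = leftSizes T₂} T₁ rep
  one : ∀ {a} → In 1 a → a ≡ 1
  one (1≤a , a≤1) = ≤-antisym a≤1 1≤a
  sound : ∀ {a b} → In (suc k) a → In (suc k) b → T (R a b) → Rel v w a b
  sound {a} {b} i j t with T∨⁻ t
  ... | inj₂ u with T∧⁻ {member a (map (1 +_) (take l (decRoots Q)))} u
  ... | u₁ , u₂ with ∈-map⁻ (1 +_) (member⁻ a (map (1 +_) (take l (decRoots Q))) u₁) | ≡ᵇ⇒≡ b 1 u₂
  ... | c , c∈ , refl | refl with take-roots≤ l T₁ (subst (λ rs → c ∈ take l rs) roots-eq c∈)
  ... | 1≤c , c≤ = Equivalence.from (Rel⇔ (rgt c) mid (1≤c , ≤-trans c≤ (prefixSize≤ l T₁)) tt) c≤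
  sound {a} {b} i j t | inj₁ u with T∨⁻ u
  ... | inj₁ u₁ with T∧⁻ {inRange 1 a} u₁
  ... | u₂ , u₃ with one (inRange⁻ {1} {a} u₂) | one (inRange⁻ {1} {b} (proj₁ (T∧⁻ {inRange 1 b} u₃)))
  ... | refl | refl = inj₁ refl
  sound {suc a} {suc b} i j t | inj₁ u | inj₂ u₁ with T∧⁻ {1 <ᵇ suc a} u₁
  ... | u₂ , u₃ with T∧⁻ {1 <ᵇ suc b} u₃
  ... | u₄ , u₅ = Equivalence.from (Rel⇔ (rgt a) (rgt b) ia ib) (Equivalence.to (sp ia ib) u₅)
    where
    ia = s≤s⁻¹ (<ᵇ⇒< 1 (suc a) u₂) , s≤s⁻¹ (proj₂ i)
    ib = s≤s⁻¹ (<ᵇ⇒< 1 (suc b) u₄) , s≤s⁻¹ (proj₂ j)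
  R-rr : ∀ {a b} → In k a → In k b → Rel (rightSizes T₁) (leftSizes T₂) a b → T (R (suc a) (suc b))
  R-rr {suc a} {suc b} i j r = T∨ˡ (Equivalence.from (sp i j) r)
  R-rm : ∀ {a} → a ∈ take l (roots T₁) → T (R (suc a) 1)
  R-rm {a} a∈ = T∨ʳ {shiftRel uIP Q (suc a) 1}
    (T∧ (member⁺ (∈-map⁺ (1 +_) (subst (λ rs → a ∈ take l rs) (sym roots-eq) a∈))) tt)
  complete : ∀ {a b} → In (suc k) a → In (suc k) b → Rel v w a b → T (R a b) ⊎ ∃ λ c → In (suc k) c × T (R a c) × T (R c b)
  complete i j r with toView i | toView j
  ... | view x ix | view y iy = go x y ix iy (Equivalence.to (Rel⇔ x y ix iy) r)
    where
    go : ∀ x y → InP x → InP y → RelP x y → T (R (val x) (val y)) ⊎ ∃ λ c → In (suc k) c × T (R (val x) c) × T (R c (val y))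
    go (lft a) y (s≤s _ , ()) _ _
    go mid     mid ix iy r = inj₁ tt
    go (rgt a) (lft b) ix iy ()
    go mid     (lft b) ix iy ()
    go mid     (rgt b) ix iy ()
    go (rgt a) (rgt b) ix iy r = inj₁ (R-rr ix iy r)
    go (rgt a) mid ix iy r with take-roots-cover l T₁ (proj₁ ix , r)
    ... | inj₁ a∈            = inj₁ (R-rm a∈)
    ... | inj₂ (c , c∈ , d) with take-roots≤ l T₁ c∈
    ... | 1≤c , c≤ = inj₂ (suc c , (s≤s z≤n , s≤s c≤k) , R-rr ix (1≤c , c≤k) (inj₂ (inj₁ d)) , R-rm c∈)
      where
      c≤k : c ≤ k
      c≤k = ≤-trans c≤ (prefixSize≤ l T₁)

-- Every vertex on the left receives its edge to the middle vertex directly, so the generators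
-- already form the whole relation and the closure adds nothing.
≺-represents : ∀ P M p {n k v₁ w₁ v₂ w₂} (F₁ : Fits n v₁ w₁) (F₂ : Fits k v₂ w₂) →
  Represents P n (Rel v₁ w₁) → Represents M (suc k) (Rel (p ∷ v₂) (0 ∷ w₂)) →
  Transitive◁ (suc (n + k)) (Rel (v₁ ++ p ∷ v₂) (w₁ ++ n ∷ w₂)) →
  Represents (P ≺ M) (suc (n + k)) (Rel (v₁ ++ p ∷ v₂) (w₁ ++ n ∷ w₂))
≺-represents P@(ip n _) M@(ip _ _) p {_} {k} F₁ F₂ (represents refl sp₁) (represents refl sp₂) tr =
  subst (λ N → Represents (closure N R) (suc (n + k)) (Rel v w)) (sym (+-suc n k))
    (closure-represents R (λ _ → inj₁ refl) tr sound λ i j r → inj₁ (complete i j r))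
  where
  open Zones p F₁ F₂
  module Z₀ = Zones p Fits-[] F₂
  R : ℕ → ℕ → Bool
  R a b = shiftRel P M a b ∨ (inRange n a ∧ (b ≡ᵇ suc n))
  sound : ∀ {a b} → In (suc (n + k)) a → In (suc (n + k)) b → T (R a b) → Rel v w a b
  sound {a} {b} i j t with T∨⁻ {shiftRel P M a b} t
  ... | inj₂ u with T∧⁻ {inRange n a} u
  ... | u₁ , u₂ with ≡ᵇ⇒≡ b (suc n) u₂
  ... | refl = Equivalence.from (Rel⇔ (lft a) mid (inRange⁻ u₁) tt) tt
  sound {a} {b} i j t | inj₁ u with T∨⁻ u
  ... | inj₁ u₁ with T∧⁻ {inRange n a} u₁
  ... | u₂ , u₃ with T∧⁻ {inRange n b} u₃
  ... | u₄ , u₅ = Equivalence.from (Rel⇔ (lft a) (lft b) ia ib) (Equivalence.to (sp₁ ia ib) u₅)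
    where
    ia = inRange⁻ u₂
    ib = inRange⁻ u₄
  sound {a} {b} i j t | inj₁ u | inj₂ u₁ with T∧⁻ {n <ᵇ a} u₁
  ... | u₂ , u₃ with T∧⁻ {n <ᵇ b} u₃
  ... | u₄ , u₅ with toView i | toView j
  ... | view x ix | view y iy = Equivalence.from (Rel⇔ x y ix iy) (go x y ix iy (<ᵇ⇒< n _ u₂) (<ᵇ⇒< n _ u₄) u₅)
    where
    go : ∀ x y → InP x → InP y → n < val x → n < val y → T (rel M (val x ∸ n) (val y ∸ n)) → RelP x y
    go (lft a) y       ix iy h h′ t = ⊥-elim (<⇒≱ h (proj₂ ix))
    go mid     (lft b) ix iy h h′ t = ⊥-elim (<⇒≱ h′ (proj₂ iy))
    go (rgt a) (lft b) ix iy h h′ t = ⊥-elim (<⇒≱ h′ (proj₂ iy))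
    go mid     mid     ix iy h h′ t = tt
    go mid     (rgt b) ix iy h h′ t rewrite m+n∸n≡m 1 n | sym (+-suc n b) | m+n∸m≡n n (suc b) =
      Equivalence.to (Z₀.Rel⇔ mid (rgt b) tt iy) (Equivalence.to (sp₂ (Z₀.valIn mid tt) (Z₀.valIn (rgt b) iy)) t)
    go (rgt a) mid     ix iy h h′ t rewrite m+n∸n≡m 1 n | sym (+-suc n a) | m+n∸m≡n n (suc a) =
      Equivalence.to (Z₀.Rel⇔ (rgt a) mid ix tt) (Equivalence.to (sp₂ (Z₀.valIn (rgt a) ix) (Z₀.valIn mid tt)) t)
    go (rgt a) (rgt b) ix iy h h′ t rewrite sym (+-suc n a) | m+n∸m≡n n (suc a) | sym (+-suc n b) | m+n∸m≡n n (suc b) =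
      Equivalence.to (Z₀.Rel⇔ (rgt a) (rgt b) ix iy) (Equivalence.to (sp₂ (Z₀.valIn (rgt a) ix) (Z₀.valIn (rgt b) iy)) t)
  complete : ∀ {a b} → In (suc (n + k)) a → In (suc (n + k)) b → Rel v w a b → T (R a b)
  complete i j r with toView i | toView j
  ... | view x ix | view y iy = go x y ix iy (Equivalence.to (Rel⇔ x y ix iy) r)
    where
    R-m : ∀ {x y a b} → n < x → n < y → x ∸ n ≡ a → y ∸ n ≡ b → T (rel M a b) → T (R x y)
    R-m {x} {y} h h′ refl refl t =
      T∨ˡ (T∨ʳ {inRange n x ∧ inRange n y ∧ rel P x y} (T∧ (<⇒<ᵇ h) (T∧ (<⇒<ᵇ h′) t)))
    sub-r : ∀ a → suc n + a ∸ n ≡ suc a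
    sub-r a = trans (cong (_∸ n) (sym (+-suc n a))) (m+n∸m≡n n (suc a))
    go : ∀ x y → InP x → InP y → RelP x y → T (R (val x) (val y))
    go (lft a) (lft b) ix iy r = T∨ˡ (T∨ˡ (T∧ (inRange⁺ ix) (T∧ (inRange⁺ iy) (Equivalence.from (sp₁ ix iy) r))))
    go (lft a) mid     ix iy r = T∨ʳ {shiftRel P M a (suc n)} (T∧ (inRange⁺ ix) (≡⇒≡ᵇ (suc n) (suc n) refl))
    go (lft a) (rgt b) ix iy ()
    go mid     (lft b) ix iy ()
    go mid     (rgt b) ix iy ()
    go (rgt a) (lft b) ix iy ()
    go mid     mid     ix iy r = R-m ≤-refl ≤-refl (m+n∸n≡m 1 n) (m+n∸n≡m 1 n)
      (Equivalence.from (sp₂ (Z₀.valIn mid tt) (Z₀.valIn mid tt)) (inj₁ refl))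
    go (rgt a) mid     ix iy r = R-m (m≤m+n (suc n) a) ≤-refl (sub-r a) (m+n∸n≡m 1 n)
      (Equivalence.from (sp₂ (Z₀.valIn (rgt a) ix) (Z₀.valIn mid tt)) (Equivalence.from (Z₀.Rel⇔ (rgt a) mid ix tt) r))
    go (rgt a) (rgt b) ix iy r = R-m (m≤m+n (suc n) a) (m≤m+n (suc n) b) (sub-r a) (sub-r b)
      (Equivalence.from (sp₂ (Z₀.valIn (rgt a) ix) (Z₀.valIn (rgt b) iy)) (Equivalence.from (Z₀.Rel⇔ (rgt a) (rgt b) ix iy) r))

bsize-lower-shape : ∀ G → bsize (lower G) ≡ bsize (shape G)
bsize-lower-shape G = trans (bsize-lower G) (sym (bsize-shape G))

-- Transitivity is carried along because a closure is bounded from above only by a transitive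
-- relation. The sizes concatenate since the node created by `graftLower` has exactly the first l
-- trees in its right subtree.
graftInv-represents : ∀ G →
  Represents (graftInv G) (bsize (lower G)) (Rel (rightSizes (lower G)) (leftSizes (shape G))) ×
  Transitive◁ (bsize (lower G)) (Rel (rightSizes (lower G)) (leftSizes (shape G)))
graftInv-represents lleaf = represents refl (λ { (s≤s _ , ()) }) , λ { (s≤s _ , ()) }
graftInv-represents (lnode l L R) with graftInv-represents L | graftInv-represents R
... | repL , trL | repR , trR
  rewrite bsize-graftLower (lower L) l (lower R) | rightSizes-graftLower (lower L) l (lower R) | sym (bsize-lower-shape L) =
  ≺-represents (graftInv L) (uIP ≻[ l ] graftInv R) p FL FR repL (≻-represents (graftInv R) l eR repR trR) tr , tr
  where
  p = prefixSize l (lower R)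
  eR = bsize-lower-shape R
  FL = Fits-trees (lower L) (shape L) (bsize-lower-shape L)
  FR = Fits-trees (lower R) (shape R) eR
  tr = Zones.transitive p FL FR trL trR (prefixSize-closed l (lower R))

graftInv≈ipOfTrees : ∀ G → graftInv G ≈IP ipOfTrees (lower G) (shape G)
graftInv≈ipOfTrees G = represents-unique (proj₁ (graftInv-represents G))
  (ipOfTrees-represents (lower G) (shape G) (bsize-lower-shape G))

graftInv-pair : ∀ {G T₁ T₂} → bsize T₁ ≡ bsize T₂ → graftInv G ≈IP ipOfTrees T₁ T₂ → lower G ≡ T₁ × shape G ≡ T₂
graftInv-pair {G} e E = ipOfTrees-injective (bsize-lower-shape G) e (≈IP-trans (≈IP-sym (graftInv≈ipOfTrees G)) E)

-- This makes `Graft` single-valued, so the trees supplied as witnesses in `BetaM` are determined.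
graftInv-injective : ∀ {G H} → ValidGT G → ValidGT H → graftInv G ≈IP graftInv H → G ≡ H
graftInv-injective {G} {H} v w E =
  let e , f = graftInv-pair {G} (bsize-lower-shape H) (≈IP-trans E (graftInv≈ipOfTrees H))
  in shape-lower-injective G H v w f e

-- Parsing Dyck words

parse-dyck : ∀ Tr w st → parse (dyck Tr ++ w) leaf st ≡ parse w Tr st
parse-dyck leaf       w st = refl
parse-dyck (node L R) w st = begin
  parse ((dyck L ++ true ∷ dyck R ++ false ∷ []) ++ w) leaf st ≡⟨ cong (λ u → parse u leaf st) (dyck-node-++ L R w) ⟩
  parse (dyck L ++ true ∷ dyck R ++ false ∷ w) leaf st         ≡⟨ parse-dyck L _ st ⟩
  parse (dyck R ++ false ∷ w) leaf (L ∷ st)                    ≡⟨ parse-dyck R _ (L ∷ st) ⟩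
  parse w (node L R) st                                        ∎
  where open ≡-Reasoning

tree-dyck : ∀ Tr → tree (dyck Tr) ≡ Tr
tree-dyck Tr = trans (cong tree (sym (++-identityʳ (dyck Tr)))) (parse-dyck Tr [] [])

IsDyck : ℕ → List Bool → Set
IsDyck h       []          = h ≡ 0
IsDyck h       (true ∷ w)  = IsDyck (suc h) w
IsDyck zero    (false ∷ w) = ⊥
IsDyck (suc h) (false ∷ w) = IsDyck h w

IsDyck-dyck : ∀ Tr h w → IsDyck h w → IsDyck h (dyck Tr ++ w)
IsDyck-dyck leaf       h w g = g
IsDyck-dyck (node L R) h w g = subst (IsDyck h) (sym (dyck-node-++ L R w))
  (IsDyck-dyck L h _ (IsDyck-dyck R (suc h) (false ∷ w) g))

-- The prefix already consumed by the parser, recovered from its state: the invariant of a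
-- left-to-right run.
unparse : BinTree → List BinTree → List Bool
unparse acc []       = dyck acc
unparse acc (s ∷ st) = unparse s st ++ true ∷ dyck acc

unparse-node : ∀ L R st → unparse (node L R) st ≡ unparse L st ++ true ∷ dyck R ++ false ∷ []
unparse-node L R []       = refl
unparse-node L R (s ∷ st) = sym (++-assoc (unparse s st) (true ∷ dyck L) _)

unparse-parse : ∀ w acc st → IsDyck (length st) w → dyck (parse w acc st) ≡ unparse acc st ++ w
unparse-parse []          acc []       g = sym (++-identityʳ _)
unparse-parse (true ∷ w)  acc st       g = trans (unparse-parse w leaf (acc ∷ st) g) (++-assoc (unparse acc st) (true ∷ []) w)
unparse-parse (false ∷ w) acc (s ∷ st) g = begin
  dyck (parse w (node s acc) st)                        ≡⟨ unparse-parse w (node s acc) st g ⟩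
  unparse (node s acc) st ++ w                          ≡⟨ cong (_++ w) (unparse-node s acc st) ⟩
  (unparse s st ++ true ∷ dyck acc ++ false ∷ []) ++ w  ≡⟨ ++-assoc (unparse s st) _ w ⟩
  unparse s st ++ true ∷ (dyck acc ++ false ∷ []) ++ w  ≡⟨ cong (λ u → unparse s st ++ true ∷ u) (++-assoc (dyck acc) (false ∷ []) w) ⟩
  unparse s st ++ true ∷ dyck acc ++ false ∷ w          ≡⟨ ++-assoc (unparse s st) (true ∷ dyck acc) (false ∷ w) ⟨
  (unparse s st ++ true ∷ dyck acc) ++ false ∷ w        ∎
  where open ≡-Reasoning

dyck-tree : ∀ w → IsDyck 0 w → dyck (tree w) ≡ w
dyck-tree w = unparse-parse w leaf []

countTrue-++ : ∀ u v → countTrue (u ++ v) ≡ countTrue u + countTrue v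
countTrue-++ []          v = refl
countTrue-++ (true ∷ u)  v = cong suc (countTrue-++ u v)
countTrue-++ (false ∷ u) v = countTrue-++ u v

countTrue-dyck : ∀ Tr → countTrue (dyck Tr) ≡ bsize Tr
countTrue-dyck leaf       = refl
countTrue-dyck (node L R) = begin
  countTrue (dyck L ++ true ∷ dyck R ++ false ∷ [])           ≡⟨ countTrue-++ (dyck L) _ ⟩
  countTrue (dyck L) + suc (countTrue (dyck R ++ false ∷ [])) ≡⟨ cong (λ n → countTrue (dyck L) + suc n) (trans (countTrue-++ (dyck R) _) (+-identityʳ _)) ⟩
  countTrue (dyck L) + suc (countTrue (dyck R))               ≡⟨ cong₂ (λ a b → a + suc b) (countTrue-dyck L) (countTrue-dyck R) ⟩
  bsize L + suc (bsize R)                                     ≡⟨ +-suc _ _ ⟩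
  suc (bsize L + bsize R)                                     ∎
  where open ≡-Reasoning

-- The number of up steps starting at height 0 before w, started at height h,
-- first goes below 0.
contacts : ℕ → List Bool → ℕ
contacts h       []          = 0
contacts zero    (true ∷ w)  = suc (contacts 1 w)
contacts (suc h) (true ∷ w)  = contacts (suc (suc h)) w
contacts zero    (false ∷ w) = 0
contacts (suc h) (false ∷ w) = contacts h w

contacts-suc : ∀ h Tr w → contacts (suc h) (dyck Tr ++ w) ≡ contacts (suc h) w
contacts-suc h leaf       w = refl
contacts-suc h (node L R) w = begin
  contacts (suc h) ((dyck L ++ true ∷ dyck R ++ false ∷ []) ++ w) ≡⟨ cong (contacts (suc h)) (dyck-node-++ L R w) ⟩
  contacts (suc h) (dyck L ++ true ∷ dyck R ++ false ∷ w)         ≡⟨ contacts-suc h L _ ⟩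
  contacts (suc (suc h)) (dyck R ++ false ∷ w)                    ≡⟨ contacts-suc (suc h) R _ ⟩
  contacts (suc h) w                                              ∎
  where open ≡-Reasoning

contacts-zero : ∀ Tr w → contacts 0 (dyck Tr ++ w) ≡ leftBranch Tr + contacts 0 w
contacts-zero leaf       w = refl
contacts-zero (node L R) w = begin
  contacts 0 ((dyck L ++ true ∷ dyck R ++ false ∷ []) ++ w)      ≡⟨ cong (contacts 0) (dyck-node-++ L R w) ⟩
  contacts 0 (dyck L ++ true ∷ dyck R ++ false ∷ w)              ≡⟨ contacts-zero L _ ⟩
  leftBranch L + suc (contacts 1 (dyck R ++ false ∷ w))          ≡⟨ cong (λ n → leftBranch L + suc n) (contacts-suc 0 R _) ⟩
  leftBranch L + suc (contacts 0 w)                              ≡⟨ +-suc _ _ ⟩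
  suc (leftBranch L + contacts 0 w)                              ∎
  where open ≡-Reasoning

contacts-dyck : ∀ Tr → contacts 0 (dyck Tr) ≡ leftBranch Tr
contacts-dyck Tr = trans (cong (contacts 0) (sym (++-identityʳ (dyck Tr)))) (trans (contacts-zero Tr []) (+-identityʳ _))

upContacts : List Bool → List ℕ
upContacts []          = []
upContacts (true ∷ w)  = contacts 0 w ∷ upContacts w
upContacts (false ∷ w) = upContacts w

-- What follows the up step of a node is the word of its right subtree R and then a down step
-- leaving the level, so the contacts seen are those within R, its left branch.
upContacts-dyck-++ : ∀ Tr w → upContacts (dyck Tr ++ w) ≡ decArities Tr ++ upContacts w
upContacts-dyck-++ leaf       w = refl
upContacts-dyck-++ (node L R) w = begin
  upContacts ((dyck L ++ true ∷ dyck R ++ false ∷ []) ++ w)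
    ≡⟨ cong upContacts (dyck-node-++ L R w) ⟩
  upContacts (dyck L ++ true ∷ dyck R ++ false ∷ w)
    ≡⟨ upContacts-dyck-++ L _ ⟩
  decArities L ++ contacts 0 (dyck R ++ false ∷ w) ∷ upContacts (dyck R ++ false ∷ w)
    ≡⟨ cong₂ (λ n xs → decArities L ++ n ∷ xs) (trans (contacts-zero R _) (+-identityʳ _)) (upContacts-dyck-++ R _) ⟩
  decArities L ++ leftBranch R ∷ decArities R ++ upContacts w
    ≡⟨ ++-assoc (decArities L) (leftBranch R ∷ decArities R) _ ⟨
  decArities (node L R) ++ upContacts w ∎
  where open ≡-Reasoning

upContacts-dyck : ∀ Tr → upContacts (dyck Tr) ≡ decArities Tr
upContacts-dyck Tr = trans (cong upContacts (sym (++-identityʳ (dyck Tr)))) (trans (upContacts-dyck-++ Tr []) (++-identityʳ _))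

-- β on grafting trees

-- β as a relation, because `Graft` is known only through its inverse. `middle` is the grafting tree
-- of the complemented interval: bounds swapped and mirrored.
record Beta (G H : LTree) : Set where
  constructor beta
  field
    {middle} : LTree
    valid    : ValidGT middle
    lower≡   : lower middle ≡ mirror (shape (LB G))
    shape≡   : shape middle ≡ mirror (lower (LB G))
    result   : H ≡ LB middle

Beta-total : ∀ G → ValidGT G → ∃ (Beta G)
Beta-total G v with graft (mirror-Path (longestPath (LB G) (valid-LB G v)))
... | M , w , e , f , _ = LB M , beta w e f refl

-- `LB` and `mirror` are involutions, so the construction runs backwards with `LB G` as its middle
-- tree.
Beta-sym : ∀ {G H} → ValidGT G → Beta G H → Beta H G
Beta-sym {G} v (beta {M} w e f refl) = beta {middle = LB G} (valid-LB G v)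
  (trans (sym (mirror-involutive _)) (cong mirror (trans (sym f) (cong shape (sym (LB-involutive M))))))
  (trans (sym (mirror-involutive _)) (cong mirror (trans (sym e) (cong lower (sym (LB-involutive M))))))
  (sym (LB-involutive G))

Beta-valid : ∀ {G H} → Beta G H → ValidGT H
Beta-valid (beta {M} w _ _ refl) = valid-LB M w

Beta-slack : ∀ {G H} → ValidGT G → Beta G H → slack G ≡ slack H
Beta-slack {G} v (beta {M} w e f refl) =
  trans (sym (slack-LB G)) (trans (slack-mirror (LB G) M (valid-LB G v) w e f) (sym (slack-LB M)))

Beta-size : ∀ {G H} → Beta G H → lsize G ≡ lsize H
Beta-size {G} (beta {M} w e f refl) = begin
  lsize G                       ≡⟨ lsize-LB G ⟨
  lsize (LB G)                  ≡⟨ bsize-shape (LB G) ⟨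
  bsize (shape (LB G))          ≡⟨ bsize-mirror (shape (LB G)) ⟨
  bsize (mirror (shape (LB G))) ≡⟨ cong bsize e ⟨
  bsize (lower M)               ≡⟨ bsize-lower M ⟩
  lsize M                       ≡⟨ lsize-LB M ⟨
  lsize (LB M)                  ∎
  where open ≡-Reasoning

-- The number of roots is size minus label sum, and `LB` changes neither.
leftBranch-lower-LB : ∀ M → ValidGT M → leftBranch (lower (LB M)) ≡ leftBranch (lower M)
leftBranch-lower-LB M v = +-cancelˡ-≡ (labelSum M) _ _ (begin
  labelSum M + leftBranch (lower (LB M))      ≡⟨ cong (_+ leftBranch (lower (LB M))) (labelSum-LB M) ⟨
  labelSum (LB M) + leftBranch (lower (LB M)) ≡⟨ labels-leftBranch (LB M) (valid-LB M v) ⟩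
  lsize (LB M)                                ≡⟨ lsize-LB M ⟩
  lsize M                                     ≡⟨ labels-leftBranch M v ⟨
  labelSum M + leftBranch (lower M)           ∎)
  where open ≡-Reasoning

dyck-shape : ∀ G → dyck (shape G) ≡ dyck (LBᵀ (shape (LB G)))
dyck-shape G = cong dyck (trans (cong shape (sym (LB-involutive G))) (shape-LB (LB G)))

Beta-leading : ∀ {G H} → Beta G H → leading (dyck (shape G)) ≡ leftBranch (lower H)
Beta-leading {G} (beta {M} w e f refl) = begin
  leading (dyck (shape G))             ≡⟨ cong leading (dyck-shape G) ⟩
  leading (dyck (LBᵀ (shape (LB G))))  ≡⟨ leading-LBᵀ (shape (LB G)) ⟩
  leftBranch (mirror (shape (LB G)))   ≡⟨ cong leftBranch e ⟨
  leftBranch (lower M)                 ≡⟨ leftBranch-lower-LB M w ⟨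
  leftBranch (lower (LB M))            ∎
  where open ≡-Reasoning

rList-dyck : ∀ G → rList (dyck (shape G)) ≡ decArities (mirror (shape (LB G)))
rList-dyck G = trans (cong rList (dyck-shape G)) (rList-LBᵀ (shape (LB G)))

Beta-rList : ∀ {G H} → Beta G H → rList (dyck (shape G)) ↭ labels H
Beta-rList {G} (beta {M} w e f refl) = begin
  rList (dyck (shape G))             ≡⟨ rList-dyck G ⟩
  decArities (mirror (shape (LB G))) ≡⟨ cong decArities e ⟨
  decArities (lower M)               ≡⟨ decArities-lower M w ⟩
  labels M                           ↭⟨ labels-LB M ⟨
  labels (LB M)                      ∎
  where open PermutationReasoning

dropLast-∷ʳ : ∀ {A : Set} (xs : List A) x → dropLast (xs ++ x ∷ []) ≡ xs
dropLast-∷ʳ []           x = refl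
dropLast-∷ʳ (y ∷ [])     x = refl
dropLast-∷ʳ (y ∷ z ∷ xs) x = cong (y ∷_) (dropLast-∷ʳ (z ∷ xs) x)

-- A permutation need not respect the last entry in general; here both last entries are 0 and can be
-- cancelled.
dropLast-decArities : ∀ S Tr → decArities S ↭ decArities Tr → dropLast (decArities S) ↭ dropLast (decArities Tr)
dropLast-decArities S Tr p with decArities-∷ʳ S | decArities-∷ʳ Tr
... | inj₂ (xs , e) | inj₂ (ys , f) rewrite e | f | dropLast-∷ʳ xs 0 | dropLast-∷ʳ ys 0 =
  ↭-trans (↭-reflexive (sym (++-identityʳ xs))) (↭-trans (drop-mid xs ys p) (↭-reflexive (++-identityʳ ys)))
... | inj₁ refl | inj₁ refl = ↭-refl
... | inj₁ refl | inj₂ (ys , f) with trans (↭-length p) (trans (cong length f) (trans (length-++ ys) (+-comm _ 1)))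
... | ()
dropLast-decArities S Tr p | inj₂ (xs , e) | inj₁ refl with trans (sym (↭-length p)) (trans (cong length e) (trans (length-++ xs) (+-comm _ 1)))
... | ()

Beta-dropLast : ∀ {G H} → Beta G H → dropLast (rList (dyck (shape G))) ↭ dropLast (labels H)
Beta-dropLast {G} {H} b = begin
  dropLast (rList (dyck (shape G)))             ≡⟨ cong dropLast (rList-dyck G) ⟩
  dropLast (decArities (mirror (shape (LB G)))) ↭⟨ dropLast-decArities (mirror (shape (LB G))) (lower H)
    (↭-trans (↭-reflexive (sym (rList-dyck G))) (↭-trans (Beta-rList b) (↭-reflexive (sym (decArities-lower H (Beta-valid b)))))) ⟩
  dropLast (decArities (lower H))               ≡⟨ cong dropLast (decArities-lower H (Beta-valid b)) ⟩
  dropLast (labels H)                           ∎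
  where open PermutationReasoning

-- m-ballot paths

-- The function local to DD that repeats up steps cannot be named here; the
-- underscore stands for it and is solved when DD-true is checked.
mutual
  rep≡replicate : ∀ M k → _ ≡ replicate k true
  rep≡replicate M zero    = refl
  rep≡replicate M (suc k) = cong (true ∷_) (rep≡replicate M k)

  DD-true : ∀ k s → DD (suc k) (true ∷ s) ≡ replicate (suc k) true ++ DD (suc k) s
  DD-true k s with suc k
  ... | M = cong (λ z → true ∷ (z ++ DD M s)) (rep≡replicate M k)

IsDyck-ups⁺ : ∀ j h w → IsDyck (h + j) w → IsDyck h (replicate j true ++ w)
IsDyck-ups⁺ zero    h w g = subst (λ x → IsDyck x w) (+-identityʳ h) g
IsDyck-ups⁺ (suc j) h w g = IsDyck-ups⁺ j (suc h) w (subst (λ x → IsDyck x w) (+-suc h j) g)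

IsDyck-ups⁻ : ∀ j h w → IsDyck h (replicate j true ++ w) → IsDyck (h + j) w
IsDyck-ups⁻ zero    h w g = subst (λ x → IsDyck x w) (sym (+-identityʳ h)) g
IsDyck-ups⁻ (suc j) h w g = subst (λ x → IsDyck x w) (sym (+-suc h j)) (IsDyck-ups⁻ j (suc h) w g)

countTrue-ups : ∀ j w → countTrue (replicate j true ++ w) ≡ j + countTrue w
countTrue-ups zero    w = refl
countTrue-ups (suc j) w = cong suc (countTrue-ups j w)

leading-ups : ∀ j w → leading (replicate j true ++ w) ≡ j + leading w
leading-ups zero    w = refl
leading-ups (suc j) w = cong suc (leading-ups j w)

rList-ups : ∀ j w → rList (replicate j true ++ w) ≡ rList w
rList-ups zero    w = refl
rList-ups (suc j) w = rList-ups j w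

contacts-ups : ∀ j h w → contacts (suc h) (replicate j true ++ w) ≡ contacts (suc h + j) w
contacts-ups zero    h w = cong (λ x → contacts (suc x) w) (sym (+-identityʳ h))
contacts-ups (suc j) h w = trans (contacts-ups j (suc h) w) (cong (λ x → contacts (suc x) w) (sym (+-suc h j)))

countᵇ : (ℕ → Bool) → ℕ → ℕ
countᵇ p zero    = 0
countᵇ p (suc n) = (if p 0 then 1 else 0) + countᵇ (p ∘ suc) n

length-filterᵇ : ∀ (p : ℕ → Bool) (f : ℕ → ℕ) n → length (filterᵇ p (applyUpTo f n)) ≡ countᵇ (p ∘ f) n
length-filterᵇ p f zero = refl
length-filterᵇ p f (suc n) with p (f 0)
... | true  = cong suc (length-filterᵇ p (f ∘ suc) n)
... | false = length-filterᵇ p (f ∘ suc) n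

countᵇ-cong : ∀ {p q : ℕ → Bool} → (∀ i → p i ≡ q i) → ∀ n → countᵇ p n ≡ countᵇ q n
countᵇ-cong h zero    = refl
countᵇ-cong h (suc n) = cong₂ (λ b c → (if b then 1 else 0) + c) (h 0) (countᵇ-cong (h ∘ suc) n)

dropLast-map : ∀ {A B : Set} (f : A → B) xs → dropLast (map f xs) ≡ map f (dropLast xs)
dropLast-map f []           = refl
dropLast-map f (x ∷ [])     = refl
dropLast-map f (x ∷ y ∷ xs) = cong (f x ∷_) (dropLast-map f (y ∷ xs))

countZeros-dropLast : ∀ h m h′ s → countZeros (dropLast (h ∷ portion m h′ s)) ≡ countZeros (h ∷ dropLast (portion m h′ s))
countZeros-dropLast h m h′       []          = refl
countZeros-dropLast h m h′       (true ∷ s)  = refl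
countZeros-dropLast h m zero     (false ∷ s) = refl
countZeros-dropLast h m (suc h′) (false ∷ s) = refl

module Ballot (k : ℕ) where

  m : ℕ
  m = suc k

  Above : ℕ → List Bool → Set
  Above h B = countFalse B ≡ h + m * countTrue B × (∀ j → countFalse (take j B) ≤ h + m * countTrue (take j B))

  height-true : ∀ h c → h + m * suc c ≡ h + m + m * c
  height-true h c = trans (cong (h +_) (*-suc m c)) (sym (+-assoc h m _))

  Above⇒IsDyck : ∀ h B → Above h B → IsDyck h (DD m B)
  Above⇒IsDyck h [] (e , _) = sym (trans e (trans (cong (h +_) (*-zeroʳ m)) (+-identityʳ h)))
  Above⇒IsDyck h (true ∷ s) (e , f) = subst (IsDyck h) (sym (DD-true k s)) (IsDyck-ups⁺ m h (DD m s)
    (Above⇒IsDyck (h + m) s (trans e (height-true h _) , λ j → ≤-trans (f (suc j)) (≤-reflexive (height-true h _)))))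
  Above⇒IsDyck zero (false ∷ s) (e , f) = ⊥-elim (<⇒≱ (s≤s z≤n) (≤-trans (f 1) (≤-reflexive (*-zeroʳ m))))
  Above⇒IsDyck (suc h) (false ∷ s) (e , f) = Above⇒IsDyck h s (suc-injective e , λ j → s≤s⁻¹ (f (suc j)))

  IsDyck⇒Above : ∀ h B → IsDyck h (DD m B) → Above h B
  IsDyck⇒Above h [] refl = sym (*-zeroʳ m) , λ { zero → z≤n ; (suc j) → z≤n }
  IsDyck⇒Above h (true ∷ s) g with IsDyck⇒Above (h + m) s (IsDyck-ups⁻ m h (DD m s) (subst (IsDyck h) (DD-true k s) g))
  ... | e , f = trans e (sym (height-true h _)) , λ { zero → z≤n ; (suc j) → ≤-trans (f j) (≤-reflexive (sym (height-true h _))) }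
  IsDyck⇒Above (suc h) (false ∷ s) g with IsDyck⇒Above h s g
  ... | e , f = cong suc e , λ { zero → z≤n ; (suc j) → s≤s (f j) }

  IsBallot⇒IsDyck : ∀ {n B} → IsBallot m n B → IsDyck 0 (DD m B)
  IsBallot⇒IsDyck {n} {B} (t , f , a) = Above⇒IsDyck 0 B (trans f (trans (cong (_* m) (sym t)) (*-comm (countTrue B) m)) , a)

  IsDyck⇒IsBallot : ∀ {n} B → countTrue B ≡ n → IsDyck 0 (DD m B) → IsBallot m n B
  IsDyck⇒IsBallot B t g with IsDyck⇒Above 0 B g
  ... | e , a = t , trans e (trans (*-comm m (countTrue B)) (cong (_* m) t)) , a

  countTrue-DD : ∀ B → countTrue (DD m B) ≡ m * countTrue B
  countTrue-DD []          = sym (*-zeroʳ m)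
  countTrue-DD (false ∷ B) = countTrue-DD B
  countTrue-DD (true ∷ B)  = begin
    countTrue (DD m (true ∷ B))                ≡⟨ cong countTrue (DD-true k B) ⟩
    countTrue (replicate m true ++ DD m B)     ≡⟨ countTrue-ups m (DD m B) ⟩
    m + countTrue (DD m B)                     ≡⟨ cong (m +_) (countTrue-DD B) ⟩
    m + m * countTrue B                        ≡⟨ *-suc m (countTrue B) ⟨
    m * suc (countTrue B)                      ∎
    where open ≡-Reasoning

  leading-DD : ∀ B → leading (DD m B) ≡ m * leading B
  leading-DD []          = sym (*-zeroʳ m)
  leading-DD (false ∷ B) = sym (*-zeroʳ m)
  leading-DD (true ∷ B)  = begin
    leading (DD m (true ∷ B))                ≡⟨ cong leading (DD-true k B) ⟩
    leading (replicate m true ++ DD m B)     ≡⟨ leading-ups m (DD m B) ⟩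
    m + leading (DD m B)                     ≡⟨ cong (m +_) (leading-DD B) ⟩
    m + m * leading B                        ≡⟨ *-suc m (leading B) ⟨
    m * suc (leading B)                      ∎
    where open ≡-Reasoning

  rList-DD : ∀ B → rList (DD m B) ≡ map (m *_) (rList B)
  rList-DD []          = refl
  rList-DD (false ∷ B) = cong₂ _∷_ (leading-DD B) (rList-DD B)
  rList-DD (true ∷ B)  = trans (cong rList (DD-true k B)) (trans (rList-ups m (DD m B)) (rList-DD B))

  DD-injective : ∀ B C → DD m B ≡ DD m C → B ≡ C
  DD-injective []          []          e = refl
  DD-injective []          (true ∷ C)  e with trans e (DD-true k C)
  ... | ()
  DD-injective (true ∷ B)  []          e with trans (sym (DD-true k B)) e
  ... | ()
  DD-injective (true ∷ B)  (true ∷ C)  e = cong (true ∷_) (DD-injective B C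
    (++-cancelˡ (replicate m true) _ _ (trans (sym (DD-true k B)) (trans e (DD-true k C)))))
  DD-injective (true ∷ B)  (false ∷ C) e with trans (sym (DD-true k B)) e
  ... | ()
  DD-injective (false ∷ B) (true ∷ C)  e with trans e (DD-true k C)
  ... | ()
  DD-injective (false ∷ B) (false ∷ C) e = cong (false ∷_) (DD-injective B C (∷-injectiveʳ e))

  portionZeros : ℕ → List Bool → ℕ
  portionZeros h s = countZeros (dropLast (portion m h s))

  -- A vertical step becomes a block of m up steps, of which only the first can start at height 0.
  -- So the zeros of the portion are the contacts of the Dyck word; its last point begins no up step
  -- and is dropped.
  portionZeros-DD : ∀ h s → portionZeros h s ≡ contacts h (DD m s)
  portionZeros-DD h       []          = refl
  portionZeros-DD zero    (true ∷ s)  = begin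
    countZeros (dropLast (0 ∷ portion m m s))      ≡⟨ countZeros-dropLast 0 m m s ⟩
    suc (portionZeros m s)                         ≡⟨ cong suc (portionZeros-DD m s) ⟩
    suc (contacts m (DD m s))                      ≡⟨ cong suc (contacts-ups k 0 (DD m s)) ⟨
    contacts 0 (replicate m true ++ DD m s)        ≡⟨ cong (contacts 0) (DD-true k s) ⟨
    contacts 0 (DD m (true ∷ s))                   ∎
    where open ≡-Reasoning
  portionZeros-DD (suc h) (true ∷ s)  = begin
    countZeros (dropLast (suc h ∷ portion m (suc h + m) s)) ≡⟨ countZeros-dropLast (suc h) m (suc h + m) s ⟩
    portionZeros (suc h + m) s                     ≡⟨ portionZeros-DD (suc h + m) s ⟩
    contacts (suc h + m) (DD m s)                  ≡⟨ contacts-ups m h (DD m s) ⟨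
    contacts (suc h) (replicate m true ++ DD m s)  ≡⟨ cong (contacts (suc h)) (DD-true k s) ⟨
    contacts (suc h) (DD m (true ∷ s))             ∎
    where open ≡-Reasoning
  portionZeros-DD zero    (false ∷ s) = refl
  portionZeros-DD (suc h) (false ∷ s) = trans (countZeros-dropLast (suc h) m h s) (portionZeros-DD h s)

  onLine : ℕ → List Bool → ℕ → Bool
  onLine h B i = countFalse (take i B) ≡ᵇ h + m * countTrue (take i B)

  -- `portion` stops where the path would drop below the line. A path that stays above never stops
  -- early, so the portion is the whole path.
  countᵇ-onLine : ∀ h B → IsDyck h (DD m B) → countᵇ (onLine h B) (length B) ≡ portionZeros h B
  countᵇ-onLine h [] g = refl
  countᵇ-onLine h (true ∷ s) g = begin
    (if 0 ≡ᵇ h + m * 0 then 1 else 0) + countᵇ (onLine h (true ∷ s) ∘ suc) (length s)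
      ≡⟨ cong₂ _+_ (cong (λ x → if 0 ≡ᵇ x then 1 else 0) (trans (cong (h +_) (*-zeroʳ m)) (+-identityʳ h)))
           (countᵇ-cong (λ i → cong (countFalse (take i s) ≡ᵇ_) (height-true h (countTrue (take i s)))) (length s)) ⟩
    (if 0 ≡ᵇ h then 1 else 0) + countᵇ (onLine (h + m) s) (length s)
      ≡⟨ cong ((if 0 ≡ᵇ h then 1 else 0) +_)
           (countᵇ-onLine (h + m) s (IsDyck-ups⁻ m h (DD m s) (subst (IsDyck h) (DD-true k s) g))) ⟩
    (if 0 ≡ᵇ h then 1 else 0) + portionZeros (h + m) s
      ≡⟨ first h ⟩
    countZeros (h ∷ dropLast (portion m (h + m) s))
      ≡⟨ countZeros-dropLast h m (h + m) s ⟨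
    portionZeros h (true ∷ s) ∎
    where
    open ≡-Reasoning
    first : ∀ h {xs} → (if 0 ≡ᵇ h then 1 else 0) + countZeros xs ≡ countZeros (h ∷ xs)
    first zero    = refl
    first (suc h) = refl
  countᵇ-onLine (suc h) (false ∷ s) g = trans (countᵇ-onLine h s g) (sym (countZeros-dropLast (suc h) m h s))

  mcontacts-DD : ∀ B → IsDyck 0 (DD m B) → mcontacts m B ≡ contacts 0 (DD m B)
  mcontacts-DD B g = trans (length-filterᵇ (onLine 0 B) id (length B)) (trans (countᵇ-onLine 0 B g) (portionZeros-DD 0 B))

  cVec : List Bool → List ℕ
  cVec B = concatMap (λ s → map (cij m s) (range1 m)) (vSuffixes B)

  -- ρ_i is the representative of -i modulo m in {0,…,m-1}: ρ_{i+1} = next ρ_i.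

  next : ℕ → ℕ
  next zero    = k
  next (suc r) = r

  advance : ℕ → ℕ → ℕ
  advance r zero    = r
  advance r (suc n) = advance (next r) n

  advance-+ : ∀ r a b → advance r (a + b) ≡ advance (advance r a) b
  advance-+ r zero    b = refl
  advance-+ r (suc a) b = advance-+ (next r) a b

  advance-suc : ∀ r a → advance r (suc a) ≡ next (advance r a)
  advance-suc r a = trans (cong (advance r) (+-comm 1 a)) (advance-+ r a 1)

  next≤ : ∀ {r} → r ≤ k → next r ≤ k
  next≤ {zero}  _ = ≤-refl
  next≤ {suc r} h = ≤-trans (n≤1+n r) h

  advance≤ : ∀ {r} n → r ≤ k → advance r n ≤ k
  advance≤ zero    h = h
  advance≤ (suc n) h = advance≤ n (next≤ h)

  m∣i+ρ : ∀ i → m ∣ i + advance 0 i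
  m∣i+ρ zero    = m ∣0
  m∣i+ρ (suc i) rewrite advance-suc 0 i with advance 0 i | m∣i+ρ i
  ... | zero  | d = subst (m ∣_) (trans (cong (_+ m) (+-identityʳ i)) (+-suc i k)) (∣m∣n⇒∣m+n d ∣-refl)
  ... | suc r | d = subst (m ∣_) (+-suc i r) d

  ρ≡0⇒m∣ : ∀ i → advance 0 i ≡ 0 → m ∣ i
  ρ≡0⇒m∣ i e = subst (m ∣_) (trans (cong (i +_) e) (+-identityʳ i)) (m∣i+ρ i)

  m∣⇒ρ≡0 : ∀ i → m ∣ i → advance 0 i ≡ 0
  m∣⇒ρ≡0 i d with advance 0 i | ∣m+n∣m⇒∣n (m∣i+ρ i) d | advance≤ {0} i z≤n
  ... | zero  | _  | _ = refl
  ... | suc r | d′ | h = ⊥-elim (<⇒≱ (s≤s h) (∣⇒≤ d′))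

-- Trees of m-ballot paths, expansion and contraction

module Expansion (k : ℕ) where
  open Ballot k

  -- The residue of a node with n nodes before it in the current subtree, where r is the residue of
  -- the vertex preceding that subtree.
  ρ : ℕ → ℕ → ℕ
  ρ r n = next (advance r n)

  -- A vertex i has positive arity iff i+1 is below i. For the arities of a tree with r = 0 this is
  -- therefore the chain condition on each block im, ..., im-(m-1) that characterises
  -- m-interval-posets.
  Positive : ℕ → List ℕ → Set
  Positive r []       = ⊤
  Positive r (l ∷ ls) = (next r ≡ 0 ⊎ 1 ≤ l) × Positive (next r) ls

  Positive-split : ∀ r xs {n l ys} → length xs ≡ n → Positive r (xs ++ l ∷ ys) →
                   Positive r xs × (ρ r n ≡ 0 ⊎ 1 ≤ l) × Positive (ρ r n) ys
  Positive-split r []       refl (p , q) = tt , p , q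
  Positive-split r (x ∷ xs) refl (p , q) with Positive-split (next r) xs refl q
  ... | a , b , c = (p , a) , b , c

  Positive-join : ∀ r xs {n l ys} → length xs ≡ n → Positive r xs → (ρ r n ≡ 0 ⊎ 1 ≤ l) → Positive (ρ r n) ys →
                  Positive r (xs ++ l ∷ ys)
  Positive-join r []       refl _       b c = b , c
  Positive-join r (x ∷ xs) refl (p , a) b c = p , Positive-join (next r) xs refl a b c

  advance-node : ∀ r a b → advance r (suc (a + b)) ≡ advance (ρ r a) b
  advance-node r a b = trans (cong (advance r) (sym (+-suc a b))) (advance-+ r a (suc b))

  -- The last vertex has arity 0, so its residue is 0. The disjunction is the same condition for the
  -- vertex just before `Tr`, which is itself the last one if `Tr` is empty.
  advance-end : ∀ r Tr → Positive r (decArities Tr) → r ≡ 0 ⊎ 1 ≤ leftBranch Tr → advance r (bsize Tr) ≡ 0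
  advance-end r leaf       _ (inj₁ e) = e
  advance-end r (node L R) h _ with Positive-split r (decArities L) (length-decArities L) h
  ... | _ , b , c = trans (advance-node r (bsize L) (bsize R)) (advance-end _ R c b)

  -- A rotation gives one node an additional child; a node that loses a child keeps a nonempty right
  -- subtree and thus positive arity. So the trees of m-ballot paths form an upper set.
  Positive-⟶ : ∀ r {S Tr} → S ⟶ Tr → Positive r (decArities S) → Positive r (decArities Tr)
  Positive-⟶ r (rot {A} {B} {C}) h
    with Positive-split r (decArities A) (length-decArities A)
           (subst (Positive r) (++-assoc (decArities A) (leftBranch B ∷ decArities B) (leftBranch C ∷ decArities C)) h)
  ... | a , _ , c = Positive-join r (decArities A) (length-decArities A) a (inj₂ (s≤s z≤n)) c
  Positive-⟶ r (left {L} {L'} {R} s) h with Positive-split r (decArities L) (trans (length-decArities L) (⟶-bsize s)) h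
  ... | a , b , c = Positive-join r (decArities L') (length-decArities L') (Positive-⟶ r s a) b c
  Positive-⟶ r (right {L} {R} {R'} s) h with Positive-split r (decArities L) (length-decArities L) h
  ... | a , _ , c = Positive-join r (decArities L) (length-decArities L) a (inj₂ (branch s)) (Positive-⟶ _ s c)
    where
    branch : ∀ {S Tr} → S ⟶ Tr → 1 ≤ leftBranch Tr
    branch rot       = s≤s z≤n
    branch (left _)  = s≤s z≤n
    branch (right _) = s≤s z≤n

  -- Every maximal run of up steps consists of complete blocks of length m; r is
  -- the number of up steps missing from the current block.
  Blocks : ℕ → List Bool → Set
  Blocks r       []          = r ≡ 0
  Blocks r       (true ∷ w)  = Blocks (next r) w
  Blocks zero    (false ∷ w) = Blocks zero w
  Blocks (suc r) (false ∷ w) = ⊥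

  Blocks-ups : ∀ j w → Blocks 0 w → Blocks j (replicate j true ++ w)
  Blocks-ups zero    w h = h
  Blocks-ups (suc j) w h = Blocks-ups j w h

  Blocks-DD : ∀ B → Blocks 0 (DD m B)
  Blocks-DD []          = refl
  Blocks-DD (false ∷ B) = Blocks-DD B
  Blocks-DD (true ∷ B)  = subst (Blocks 0) (sym (DD-true k B)) (Blocks-ups k (DD m B) (Blocks-DD B))

  Blocks⇒DD : ∀ r w → Blocks r w → ∃ λ B → w ≡ replicate r true ++ DD m B
  Blocks⇒DD r       []          refl = [] , refl
  Blocks⇒DD zero    (true ∷ w)  h with Blocks⇒DD k w h
  ... | B , e = true ∷ B , trans (cong (true ∷_) e) (sym (DD-true k B))
  Blocks⇒DD (suc r) (true ∷ w)  h with Blocks⇒DD r w h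
  ... | B , e = B , cong (true ∷_) e
  Blocks⇒DD zero    (false ∷ w) h with Blocks⇒DD zero w h
  ... | B , e = false ∷ B , cong (false ∷_) e

  Blocks-down : ∀ r w → Blocks r (false ∷ w) → r ≡ 0 × Blocks 0 w
  Blocks-down zero w h = refl , h

  Positive⇒Blocks : ∀ r Tr w → Positive r (decArities Tr) → Blocks (advance r (bsize Tr)) w → Blocks r (dyck Tr ++ w)
  Positive⇒Blocks r leaf       w h b = b
  Positive⇒Blocks r (node L R) w h b with Positive-split r (decArities L) (length-decArities L) h
  ... | a , z , c = subst (Blocks r) (sym (dyck-node-++ L R w)) (Positive⇒Blocks r L _ a (Positive⇒Blocks _ R (false ∷ w) c
    (subst (λ q → Blocks q (false ∷ w)) (sym end) (subst (λ q → Blocks q w) (trans (advance-node r (bsize L) (bsize R)) end) b))))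
    where
    end : advance (ρ r (bsize L)) (bsize R) ≡ 0
    end = advance-end _ R c z

  Blocks⇒Positive : ∀ r Tr w → Blocks r (dyck Tr ++ w) → Positive r (decArities Tr) × Blocks (advance r (bsize Tr)) w
  Blocks⇒Positive r leaf       w b = tt , b
  Blocks⇒Positive r (node L R) w b with Blocks⇒Positive r L _ (subst (Blocks r) (dyck-node-++ L R w) b)
  ... | a , b₁ with Blocks⇒Positive (ρ r (bsize L)) R (false ∷ w) b₁
  ... | c , b₂ with Blocks-down _ w b₂
  ... | e , b₃ = Positive-join r (decArities L) (length-decArities L) a (full R e) c ,
                 subst (λ q → Blocks q w) (sym (trans (advance-node r (bsize L) (bsize R)) e)) b₃
    where
    full : ∀ R → advance (ρ r (bsize L)) (bsize R) ≡ 0 → ρ r (bsize L) ≡ 0 ⊎ 1 ≤ leftBranch R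
    full leaf       e = inj₁ e
    full (node _ _) e = inj₂ (s≤s z≤n)

  Positive⇒DD : ∀ Tr → Positive 0 (decArities Tr) → ∃ λ B → dyck Tr ≡ DD m B
  Positive⇒DD Tr h = Blocks⇒DD 0 (dyck Tr) (subst (Blocks 0) (++-identityʳ (dyck Tr))
    (Positive⇒Blocks 0 Tr [] h (advance-end 0 Tr h (inj₁ refl))))

  DD⇒Positive : ∀ Tr B → dyck Tr ≡ DD m B → Positive 0 (decArities Tr)
  DD⇒Positive Tr B e = proj₁ (Blocks⇒Positive 0 Tr [] (subst (Blocks 0) (trans (sym e) (sym (++-identityʳ (dyck Tr)))) (Blocks-DD B)))

  rises⇒Blocks : ∀ r w → advance r (leading w) ≡ 0 → All (λ x → advance 0 x ≡ 0) (rList w) → Blocks r w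
  rises⇒Blocks r       []          e _        = e
  rises⇒Blocks r       (true ∷ w)  e h        = rises⇒Blocks (next r) w e h
  rises⇒Blocks zero    (false ∷ w) e (e′ ∷ h) = rises⇒Blocks zero w e′ h

  rises⇒DD : ∀ w → m ∣ leading w → All (m ∣_) (rList w) → ∃ λ B → w ≡ DD m B
  rises⇒DD w d h = Blocks⇒DD 0 w (rises⇒Blocks 0 w (m∣⇒ρ≡0 _ d) (All.map (m∣⇒ρ≡0 _) h))

  -- Relabelling by a function of ρ_i

  -- Expansion and contraction depend on the index only modulo m; carrying the residue makes the
  -- recursion uniform in the subtrees.
  relabelρ : (ℕ → ℕ → ℕ) → ℕ → LTree → LTree
  relabelρ g r lleaf         = lleaf
  relabelρ g r (lnode l L R) = lnode (g (ρ r (lsize L)) l) (relabelρ g r L) (relabelρ g (ρ r (lsize L)) R)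

  mapρ : (ℕ → ℕ → ℕ) → ℕ → List ℕ → List ℕ
  mapρ g r []       = []
  mapρ g r (l ∷ ls) = g (next r) l ∷ mapρ g (next r) ls

  mapρ-++ : ∀ g r xs {n l ys} → length xs ≡ n → mapρ g r (xs ++ l ∷ ys) ≡ mapρ g r xs ++ g (ρ r n) l ∷ mapρ g (ρ r n) ys
  mapρ-++ g r []       refl = refl
  mapρ-++ g r (x ∷ xs) refl = cong (g (next r) x ∷_) (mapρ-++ g (next r) xs refl)

  length-labels′ : ∀ G → length (labels G) ≡ lsize G
  length-labels′ G = trans (length-labels G) (bsize-shape G)

  labels-relabelρ : ∀ g r G → labels (relabelρ g r G) ≡ mapρ g r (labels G)
  labels-relabelρ g r lleaf         = refl
  labels-relabelρ g r (lnode l L R) = trans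
    (cong₂ (λ xs ys → xs ++ g (ρ r (lsize L)) l ∷ ys) (labels-relabelρ g r L) (labels-relabelρ g _ R))
    (sym (mapρ-++ g r (labels L) (length-labels′ L)))

  shape-relabelρ : ∀ g r G → shape (relabelρ g r G) ≡ shape G
  shape-relabelρ g r lleaf         = refl
  shape-relabelρ g r (lnode l L R) = cong₂ node (shape-relabelρ g r L) (shape-relabelρ g _ R)

  lsize-relabelρ : ∀ g r G → lsize (relabelρ g r G) ≡ lsize G
  lsize-relabelρ g r G = trans (sym (bsize-shape (relabelρ g r G))) (trans (cong bsize (shape-relabelρ g r G)) (bsize-shape G))

  relabel≡relabelρ : ∀ {f g} → (∀ i l → f i l ≡ g (advance 0 i) l) → ∀ j G → relabel f j G ≡ relabelρ g (advance 0 j) G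
  relabel≡relabelρ h j lleaf         = refl
  relabel≡relabelρ {f} {g} h j (lnode l L R) = cong₃ lnode
    (trans (h i l) (cong (λ r → g r l) ρ-eq)) (relabel≡relabelρ h j L) (trans (relabel≡relabelρ h i R) (cong (λ r → relabelρ g r R) ρ-eq))
    where
    i = suc (j + lsize L)
    ρ-eq : advance 0 i ≡ ρ (advance 0 j) (lsize L)
    ρ-eq = trans (advance-suc 0 (j + lsize L)) (cong next (advance-+ 0 j (lsize L)))
    cong₃ : ∀ {A B C D : Set} (f : A → B → C → D) {a a′ b b′ c c′} → a ≡ a′ → b ≡ b′ → c ≡ c′ → f a b c ≡ f a′ b′ c′
    cong₃ f refl refl refl = refl

  expandLabel contractLabel : ℕ → ℕ → ℕ
  expandLabel zero    l = m * l
  expandLabel (suc _) l = m * (l ∸ 1)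
  contractLabel zero    l = l / m
  contractLabel (suc _) l = suc (l / m)

  if-∣? : ∀ {A : Set} i {x y : A} (f : ℕ → A) → f 0 ≡ x → (∀ r → f (suc r) ≡ y) →
          (if does (m ∣? i) then x else y) ≡ f (advance 0 i)
  if-∣? {A} i {x} {y} f e e′ = go (m ∣? i) (advance 0 i) refl
    where
    go : (d : Dec (m ∣ i)) → ∀ r → advance 0 i ≡ r → (if does d then x else y) ≡ f r
    go (yes _) zero    _  = sym e
    go (yes d) (suc r) eq with trans (sym eq) (m∣⇒ρ≡0 i d)
    ... | ()
    go (no ¬d) zero    eq = ⊥-elim (¬d (ρ≡0⇒m∣ i eq))
    go (no _)  (suc r) _  = sym (e′ r)

  expandρ contractρ : LTree → LTree
  expandρ   = relabelρ expandLabel 0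
  contractρ = relabelρ contractLabel 0

  expand≡ : ∀ G → expand m G ≡ expandρ G
  expand≡ = relabel≡relabelρ (λ i l → if-∣? i (λ r → expandLabel r l) refl (λ _ → refl)) 0

  contract≡ : ∀ G → contract m G ≡ contractρ G
  contract≡ = relabel≡relabelρ (λ i l → if-∣? i (λ r → contractLabel r l) refl (λ _ → refl)) 0

  m*n/m≡n : ∀ n → (m * n) / m ≡ n
  m*n/m≡n n = trans (cong (_/ m) (*-comm m n)) (m*n/n≡m n m)

  m*[n/m]≡n : ∀ {n} → m ∣ n → m * (n / m) ≡ n
  m*[n/m]≡n {n} d = trans (*-comm m (n / m)) (m/n*n≡m d)

  m∣expandLabel : ∀ r l → m ∣ expandLabel r l
  m∣expandLabel zero    l = m∣m*n l
  m∣expandLabel (suc r) l = m∣m*n (l ∸ 1)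

  contract-expandLabel : ∀ r l → r ≡ 0 ⊎ 1 ≤ l → contractLabel r (expandLabel r l) ≡ l
  contract-expandLabel zero    l       _            = m*n/m≡n l
  contract-expandLabel (suc r) (suc l) _            = cong suc (m*n/m≡n l)
  contract-expandLabel (suc r) zero    (inj₁ ())
  contract-expandLabel (suc r) zero    (inj₂ ())

  expand-contractLabel : ∀ r l → m ∣ l → expandLabel r (contractLabel r l) ≡ l
  expand-contractLabel zero    l d = m*[n/m]≡n d
  expand-contractLabel (suc r) l d = m*[n/m]≡n d

  contractLabel-positive : ∀ r l → r ≡ 0 ⊎ 1 ≤ contractLabel r l
  contractLabel-positive zero    l = inj₁ refl
  contractLabel-positive (suc r) l = inj₂ (s≤s z≤n)

  mapρ-contract-expand : ∀ r ls → Positive r ls → mapρ contractLabel r (mapρ expandLabel r ls) ≡ ls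
  mapρ-contract-expand r []       _       = refl
  mapρ-contract-expand r (l ∷ ls) (p , h) = cong₂ _∷_ (contract-expandLabel (next r) l p) (mapρ-contract-expand (next r) ls h)

  mapρ-expand-contract : ∀ r ls → All (m ∣_) ls → mapρ expandLabel r (mapρ contractLabel r ls) ≡ ls
  mapρ-expand-contract r []       _       = refl
  mapρ-expand-contract r (l ∷ ls) (d ∷ h) = cong₂ _∷_ (expand-contractLabel (next r) l d) (mapρ-expand-contract (next r) ls h)

  Positive-contract : ∀ r ls → Positive r (mapρ contractLabel r ls)
  Positive-contract r []       = tt
  Positive-contract r (l ∷ ls) = contractLabel-positive (next r) l , Positive-contract (next r) ls

  ∣-mapρ-expand : ∀ r ls → All (m ∣_) (mapρ expandLabel r ls)
  ∣-mapρ-expand r []       = []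
  ∣-mapρ-expand r (l ∷ ls) = m∣expandLabel (next r) l ∷ ∣-mapρ-expand (next r) ls

  contract-expand : ∀ G → Positive 0 (labels G) → contractρ (expandρ G) ≡ G
  contract-expand G h = shape-labels-injective _ G
    (trans (shape-relabelρ _ 0 (expandρ G)) (shape-relabelρ _ 0 G))
    (trans (labels-relabelρ _ 0 (expandρ G)) (trans (cong (mapρ contractLabel 0) (labels-relabelρ _ 0 G)) (mapρ-contract-expand 0 (labels G) h)))

  expand-contract : ∀ G → All (m ∣_) (labels G) → expandρ (contractρ G) ≡ G
  expand-contract G h = shape-labels-injective _ G
    (trans (shape-relabelρ _ 0 (contractρ G)) (shape-relabelρ _ 0 G))
    (trans (labels-relabelρ _ 0 (contractρ G)) (trans (cong (mapρ expandLabel 0) (labels-relabelρ _ 0 G)) (mapρ-expand-contract 0 (labels G) h)))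

  -- Validity and slack of expanded trees

  -- One equation for both cases of the expansion: `next r` is k at residue 0 and r - 1 otherwise.
  -- The difference `next r` minus r is what telescopes.
  expandLabel-eq : ∀ r l → r ≡ 0 ⊎ 1 ≤ l → expandLabel r l + r + k ≡ m * l + next r
  expandLabel-eq zero    l       _ = cong (_+ k) (+-identityʳ (m * l))
  expandLabel-eq (suc r) (suc l) _ = lemma k l r
    where
    lemma : ∀ k l r → suc k * l + suc r + k ≡ suc k * suc l + r
    lemma = solve-∀
  expandLabel-eq (suc r) zero (inj₁ ())
  expandLabel-eq (suc r) zero (inj₂ ())

  Positive-labels : ∀ r l L R → Positive r (labels (lnode l L R)) →
    Positive r (labels L) × (ρ r (lsize L) ≡ 0 ⊎ 1 ≤ l) × Positive (ρ r (lsize L)) (labels R)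
  Positive-labels r l L R = Positive-split r (labels L) (length-labels′ L)

  -- ρ telescopes along the nodes of G.
  labelSum-expand : ∀ r G → Positive r (labels G) →
    labelSum (relabelρ expandLabel r G) + next r + k * lsize G ≡ m * labelSum G + ρ r (lsize G)
  labelSum-expand r lleaf         _ = trans (cong (next r +_) (*-zeroʳ k)) (trans (+-identityʳ _) (cong (_+ next r) (sym (*-zeroʳ m))))
  labelSum-expand r (lnode l L R) h with Positive-labels r l L R h
  ... | hL , hl , hR = +-cancelʳ-≡ (q + next q) _ _ (begin
    l′ + SL′ + SR′ + next r + k * suc (nL + nR) + (q + next q)
      ≡⟨ regroup l′ SL′ SR′ (next r) k nL nR q (next q) ⟩
    (SL′ + next r + k * nL) + (l′ + q + k) + (SR′ + next q + k * nR)
      ≡⟨ cong₂ _+_ (cong₂ _+_ (labelSum-expand r L hL) (expandLabel-eq q l hl)) (labelSum-expand q R hR) ⟩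
    (m * labelSum L + q) + (m * l + next q) + (m * labelSum R + ρ q nR)
      ≡⟨ regroup′ m (labelSum L) (labelSum R) l q (next q) (ρ q nR) ⟩
    m * (l + labelSum L + labelSum R) + ρ q nR + (q + next q)
      ≡⟨ cong (λ z → m * (l + labelSum L + labelSum R) + next z + (q + next q)) (advance-node r nL nR) ⟨
    m * (l + labelSum L + labelSum R) + ρ r (suc (nL + nR)) + (q + next q) ∎)
    where
    open ≡-Reasoning
    nL = lsize L
    nR = lsize R
    q = ρ r nL
    l′ = expandLabel q l
    SL′ = labelSum (relabelρ expandLabel r L)
    SR′ = labelSum (relabelρ expandLabel q R)
    regroup : ∀ l a b n k x y q p → l + a + b + n + k * suc (x + y) + (q + p) ≡ (a + n + k * x) + (l + q + k) + (b + p + k * y)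
    regroup = solve-∀
    regroup′ : ∀ m a b l q p z → (m * a + q) + (m * l + p) + (m * b + z) ≡ m * (l + a + b) + z + (q + p)
    regroup′ = solve-∀

  node-expand : ∀ q l R → q ≡ 0 ⊎ 1 ≤ l → Positive q (labels R) → advance q (lsize R) ≡ 0 →
    expandLabel q l + labelSum (relabelρ expandLabel q R) + q + k * lsize R ≡ m * (l + labelSum R)
  node-expand q l R hl hR e = +-cancelʳ-≡ (next q + k) _ _ (begin
    l′ + SR′ + q + k * lsize R + (next q + k)        ≡⟨ regroup l′ SR′ q (k * lsize R) (next q) k ⟩
    (l′ + q + k) + (SR′ + next q + k * lsize R)      ≡⟨ cong₂ _+_ (expandLabel-eq q l hl) (labelSum-expand q R hR) ⟩
    (m * l + next q) + (m * labelSum R + ρ q (lsize R)) ≡⟨ cong (λ z → (m * l + next q) + (m * labelSum R + next z)) e ⟩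
    (m * l + next q) + (m * labelSum R + k)          ≡⟨ regroup′ m l (labelSum R) (next q) k ⟩
    m * (l + labelSum R) + (next q + k)              ∎)
    where
    open ≡-Reasoning
    l′ = expandLabel q l
    SR′ = labelSum (relabelρ expandLabel q R)
    regroup : ∀ l s q n p k → l + s + q + n + (p + k) ≡ (l + q + k) + (s + p + n)
    regroup = solve-∀
    regroup′ : ∀ m l s p k → (m * l + p) + (m * s + k) ≡ m * (l + s) + (p + k)
    regroup′ = solve-∀

  Blocked : ℕ → LTree → Set
  Blocked r G = Positive r (decArities (shape G))

  Blocked-node : ∀ r l L R → Blocked r (lnode l L R) →
    Blocked r L × Blocked (ρ r (lsize L)) R × advance (ρ r (lsize L)) (lsize R) ≡ 0
  Blocked-node r l L R h
    with Positive-split r (decArities (shape L)) (trans (length-decArities (shape L)) (bsize-shape L)) h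
  ... | a , b , c = a , c , trans (cong (advance (ρ r (lsize L))) (sym (bsize-shape R))) (advance-end _ (shape R) c b)

  -- The contribution d of the node becomes `q + m * d`. The term q is its own residue, the one end
  -- of the telescoping sum that remains; at the other end the residue is 0 by `e`.
  slack-node : ∀ q l R → q ≡ 0 ⊎ 1 ≤ l → Positive q (labels R) → advance q (lsize R) ≡ 0 → l + labelSum R ≤ lsize R →
    expandLabel q l + labelSum (relabelρ expandLabel q R) + (q + m * (lsize R ∸ (l + labelSum R))) ≡ lsize R
  slack-node q l R hl hR e le = +-cancelʳ-≡ (k * lsize R) _ _ (begin
    S′ + (q + m * d) + k * lsize R     ≡⟨ regroup S′ q (m * d) (k * lsize R) ⟩
    S′ + q + k * lsize R + m * d       ≡⟨ cong (_+ m * d) (node-expand q l R hl hR e) ⟩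
    m * (l + labelSum R) + m * d       ≡⟨ *-distribˡ-+ m (l + labelSum R) d ⟨
    m * (l + labelSum R + d)           ≡⟨ cong (m *_) (m+[n∸m]≡n le) ⟩
    lsize R + k * lsize R              ∎)
    where
    open ≡-Reasoning
    d = lsize R ∸ (l + labelSum R)
    S′ = expandLabel q l + labelSum (relabelρ expandLabel q R)
    regroup : ∀ s q x n → s + (q + x) + n ≡ s + q + n + x
    regroup = solve-∀

  valid-expand : ∀ r G → Positive r (labels G) → Blocked r G → ValidGT G → ValidGT (relabelρ expandLabel r G)
  valid-expand r lleaf         _ _ _ = tt
  valid-expand r (lnode l L R) h b (le , vL , vR) with Positive-labels r l L R h | Blocked-node r l L R b
  ... | hL , hl , hR | bL , bR , e =
    ≤-trans (≤-trans (m≤m+n _ _) (≤-reflexive (slack-node _ l R hl hR e le))) (≤-reflexive (sym (lsize-relabelρ expandLabel _ R))) ,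
    valid-expand r L hL bL vL , valid-expand _ R hR bR vR

  -- Validity after expansion gives `m * (l + labelSum R)` at most `m * lsize R + q`. As q is at
  -- most k, hence below m, the excess disappears on division by m.
  valid-expand⁻ : ∀ r G → r ≤ k → Positive r (labels G) → Blocked r G → ValidGT (relabelρ expandLabel r G) → ValidGT G
  valid-expand⁻ r lleaf         _ _ _ _ = tt
  valid-expand⁻ r (lnode l L R) r≤k h b (le , vL , vR) with Positive-labels r l L R h | Blocked-node r l L R b
  ... | hL , hl , hR | bL , bR , e = s≤s⁻¹ (*-cancelˡ-< m _ _ (begin-strict
      m * (l + labelSum R)                                 ≡⟨ node-expand q l R hl hR e ⟨
      S′ + q + k * lsize R                                 ≤⟨ +-monoˡ-≤ (k * lsize R) (+-mono-≤ (≤-trans le (≤-reflexive (lsize-relabelρ expandLabel q R))) q≤k) ⟩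
      lsize R + k + k * lsize R                            <⟨ n<1+n _ ⟩
      suc (lsize R + k + k * lsize R)                      ≡⟨ lemma k (lsize R) ⟩
      m * suc (lsize R)                                    ∎)) ,
    valid-expand⁻ r L r≤k hL bL vL , valid-expand⁻ q R q≤k hR bR vR
    where
    open ≤-Reasoning
    q = ρ r (lsize L)
    q≤k : q ≤ k
    q≤k = next≤ (advance≤ (lsize L) r≤k)
    S′ = expandLabel q l + labelSum (relabelρ expandLabel q R)
    lemma : ∀ k s → suc (s + k + k * s) ≡ suc k * suc s
    lemma = solve-∀

  -- The sum of the residues of the next n vertices: the constant that expansion adds to the slack.
  offset : ℕ → ℕ → ℕ
  offset r zero    = 0
  offset r (suc n) = next r + offset (next r) n

  offset-node : ∀ r a b → offset r (suc (a + b)) ≡ offset r a + (ρ r a + offset (ρ r a) b)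
  offset-node r zero    b = refl
  offset-node r (suc a) b = trans (cong (next r +_) (offset-node (next r) a b)) (sym (+-assoc (next r) _ _))

  slack-expand : ∀ r G → Positive r (labels G) → Blocked r G → ValidGT G →
    slack (relabelρ expandLabel r G) ≡ m * slack G + offset r (lsize G)
  slack-expand r lleaf         _ _ _ = sym (trans (+-identityʳ _) (*-zeroʳ m))
  slack-expand r (lnode l L R) h b (le , vL , vR) with Positive-labels r l L R h | Blocked-node r l L R b
  ... | hL , hl , hR | bL , bR , e = begin
    (lsize (relabelρ expandLabel q R) ∸ S′) + slack (relabelρ expandLabel r L) + slack (relabelρ expandLabel q R)
      ≡⟨ cong₂ _+_ (cong₂ _+_ d-eq (slack-expand r L hL bL vL)) (slack-expand q R hR bR vR) ⟩
    (q + m * d) + (m * slack L + offset r (lsize L)) + (m * slack R + offset q (lsize R))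
      ≡⟨ regroup m q d (slack L) (slack R) (offset r (lsize L)) (offset q (lsize R)) ⟩
    m * (d + slack L + slack R) + (offset r (lsize L) + (q + offset q (lsize R)))
      ≡⟨ cong (m * (d + slack L + slack R) +_) (offset-node r (lsize L) (lsize R)) ⟨
    m * slack (lnode l L R) + offset r (lsize (lnode l L R)) ∎
    where
    open ≡-Reasoning
    q = ρ r (lsize L)
    d = lsize R ∸ (l + labelSum R)
    S′ = expandLabel q l + labelSum (relabelρ expandLabel q R)
    d-eq : lsize (relabelρ expandLabel q R) ∸ S′ ≡ q + m * d
    d-eq = begin
      lsize (relabelρ expandLabel q R) ∸ S′ ≡⟨ cong (_∸ S′) (lsize-relabelρ expandLabel q R) ⟩
      lsize R ∸ S′                          ≡⟨ cong (_∸ S′) (slack-node q l R hl hR e le) ⟨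
      S′ + (q + m * d) ∸ S′                 ≡⟨ m+n∸m≡n S′ _ ⟩
      q + m * d                             ∎
    regroup : ∀ m q d a b x y → (q + m * d) + (m * a + x) + (m * b + y) ≡ m * (d + a + b) + (x + (q + y))
    regroup = solve-∀

  -- Over the whole tree the residues begin and end at 0, so the expanded label sum is m times the
  -- old one minus k times the size. Subtracting it from the size gives m times the old number of
  -- roots.
  leftBranch-expand : ∀ G → Positive 0 (labels G) → Blocked 0 G → ValidGT G →
    leftBranch (lower (expandρ G)) ≡ m * leftBranch (lower G)
  leftBranch-expand G h b v = +-cancelˡ-≡ S′ _ _ (+-cancelʳ-≡ (k * n) _ _ (begin
    S′ + leftBranch (lower (expandρ G)) + k * n ≡⟨ cong (_+ k * n) (labels-leftBranch (expandρ G) (valid-expand 0 G h b v)) ⟩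
    lsize (expandρ G) + k * n                   ≡⟨ cong (_+ k * n) (lsize-relabelρ expandLabel 0 G) ⟩
    m * n                                       ≡⟨ cong (m *_) (labels-leftBranch G v) ⟨
    m * (labelSum G + c)                        ≡⟨ *-distribˡ-+ m (labelSum G) c ⟩
    m * labelSum G + m * c                      ≡⟨ cong (_+ m * c) sums ⟨
    S′ + k * n + m * c                          ≡⟨ regroup S′ (k * n) (m * c) ⟩
    S′ + m * c + k * n                          ∎))
    where
    open ≡-Reasoning
    n = lsize G
    c = leftBranch (lower G)
    S′ = labelSum (expandρ G)
    regroup : ∀ a b c → a + b + c ≡ a + c + b
    regroup = solve-∀
    end : advance 0 n ≡ 0
    end = trans (cong (advance 0) (sym (bsize-shape G))) (advance-end 0 (shape G) b (inj₁ refl))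
    sums : S′ + k * n ≡ m * labelSum G
    sums = +-cancelʳ-≡ k _ _ (begin
      S′ + k * n + k             ≡⟨ regroup S′ (k * n) k ⟩
      S′ + k + k * n             ≡⟨ labelSum-expand 0 G h ⟩
      m * labelSum G + ρ 0 n     ≡⟨ cong (λ z → m * labelSum G + next z) end ⟩
      m * labelSum G + k         ∎)

  -- Contacts of the expanded tree

  -- An up step with i > 0 steps left in its block has a contact at the very next up step. The -1 of
  -- the expansion removes precisely this one and leaves the contacts counted from height i after
  -- the block, as c_{i,j} does.
  upContacts-ups : ∀ j w → mapρ expandLabel j (upContacts (replicate j true ++ w)) ≡
                   map (λ i → m * contacts i w) (downFrom j) ++ mapρ expandLabel 0 (upContacts w)
  upContacts-ups zero    w = refl
  upContacts-ups (suc i) w = cong₂ _∷_ (entry i) (upContacts-ups i w)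
    where
    entry : ∀ i → expandLabel i (contacts 0 (replicate i true ++ w)) ≡ m * contacts i w
    entry zero    = refl
    entry (suc i) = cong (m *_) (contacts-ups i 0 w)

  cij-downFrom : ∀ s → map (cij m s) (range1 m) ≡ map (λ i → contacts i (DD m s)) (downFrom m)
  cij-downFrom s = begin
    map (cij m s) (map suc (upTo m))            ≡⟨ cong (map (cij m s)) (map-applyUpTo id suc m) ⟩
    map (cij m s) (applyUpTo suc m)             ≡⟨ map-applyUpTo suc (cij m s) m ⟩
    -- With j = i + 1 the starting height m - j is k - i, so j = 1, ..., m runs through the heights
    -- k, ..., 0.
    applyUpTo (λ i → portionZeros (k ∸ i) s) m  ≡⟨ go k ⟩
    map (λ i → contacts i (DD m s)) (downFrom m) ∎
    where
    open ≡-Reasoning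
    go : ∀ k → applyUpTo (λ i → portionZeros (k ∸ i) s) (suc k) ≡ map (λ i → contacts i (DD m s)) (downFrom (suc k))
    go zero    = cong (_∷ []) (portionZeros-DD 0 s)
    go (suc k) = cong₂ _∷_ (portionZeros-DD (suc k) s) (go k)

  expand-upContacts : ∀ B → mapρ expandLabel 0 (upContacts (DD m B)) ≡ map (m *_) (cVec B)
  expand-upContacts []          = refl
  expand-upContacts (false ∷ B) = expand-upContacts B
  expand-upContacts (true ∷ B)  = begin
    mapρ expandLabel 0 (upContacts (DD m (true ∷ B)))
      ≡⟨ cong (λ w → mapρ expandLabel 0 (upContacts w)) (DD-true k B) ⟩
    mapρ expandLabel m (upContacts (replicate m true ++ DD m B))
      ≡⟨ upContacts-ups m (DD m B) ⟩
    map (λ i → m * contacts i (DD m B)) (downFrom m) ++ mapρ expandLabel 0 (upContacts (DD m B))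
      ≡⟨ cong₂ _++_ (trans (map-∘ (downFrom m)) (cong (map (m *_)) (sym (cij-downFrom B)))) (expand-upContacts B) ⟩
    map (m *_) (map (cij m B) (range1 m)) ++ map (m *_) (cVec B)
      ≡⟨ map-++ (m *_) (map (cij m B) (range1 m)) (cVec B) ⟨
    map (m *_) (cVec (true ∷ B)) ∎
    where open ≡-Reasoning

⟶-irrefl : ∀ {A B} → A ⟶ B → A ≢ B
⟶-irrefl (rot {A} {B}) e = <⇒≢ (s≤s (m≤m+n (bsize A) (bsize B))) (sym (cong bsize (proj₁ (node-injective e))))
⟶-irrefl (left r)      e = ⟶-irrefl r (proj₁ (node-injective e))
⟶-irrefl (right r)     e = ⟶-irrefl r (proj₂ (node-injective e))

monomial-↭ : ∀ {c ℓ} (M : CommutativeMonoid c ℓ) (x : ℕ → CommutativeMonoid.Carrier M) {us vs} → us ↭ vs →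
             CommutativeMonoid._≈_ M (monomial M x us) (monomial M x vs)
monomial-↭ M x = go
  where
  open CommutativeMonoid M renaming (refl to ≈-refl; sym to ≈-sym; trans to ≈-trans)
  go : ∀ {us vs} → us ↭ vs → monomial M x us ≈ monomial M x vs
  go _↭_.refl         = ≈-refl
  go (_↭_.prep v p)   = ∙-congˡ (go p)
  go (_↭_.swap u v p) = ≈-trans (≈-sym (assoc (x u) (x v) _))
    (≈-trans (∙-cong (comm (x u) (x v)) (go p)) (assoc (x v) (x u) _))
  go (_↭_.trans p q)  = ≈-trans (go p) (go q)

Beta-functional : ∀ {G H H′} → Beta G H → Beta G H′ → H ≡ H′
Beta-functional (beta {M} w e f refl) (beta {M′} w′ e′ f′ refl) =
  cong LB (shape-lower-injective M M′ w w′ (trans f (sym f′)) (trans e (sym e′)))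


-- Intervals of Tam_n^m, the involution and the distance

module Involution (k n : ℕ) where
  open Ballot k
  open Expansion k

  treeOf : List Bool → BinTree
  treeOf B = tree (DD m B)

  dyck-treeOf : ∀ {B} → IsBallot m n B → dyck (treeOf B) ≡ DD m B
  dyck-treeOf {B} b = dyck-tree (DD m B) (IsBallot⇒IsDyck b)

  bsize-treeOf : ∀ {B} → IsBallot m n B → bsize (treeOf B) ≡ m * n
  bsize-treeOf {B} b = begin
    bsize (treeOf B)            ≡⟨ countTrue-dyck (treeOf B) ⟨
    countTrue (dyck (treeOf B)) ≡⟨ cong countTrue (dyck-treeOf b) ⟩
    countTrue (DD m B)          ≡⟨ countTrue-DD B ⟩
    m * countTrue B             ≡⟨ cong (m *_) (proj₁ b) ⟩
    m * n                       ∎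
    where open ≡-Reasoning

  treeOf-injective : ∀ {B C} → IsBallot m n B → IsBallot m n C → treeOf B ≡ treeOf C → B ≡ C
  treeOf-injective {B} {C} b c e = DD-injective B C (trans (sym (dyck-treeOf b)) (trans (cong dyck e) (dyck-treeOf c)))

  Positive-treeOf : ∀ {B} → IsBallot m n B → Positive 0 (decArities (treeOf B))
  Positive-treeOf {B} b = DD⇒Positive (treeOf B) B (dyck-treeOf b)

  treeOf-DD : ∀ Tr B → dyck Tr ≡ DD m B → treeOf B ≡ Tr
  treeOf-DD Tr B e = trans (cong tree (sym e)) (tree-dyck Tr)

  ballot-DD : ∀ Tr B → bsize Tr ≡ m * n → dyck Tr ≡ DD m B → IsBallot m n B
  ballot-DD Tr B s e = IsDyck⇒IsBallot B
    (*-cancelˡ-≡ (countTrue B) n m (trans (sym (countTrue-DD B)) (trans (cong countTrue (sym e)) (trans (countTrue-dyck Tr) s))))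
    (subst (IsDyck 0) (trans (++-identityʳ (dyck Tr)) e) (IsDyck-dyck Tr 0 [] refl))

  -- The two conditions needed for expansion come from the two bounds: the labels are the arities of
  -- the lower path, and the upper path makes subtrees end at multiples of m.
  record GraftOf (I : Interval m n) (G : LTree) : Set where
    constructor graftOf
    field
      valid  : ValidGT G
      lower≡ : lower G ≡ treeOf (low I)
      shape≡ : shape G ≡ treeOf (high I)

    positive : Positive 0 (labels G)
    positive = subst (Positive 0) (trans (cong decArities (sym lower≡)) (decArities-lower G valid)) (Positive-treeOf (lowOK I))

    blocked : Blocked 0 G
    blocked = subst (λ Tr → Positive 0 (decArities Tr)) (sym shape≡) (Positive-treeOf (highOK I))

    lsize≡ : lsize G ≡ m * n
    lsize≡ = trans (sym (bsize-lower G)) (trans (cong bsize lower≡) (bsize-treeOf (lowOK I)))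

    valid-expandρ : ValidGT (expandρ G)
    valid-expandρ = valid-expand 0 G positive blocked valid

    labels-expandρ : labels (expandρ G) ≡ map (m *_) (cVec (low I))
    labels-expandρ = begin
      labels (expandρ G)                               ≡⟨ labels-relabelρ expandLabel 0 G ⟩
      mapρ expandLabel 0 (labels G)                    ≡⟨ cong (mapρ expandLabel 0) (decArities-lower G valid) ⟨
      mapρ expandLabel 0 (decArities (lower G))        ≡⟨ cong (λ Tr → mapρ expandLabel 0 (decArities Tr)) lower≡ ⟩
      mapρ expandLabel 0 (decArities (treeOf (low I))) ≡⟨ cong (mapρ expandLabel 0) (upContacts-dyck (treeOf (low I))) ⟨
      mapρ expandLabel 0 (upContacts (dyck (treeOf (low I)))) ≡⟨ cong (λ w → mapρ expandLabel 0 (upContacts w)) (dyck-treeOf (lowOK I)) ⟩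
      mapρ expandLabel 0 (upContacts (DD m (low I)))   ≡⟨ expand-upContacts (low I) ⟩
      map (m *_) (cVec (low I))                        ∎
      where open ≡-Reasoning

    leftBranch-expandρ : leftBranch (lower (expandρ G)) ≡ m * mcontacts m (low I)
    leftBranch-expandρ = begin
      leftBranch (lower (expandρ G))       ≡⟨ leftBranch-expand G positive blocked valid ⟩
      m * leftBranch (lower G)             ≡⟨ cong (λ Tr → m * leftBranch Tr) lower≡ ⟩
      m * leftBranch (treeOf (low I))      ≡⟨ cong (m *_) (contacts-dyck (treeOf (low I))) ⟨
      m * contacts 0 (dyck (treeOf (low I))) ≡⟨ cong (λ w → m * contacts 0 w) (dyck-treeOf (lowOK I)) ⟩
      m * contacts 0 (DD m (low I))        ≡⟨ cong (m *_) (mcontacts-DD (low I) (IsBallot⇒IsDyck (lowOK I))) ⟨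
      m * mcontacts m (low I)              ∎
      where open ≡-Reasoning

    dyck-expandρ : dyck (shape (expandρ G)) ≡ DD m (high I)
    dyck-expandρ = trans (cong dyck (trans (shape-relabelρ expandLabel 0 G) shape≡)) (dyck-treeOf (highOK I))

    slack-expandρ : slack (expandρ G) ≡ m * slack G + offset 0 (m * n)
    slack-expandρ = trans (slack-expand 0 G positive blocked valid) (cong (λ s → m * slack G + offset 0 s) lsize≡)
  open GraftOf

  graftOf-exists : ∀ I → ∃ (GraftOf I)
  graftOf-exists I with graft (proj₂ (toPath (le I)))
  ... | G , v , e , f , _ = G , graftOf v e f

  bsize-trees : ∀ (I : Interval m n) → bsize (treeOf (low I)) ≡ bsize (treeOf (high I))
  bsize-trees I = trans (bsize-treeOf (lowOK I)) (sym (bsize-treeOf (highOK I)))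

  IsGraft⇒GraftOf : ∀ {I G} → IsGraft G (ipOf I) → GraftOf I G
  IsGraft⇒GraftOf {I} {G} (v , E) = let e , f = graftInv-pair {G} (bsize-trees I) E in graftOf v e f

  GraftOf⇒≈ : ∀ {I G} → GraftOf I G → graftInv G ≈IP ipOf I
  GraftOf⇒≈ {I} {G} (graftOf _ e f) = subst₂ (λ A B → graftInv G ≈IP ipOfTrees A B) e f (graftInv≈ipOfTrees G)

  GraftOf-unique : ∀ {I G H} → GraftOf I G → GraftOf I H → G ≡ H
  GraftOf-unique (graftOf v e f) (graftOf w e′ f′) = shape-lower-injective _ _ v w (trans f (sym f′)) (trans e (sym e′))

  interval : ∀ G → ValidGT G → Positive 0 (labels G) → Blocked 0 G → lsize G ≡ m * n → ∃ λ J → GraftOf J G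
  interval G v h b s with Positive⇒DD (lower G) (subst (Positive 0) (sym (decArities-lower G v)) h) | Positive⇒DD (shape G) b
  ... | B₁ , e₁ | B₂ , e₂ = J , graftOf v (sym t₁) (sym t₂)
    where
    t₁ : treeOf B₁ ≡ lower G
    t₁ = treeOf-DD (lower G) B₁ e₁
    t₂ : treeOf B₂ ≡ shape G
    t₂ = treeOf-DD (shape G) B₂ e₂
    J : Interval m n
    J = record
      { low = B₁ ; high = B₂
      ; lowOK = ballot-DD (lower G) B₁ (trans (bsize-lower G) s) e₁
      ; highOK = ballot-DD (shape G) B₂ (trans (bsize-shape G) s) e₂
      ; le = subst₂ _≤T_ (sym t₁) (sym t₂) (lower≤shape G v) }

  -- β exchanges the rises with the labels, so it preserves the intervals whose
  -- rises and contacts are all divisible by m, i.e. the expanded ones.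
  module _ {I G F} (g : GraftOf I G) (b : Beta (expandρ G) F) where

    rises↭labels : map (m *_) (rList (high I)) ↭ labels F
    rises↭labels = ↭-trans (↭-reflexive (sym (trans (cong rList (dyck-expandρ g)) (rList-DD (high I))))) (Beta-rList b)

    ∣labels : All (m ∣_) (labels F)
    ∣labels = All-resp-↭ rises↭labels (multiples (rList (high I)))
      where
      multiples : ∀ xs → All (m ∣_) (map (m *_) xs)
      multiples []       = []
      multiples (x ∷ xs) = m∣m*n x ∷ multiples xs

    private
      H = contractρ F
      c : Beta F (expandρ G)
      c = Beta-sym (valid-expandρ g) b

    lsize-F : lsize F ≡ m * n
    lsize-F = trans (sym (Beta-size b)) (trans (lsize-relabelρ expandLabel 0 G) (lsize≡ g))

    expand-H : expandρ H ≡ F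
    expand-H = expand-contract F ∣labels

    positive-H : Positive 0 (labels H)
    positive-H = subst (Positive 0) (sym (labels-relabelρ contractLabel 0 F)) (Positive-contract 0 (labels F))

    -- Read through the inverse of β, the rises of the upper bound of F are the root count and the
    -- labels of the expanded G, all multiples of m. So its word consists of complete blocks.
    blocked-H : Blocked 0 H
    blocked-H with rises⇒DD (dyck (shape F))
                     (subst (m ∣_) (sym (trans (Beta-leading c) (leftBranch-expandρ g))) (m∣m*n _))
                     (All-resp-↭ (↭-sym (Beta-rList c)) (subst (All (m ∣_)) (sym (labels-relabelρ expandLabel 0 G)) (∣-mapρ-expand 0 (labels G))))
    ... | B , e = subst (λ Tr → Positive 0 (decArities Tr)) (sym (shape-relabelρ contractLabel 0 F)) (DD⇒Positive (shape F) B e)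

    valid-H : ValidGT H
    valid-H = valid-expand⁻ 0 H z≤n positive-H blocked-H (subst ValidGT (sym expand-H) (Beta-valid b))

    lsize-H : lsize H ≡ m * n
    lsize-H = trans (lsize-relabelρ contractLabel 0 F) lsize-F

  -- `BetaM` with posets replaced by trees; totality, symmetry and uniqueness are proved in this
  -- form and then transferred.
  record Link (I J : Interval m n) : Set where
    constructor link
    field
      {G F}  : LTree
      source : GraftOf I G
      image  : Beta (expandρ G) F
      target : GraftOf J (contractρ F)

  Link-total : ∀ I → ∃ (Link I)
  Link-total I with graftOf-exists I
  ... | G , g with Beta-total (expandρ G) (valid-expandρ g)
  ... | F , b with interval (contractρ F) (valid-H g b) (positive-H g b) (blocked-H g b) (lsize-H g b)
  ... | J , h = J , link g b h

  Link-sym : ∀ {I J} → Link I J → Link J I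
  Link-sym {I} {J} (link {G} {F} g b h) = link h
    (subst (λ E → Beta E (expandρ G)) (sym (expand-H g b)) (Beta-sym (valid-expandρ g) b))
    (subst (GraftOf I) (sym (contract-expand G (positive g))) g)

  Link-functional : ∀ {I J J′} → Link I J → Link I J′ → SameInterval J J′
  Link-functional {I} {J} {J′} (link g b h) (link g′ b′ h′) with GraftOf-unique g g′
  ... | refl with Beta-functional b b′
  ... | refl = treeOf-injective (lowOK J) (lowOK J′) (trans (sym (lower≡ h)) (lower≡ h′)) ,
               treeOf-injective (highOK J) (highOK J′) (trans (sym (shape≡ h)) (shape≡ h′))

  compl-graftInv : ∀ G → compl (graftInv G) ≈IP ipOfTrees (mirror (shape G)) (mirror (lower G))
  compl-graftInv G = ≈IP-trans (compl-cong (graftInv≈ipOfTrees G)) (compl-ipOfTrees (lower G) (shape G) (bsize-lower-shape G))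

  Link⇒BetaM : ∀ {I J} → Link I J → BetaM m n I J
  Link⇒BetaM {I} {J} (link {G} {F} g (beta {M} w e f refl) h) = record
    { g0 = G ; g1 = expandρ G ; g2 = M ; g3 = LB M
    ; is0 = valid g , GraftOf⇒≈ g
    ; is1 = valid-expandρ g , subst (λ E → graftInv (expandρ G) ≈IP graftInv E) (sym (expand≡ G)) ≈IP-refl
    ; is2 = w , ≈IP-trans (subst₂ (λ A B → graftInv M ≈IP ipOfTrees A B) e f (graftInv≈ipOfTrees M))
                  (≈IP-sym (compl-graftInv (LB (expandρ G))))
    ; is3 = valid-LB M w , ≈IP-refl
    ; res = subst (λ E → ipOf J ≈IP graftInv E) (sym (contract≡ (LB M))) (≈IP-sym (GraftOf⇒≈ h)) }

  -- Injectivity of `graftInv` and of `ipOfTrees` identifies the supplied witnesses, one after the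
  -- other, with the trees of the construction.
  BetaM⇒Link : ∀ {I J} → BetaM m n I J → Link I J
  BetaM⇒Link {I} {J} r = link g b (graftOf (valid-H g b) (proj₁ pairJ) (proj₂ pairJ))
    where
    open BetaM r
    g : GraftOf I g0
    g = IsGraft⇒GraftOf is0
    g1≡ : g1 ≡ expandρ g0
    g1≡ = graftInv-injective (proj₁ is1) (valid-expandρ g) (subst (λ E → graftInv g1 ≈IP graftInv E) (expand≡ g0) (proj₂ is1))
    sizes : bsize (mirror (shape (LB g1))) ≡ bsize (mirror (lower (LB g1)))
    sizes = trans (bsize-mirror (shape (LB g1))) (trans (sym (bsize-lower-shape (LB g1))) (sym (bsize-mirror (lower (LB g1)))))
    pair₂ : lower g2 ≡ mirror (shape (LB g1)) × shape g2 ≡ mirror (lower (LB g1))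
    pair₂ = graftInv-pair {g2} sizes (≈IP-trans (proj₂ is2) (compl-graftInv (LB g1)))
    b : Beta (expandρ g0) g3
    b = subst (λ E → Beta E g3) g1≡ (beta (proj₁ is2) (proj₁ pair₂) (proj₂ pair₂)
      (graftInv-injective (proj₁ is3) (valid-LB g2 (proj₁ is2)) (proj₂ is3)))
    pairJ : lower (contractρ g3) ≡ treeOf (low J) × shape (contractρ g3) ≡ treeOf (high J)
    pairJ = graftInv-pair {contractρ g3} (bsize-trees J) (≈IP-sym (subst (λ E → ipOf J ≈IP graftInv E) (contract≡ g3) res))

  target-F : ∀ {I J} (L : Link I J) → expandρ (contractρ (Link.F L)) ≡ Link.F L
  target-F (link g b h) = expand-H g b

  Link-mrises : ∀ {I J} → Link I J → mrises (high I) ≡ mcontacts m (low J)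
  Link-mrises {I} {J} L@(link {G} {F} g b h) = *-cancelˡ-≡ _ _ m (begin
    m * mrises (high I)                       ≡⟨ leading-DD (high I) ⟨
    leading (DD m (high I))                   ≡⟨ cong leading (dyck-expandρ g) ⟨
    leading (dyck (shape (expandρ G)))        ≡⟨ Beta-leading b ⟩
    leftBranch (lower F)                      ≡⟨ cong (leftBranch ∘ lower) (target-F L) ⟨
    leftBranch (lower (expandρ (contractρ F))) ≡⟨ leftBranch-expandρ h ⟩
    m * mcontacts m (low J)                   ∎)
    where open ≡-Reasoning

  map-m*-cancel : ∀ {xs ys} → map (m *_) xs ↭ map (m *_) ys → xs ↭ ys
  map-m*-cancel {xs} {ys} p = ↭-trans (↭-reflexive (sym (undo xs))) (↭-trans (map⁺ (_/ m) p) (↭-reflexive (undo ys)))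
    where
    undo : ∀ xs → map (_/ m) (map (m *_) xs) ≡ xs
    undo xs = trans (sym (map-∘ xs)) (trans (map-cong m*n/m≡n xs) (map-id xs))

  -- Both vectors, multiplied by m, are read off the expanded trees exchanged by β; division by m
  -- carries the permutation back.
  Link-vectors : ∀ {I J} → Link I J → riseVec (high I) ↭ contactVec m (low J)
  Link-vectors {I} {J} L@(link {G} {F} g b h) = ↭-trans (↭-prep _ (map-m*-cancel (begin
    map (m *_) (dropLast (rList (high I)))        ≡⟨ dropLast-map (m *_) (rList (high I)) ⟨
    dropLast (map (m *_) (rList (high I)))        ≡⟨ cong dropLast (trans (cong rList (dyck-expandρ g)) (rList-DD (high I))) ⟨
    dropLast (rList (dyck (shape (expandρ G))))   ↭⟨ Beta-dropLast b ⟩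
    dropLast (labels F)                           ≡⟨ cong (dropLast ∘ labels) (target-F L) ⟨
    dropLast (labels (expandρ (contractρ F)))     ≡⟨ cong dropLast (labels-expandρ h) ⟩
    dropLast (map (m *_) (cVec (low J)))          ≡⟨ dropLast-map (m *_) (cVec (low J)) ⟩
    map (m *_) (dropLast (cVec (low J)))          ∎)))
    (↭-reflexive (cong (_∷ dropLast (cVec (low J))) (Link-mrises L)))
    where open PermutationReasoning

  -- Both expansions add the same offset, since it depends on the size alone; it cancels, and then
  -- so does the factor m.
  Link-slack : ∀ {I J} (L : Link I J) → slack (Link.G L) ≡ slack (contractρ (Link.F L))
  Link-slack {I} {J} L@(link {G} {F} g b h) = *-cancelˡ-≡ _ _ m (+-cancelʳ-≡ (offset 0 (m * n)) _ _ (begin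
    m * slack G + offset 0 (m * n)             ≡⟨ slack-expandρ g ⟨
    slack (expandρ G)                          ≡⟨ Beta-slack (valid-expandρ g) b ⟩
    slack F                                    ≡⟨ cong slack (target-F L) ⟨
    slack (expandρ (contractρ F))              ≡⟨ slack-expandρ h ⟩
    m * slack (contractρ F) + offset 0 (m * n) ∎))
    where open ≡-Reasoning

  -- The upper set property makes every tree on the path the tree of an m-ballot path, so each
  -- rotation is a strict step within Tam_n^m.
  Path⇒Chain : ∀ {A C j} → Path A C j → ∀ {B B′} → IsBallot m n B → IsBallot m n B′ →
               treeOf B ≡ A → treeOf B′ ≡ C → Chain m n B B′ j
  Path⇒Chain []      {B} b b′ e e′ with treeOf-injective b b′ (trans e (sym e′))
  ... | refl = done
  Path⇒Chain (_∷_ {T' = A′} r p) {B} b b′ refl e′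
    with Positive⇒DD A′ (Positive-⟶ 0 r (Positive-treeOf b))
  ... | B″ , f = step b″ (subst (treeOf B ≤T_) (sym t) (r ◅ ε) , λ { refl → ⟶-irrefl r t }) (Path⇒Chain p b″ b′ t e′)
    where
    t : treeOf B″ ≡ A′
    t = treeOf-DD A′ B″ f
    b″ : IsBallot m n B″
    b″ = ballot-DD A′ B″ (trans (sym (⟶-bsize r)) (bsize-treeOf b)) f

  -- A strict step joins different trees and therefore refines into at least one rotation.
  Chain⇒Path : ∀ {B B′ j} → IsBallot m n B → Chain m n B B′ j → ∃ λ i → j ≤ i × Path (treeOf B) (treeOf B′) i
  Chain⇒Path b done = 0 , z≤n , []
  Chain⇒Path b (step {B} {C} c (le , ne) ch) with toPath le | Chain⇒Path c ch
  ... | i , p | j , h , q = i + j , +-mono-≤ (positive-length p) h , p ++ᴾ q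
    where
    positive-length : ∀ {i} → Path (treeOf B) (treeOf C) i → 1 ≤ i
    positive-length {suc i} _ = s≤s z≤n
    positive-length {zero}  p = ⊥-elim (ne (treeOf-injective b c (same-end p)))
      where
      same-end : ∀ {A C} → Path A C 0 → A ≡ C
      same-end [] = refl

  -- The slack is attained by a longest Tamari path, which is a chain in Tam_n^m, and bounds every
  -- chain because refining can only lengthen it.
  IsDist-slack : ∀ {I G} → GraftOf I G → IsDist m n I (slack G)
  IsDist-slack {I} {G} (graftOf v e f) =
    Path⇒Chain (longestPath G v) (lowOK I) (highOK I) (sym e) (sym f) ,
    λ j ch → let i , h , p = Chain⇒Path (lowOK I) ch in
      ≤-trans h (Path≤slack G v (subst₂ (λ A B → Path A B i) (sym e) (sym f) p))

theorem5p18 : ∀ {c ℓ} (m : ℕ) .{{_ : NonZero m}} (n : ℕ) →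
  -- β_m is defined on every interval of Tam_n^m (and is a function)
  ((I : Interval m n) → Σ (Interval m n) (λ J → BetaM m n I J)) ×
  ((I J J' : Interval m n) → BetaM m n I J → BetaM m n I J' → SameInterval J J') ×
  -- involution, and statistics exchanged / preserved
  ((I J : Interval m n) → BetaM m n I J →
      BetaM m n J I ×
      mrises (high I) ≡ mcontacts m (low J) ×
      ((M : CommutativeMonoid c ℓ) (x : ℕ → CommutativeMonoid.Carrier M) →
        CommutativeMonoid._≈_ M (mRiseMon M x (high I)) (mContactMon M m x (low J))) ×
      Σ ℕ (λ d → IsDist m n I d × IsDist m n J d))
theorem5p18 (suc k) n =
  (λ I → let J , L = Link-total I in J , Link⇒BetaM L) ,
  (λ I J J' r r' → Link-functional (BetaM⇒Link r) (BetaM⇒Link r')) ,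
  λ I J r → let L = BetaM⇒Link r in
    Link⇒BetaM (Link-sym L) , Link-mrises L , (λ M x → monomial-↭ M x (Link-vectors L)) ,
    slack (Link.G L) , IsDist-slack (Link.source L) ,
    subst (IsDist (suc k) n J) (sym (Link-slack L)) (IsDist-slack (Link.target L))
  where open Involution k n
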